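{- Let $q$ be a prime power with $q\equiv1\pmod 4$ and let $d$ be an odd positive integer with $q\equiv-1\pmod d$. Let $s=\nu_2(q-1)$ (so $s\ge2$). Fix a primitive $2^s$-th root of unity $\alpha_{2^s}\in\mathbb{F}_q^*$ and put $\alpha_{2^k}=\alpha_{2^s}^{2^{s-k}}$ for $1\le k\le s$ (so $\alpha_2=-1$ and $\alpha_{2^{k-1}}=\alpha_{2^k}^2$); fix $\beta_{2^{s+1}}\in\mathbb{F}_{q^2}$ with $\beta_{2^{s+1}}^2=\alpha_{2^s}$ (a primitive $2^{s+1}$-th root of unity). Let $\gamma$ be a primitive $d$-th root of unity in $\mathbb{F}_{q^2}$ and set $\delta_j=\gamma^j+\gamma^{qj}$, $\theta_j=\gamma^j-\gamma^{qj}$. Then: (i) For $2\le k\le s$, $\Phi_{2^k}(x^d)$ factors into $2^{k-2}(d+1)$ monic irreducible factors over $\mathbb{F}_q$ as $$\Phi_{2^k}(x^d)=\prod_{i=1}^{2^{k-2}}\left[\left(x\pm\alpha_{2^k}^{2i-1}\right)\prod_{j=1}^{(d-1)/2}\left(x^2\pm\alpha_{2^k}^{2i-1}\delta_jx+\alpha_{2^{k-1}}^{2i-1}\right)\right].$$ (ii) For every integer $r\ge1$, $\Phi_{2^{s+r}}(x^d)$ factors into $2^{s-1}d$ monic irreducible factors over $\mathbb{F}_q$ as $$\Phi_{2^{s+r}}(x^d)=\prod_{i=1}^{2^{s-2}}\left[\left(x^{2^r}\pm\alpha_{2^s}^{2i-1}\right)\prod_{j=1}^{(d-1)/2}\prod_{l=0}^{1}\left(x^{2^r}\pm\alpha_4^{l}\beta_{2^{s+1}}^{2i-1}\theta_jx^{2^{r-1}}-\alpha_2^{l}\alpha_{2^s}^{2i-1}\right)\right].$$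 In particular all coefficients appearing above lie in $\mathbb{F}_q$.
   Context: $\nu_2(l)$ is the exponent of the largest power of $2$ dividing $l$; $\Phi_N$ is the $N$-th cyclotomic polynomial. Notation: for expressions $A,B$, the factor $(A\pm B)$ means the product $(A+B)(A-B)$; similarly $(x^2\pm ux+v)$ means $(x^2+ux+v)(x^2-ux+v)$ and $(x^{2^r}\pm ux^{2^{r-1}}+v)$ means $(x^{2^r}+ux^{2^{r-1}}+v)(x^{2^r}-ux^{2^{r-1}}+v)$. -}

module Defs where

open import Level using (Level; _⊔_)
open import Data.Nat.Base as ℕ using (ℕ; zero; suc; _<_; _≤_; ⌊_/2⌋)
open import Data.Nat.Primality using (Prime)
open import Data.Fin.Base using (Fin)
open import Data.List.Base as List using (List; []; _∷_; _++_; map; foldr; replicate; concatMap; upTo)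
open import Data.Product.Base using (Σ; ∃; _×_; _,_)
open import Data.Sum.Base using (_⊎_)
open import Relation.Nullary using (¬_)
open import Relation.Binary.PropositionalEquality using (_≡_)
open import Algebra.Bundles using (CommutativeRing; RawRing)
import Algebra.Definitions.RawSemiring as RS

IsPrimePower : ℕ → Set
IsPrimePower q = Σ ℕ λ p → Σ ℕ λ m → Prime p × 1 ≤ m × q ≡ p ℕ.^ m

oneTo : ℕ → List ℕ
oneTo n = map suc (upTo n)

module _ {c ℓ : Level} (R : CommutativeRing c ℓ) where
  open CommutativeRing R
  open RS (RawRing.rawSemiring rawRing) using (_^_)

  pow : Carrier → ℕ → Carrier
  pow x n = x ^ n

  IsField : Set (c ⊔ ℓ)
  IsField = ¬ (1# ≈ 0#) × (∀ x → ¬ (x ≈ 0#) → ∃ λ y → x * y ≈ 1#)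

  HasCard : ℕ → Set (c ⊔ ℓ)
  HasCard n = Σ (Fin n → Carrier) λ e →
    (∀ i j → e i ≈ e j → i ≡ j) × (∀ x → ∃ λ i → e i ≈ x)

  IsPrimitiveRoot : ℕ → Carrier → Set ℓ
  IsPrimitiveRoot N x = (x ^ N ≈ 1#) × (∀ m → 0 < m → m < N → ¬ (x ^ m ≈ 1#))

  -- Polynomials over R as coefficient lists (constant term first)

  Poly : Set c
  Poly = List Carrier

  coeff : Poly → ℕ → Carrier
  coeff []       _       = 0#
  coeff (a ∷ p)  zero    = a
  coeff (a ∷ p)  (suc n) = coeff p n

  _≋_ : Poly → Poly → Set ℓ
  p ≋ q = ∀ n → coeff p n ≈ coeff q n

  _+ₚ_ : Poly → Poly → Poly
  []      +ₚ q       = q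
  (a ∷ p) +ₚ []      = a ∷ p
  (a ∷ p) +ₚ (b ∷ q) = (a + b) ∷ (p +ₚ q)

  _·ₚ_ : Carrier → Poly → Poly
  a ·ₚ p = map (a *_) p

  _*ₚ_ : Poly → Poly → Poly
  []      *ₚ q = []
  (a ∷ p) *ₚ q = (a ·ₚ q) +ₚ (0# ∷ (p *ₚ q))

  cst : Carrier → Poly
  cst a = a ∷ []

  Xpow : ℕ → Poly
  Xpow n = replicate n 0# ++ (1# ∷ [])

  prodₚ : List Poly → Poly
  prodₚ = foldr _*ₚ_ (cst 1#)

  compose : Poly → Poly → Poly
  compose []      g = []
  compose (a ∷ p) g = cst a +ₚ (g *ₚ compose p g)

  Monic : Poly → Set ℓ
  Monic p = ∃ λ n → (coeff p n ≈ 1#) × (∀ m → n < m → coeff p m ≈ 0#)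

  IsConstant : Poly → Set ℓ
  IsConstant p = ∀ m → 1 ≤ m → coeff p m ≈ 0#

  -- irreducible in R[x] (R a field): non-constant, and in every
  -- factorisation one factor is constant (i.e. a unit)
  Irreducible : Poly → Set (c ⊔ ℓ)
  Irreducible p = ¬ IsConstant p × (∀ g h → p ≋ (g *ₚ h) → IsConstant g ⊎ IsConstant h)

  -- the cyclotomic polynomial Φ_{2^k}(x) = x^{2^(k-1)} + 1  (k ≥ 1)
  cyclo2pow : ℕ → Poly
  cyclo2pow k = Xpow (2 ℕ.^ (k ℕ.∸ 1)) +ₚ cst 1#

  pmBin : ℕ → Carrier → List Poly
  pmBin n a = (Xpow n +ₚ cst a) ∷ (Xpow n +ₚ cst (- a)) ∷ []

  pmTri : ℕ → ℕ → Carrier → Carrier → List Poly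
  pmTri n m u v = ((Xpow n +ₚ (u ·ₚ Xpow m)) +ₚ cst v)
                ∷ ((Xpow n +ₚ ((- u) ·ₚ Xpow m)) +ₚ cst v) ∷ []

  -- The factor lists of Theorem 3.2, written in R = F_{q^2}.
  -- a2s = α_{2^s} (image in R), b = β_{2^{s+1}}, g = γ.
  module Factors (q d s : ℕ) (a2s b g : Carrier) where

    α : ℕ → Carrier
    α k = a2s ^ (2 ℕ.^ (s ℕ.∸ k))

    δ θ : ℕ → Carrier
    δ j = (g ^ j) + (g ^ (q ℕ.* j))
    θ j = (g ^ j) - (g ^ (q ℕ.* j))

    odd : ℕ → ℕ
    odd i = 2 ℕ.* i ℕ.∸ 1

    factorsI : ℕ → List Poly
    factorsI k = concatMap (λ i →
        pmBin 1 (α k ^ odd i)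
        ++ concatMap (λ j → pmTri 2 1 ((α k ^ odd i) * δ j) (α (k ℕ.∸ 1) ^ odd i))
                     (oneTo ⌊ d ℕ.∸ 1 /2⌋))
      (oneTo (2 ℕ.^ (k ℕ.∸ 2)))

    factorsII : ℕ → List Poly
    factorsII r = concatMap (λ i →
        pmBin (2 ℕ.^ r) (α s ^ odd i)
        ++ concatMap (λ j → concatMap (λ l →
              pmTri (2 ℕ.^ r) (2 ℕ.^ (r ℕ.∸ 1))
                    (((α 2 ^ l) * (b ^ odd i)) * θ j)
                    (- ((α 1 ^ l) * (α s ^ odd i))))
              (0 ∷ 1 ∷ []))
           (oneTo ⌊ d ℕ.∸ 1 /2⌋))
      (oneTo (2 ℕ.^ (s ℕ.∸ 2)))

module _ {c ℓ : Level} (F K : CommutativeRing c ℓ)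
         (ι : CommutativeRing.Carrier F → CommutativeRing.Carrier K) where

  mapₚ : Poly F → Poly K
  mapₚ = map ι

  MonicIrreducibleOver : Poly K → Set (c ⊔ ℓ)
  MonicIrreducibleOver f = ∃ λ (g : Poly F) → Monic F g × Irreducible F g × _≋_ K (mapₚ g) f

{-# OPTIONS --safe #-}
module Submission where

-- Irreducibility.  Let ω ∈ K be a root of x² + ux + v ∈ F[x] not lying in F.  If ω is a nonsquare
-- of K, then adjoining √ω, √√ω, … to K gives a tower of proper quadratic extensions: from
-- (a + b√ρ)² = √ρ one gets ρ = −(a/b)², a square because −1 is one.  After n steps the generator ρ
-- has degree 2ⁿ⁺¹ over F and is a root of x^(2ⁿ⁺¹) + ux^(2ⁿ) + v, which is therefore irreducible.
-- All ω needed for (ii) are nonsquares because ω^((q²−1)/2) = −1.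
--
-- Rationality.  K = F ⊕ Fβ by counting.  The norm of γʲ is a d-th root of unity in F, and
-- gcd(d, q − 1) = 1, so the norm is 1 and γʲ, γ^(qj) = γ⁻ʲ are conjugate: δⱼ ∈ F and θⱼ ∈ Fβ.
--
-- Product.  Each block of factors is a product of (y − w)∏ⱼ(y − wγʲ)(y − wγ⁻ʲ) = yᵈ − wᵈ over
-- w = ±ζ (or ±w, ±α₄w), and the blocks are multiplied by ∏ᵢ(Y − η²ⁱ⁻¹) = Y^(2ⁿ) + 1 for η^(2ⁿ) = −1.

open import Defs
open import Level using (Level; _⊔_)
open import Data.Empty using (⊥-elim)
open import Data.Fin.Base as Fin using (Fin; punchIn; punchOut)
open import Data.Fin.Permutation using (Permutation; permutation)
import Data.Fin.Properties as Finₚ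
open import Data.List.Base using (List; []; _∷_; _++_; map; drop; length; foldr; concatMap; applyUpTo)
import Data.List.Properties as Listₚ
open import Data.List.Relation.Unary.All as All using (All; []; _∷_)
import Data.List.Relation.Unary.All.Properties as Allₚ
open import Data.List.Relation.Unary.AllPairs using (AllPairs; []; _∷_)
open import Data.Nat.Base as ℕ using (ℕ; zero; suc; _<_; _≤_; z≤n; s≤s; ⌊_/2⌋)
open import Data.Nat.Divisibility using (_∣_; divides; ∣-trans)
open import Data.Nat.DivMod using (_%_; _/_; m≡m%n+[m/n]*n; m%n<n)
import Data.Nat.Properties as ℕₚ
open import Data.Nat.Solver using (module +-*-Solver)
open import Data.Product.Base using (∃; ∃₂; _×_; _,_; proj₁; proj₂)
open import Data.Sum.Base using (_⊎_; inj₁; inj₂)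
open import Data.Vec.Functional using (removeAt; replicate)
open import Function.Base using (_∘_; case_of_)
open import Relation.Binary.Definitions using (tri<; tri≈; tri>)
open import Relation.Binary.PropositionalEquality as ≡ using (_≡_)
import Relation.Binary.Reasoning.Setoid as SetoidReasoning
open import Relation.Nullary using (¬_; Dec; yes; no)
open import Algebra.Bundles using (CommutativeRing)
open import Algebra.Morphism.Structures using (module RingMorphisms)
import Algebra.Properties.CommutativeMonoid.Sum as Sum
import Algebra.Properties.CommutativeSemigroup as SemigroupProperties
import Algebra.Properties.CommutativeSemiring.Exp as Exp
import Algebra.Properties.Ring as RingProperties
import Algebra.Solver.Ring.NaturalCoefficients.Default as Solver

-- The value -1 of ω^((q² - 1)/2) comes from β alone, and it is where q ≡ 1 (mod 4) and the
-- exactness of s enter. Write q = 1 + 4C. Then (q² - 1)/2 = 4C(2C + 1), and β² = α turns this power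
-- of β into (α^(2C))^(2C + 1). Exactness makes 2C an odd multiple of 2^(s - 1), so α^(2C) = -1, and
-- the outer exponent is odd. The same value keeps ω out of F, since elements of F* have power 1;
-- for ω = β this gives F ∩ Fβ = 0, which the counting argument uses. Conjugation is the sign change
-- of β in coordinates on F ⊕ Fβ, not the Frobenius map: its multiplicativity is then a computation
-- from β² = α, and uniqueness of coordinates carries g^d = 1 over to the conjugate. In (i) no tower
-- is built: a quadratic is irreducible as soon as its root is outside F, and there it is outside
-- because 1 is the only d-th root of unity in F. The binomials of (ii) are treated as trinomials
-- with u = 0, coming from the root of unity 1 in place of γʲ.

-- Ring homomorphisms and signs of powers

IsHom : {c ℓ : Level} (R S : CommutativeRing c ℓ) →
  (CommutativeRing.Carrier R → CommutativeRing.Carrier S) → Set (c ⊔ ℓ)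
IsHom R S = RingMorphisms.IsRingHomomorphism (CommutativeRing.rawRing R) (CommutativeRing.rawRing S)

module _ {c ℓ : Level} (R S : CommutativeRing c ℓ) where
  private
    module R = CommutativeRing R
    module S = CommutativeRing S
  open SetoidReasoning S.setoid
  open RingProperties S.ring using (+-inverseˡ-unique)

  -- Negatives are preserved automatically, because f (- x) is an additive inverse of f x; this
  -- leaves five laws to check for each homomorphism below.
  isHom : (f : R.Carrier → S.Carrier) →
    (∀ {x y} → x R.≈ y → f x S.≈ f y) →
    (∀ x y → f (x R.+ y) S.≈ f x S.+ f y) →
    (∀ x y → f (x R.* y) S.≈ f x S.* f y) →
    f R.0# S.≈ S.0# → f R.1# S.≈ S.1# → IsHom R S f
  isHom f f-cong f-+ f-* f-0 f-1 = record
    { isSemiringHomomorphism = record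
      { isNearSemiringHomomorphism = record
        { +-isMonoidHomomorphism = record
          { isMagmaHomomorphism = record
            { isRelHomomorphism = record { cong = f-cong }
            ; homo = f-+ }
          ; ε-homo = f-0 }
        ; *-homo = f-* }
      ; 1#-homo = f-1 }
    ; -‿homo = λ x → +-inverseˡ-unique (f (R.- x)) (f x) (begin
        f (R.- x) S.+ f x   ≈⟨ f-+ (R.- x) x ⟨
        f (R.- x R.+ x)     ≈⟨ f-cong (R.-‿inverseˡ x) ⟩
        f R.0#              ≈⟨ f-0 ⟩
        S.0#                ∎) }

module HomProperties {c ℓ : Level} (R S : CommutativeRing c ℓ)
  (f : CommutativeRing.Carrier R → CommutativeRing.Carrier S) (f-hom : IsHom R S f) where
  private
    module R = CommutativeRing R
    module S = CommutativeRing S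
  open RingMorphisms.IsRingHomomorphism f-hom public
    using (⟦⟧-cong; +-homo; *-homo; 0#-homo; 1#-homo; -‿homo)

  ^-homo : ∀ x n → f (pow R x n) S.≈ pow S (f x) n
  ^-homo x zero    = 1#-homo
  ^-homo x (suc n) = S.trans (*-homo x (pow R x n)) (S.*-congˡ (^-homo x n))

module CommutativeRingProperties {c ℓ : Level} (R : CommutativeRing c ℓ) where
  open CommutativeRing R
  open RingProperties ring using (-‿distribˡ-*; -‿distribʳ-*; -‿involutive)
  open Exp commutativeSemiring using (_^_; ^-congˡ; ^-congʳ; ^-homo-*; ^-distrib-*)
  open SemigroupProperties *-commutativeSemigroup public using () renaming (interchange to *-interchange)

  1^n≈1 : ∀ n → 1# ^ n ≈ 1#
  1^n≈1 zero    = refl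
  1^n≈1 (suc n) = trans (*-identityˡ _) (1^n≈1 n)

  -x*-y≈xy : ∀ x y → - x * - y ≈ x * y
  -x*-y≈xy x y = trans (sym (-‿distribˡ-* x (- y))) (trans (-‿cong (sym (-‿distribʳ-* x y))) (-‿involutive _))

  -- Odd numbers are written `suc (n + n)` throughout: the even part splits as xⁿ · xⁿ, where the
  -- signs cancel in pairs.
  -x^odd≈-[x^odd] : ∀ x n → (- x) ^ suc (n ℕ.+ n) ≈ - (x ^ suc (n ℕ.+ n))
  -x^odd≈-[x^odd] x n = trans (*-congˡ even) (sym (-‿distribˡ-* x _))
    where
    even : (- x) ^ (n ℕ.+ n) ≈ x ^ (n ℕ.+ n)
    even = trans (^-homo-* (- x) n n) (trans (sym (^-distrib-* (- x) (- x) n))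
      (trans (^-congˡ n (-x*-y≈xy x x)) (trans (^-distrib-* x x n) (sym (^-homo-* x n n)))))

  -1^odd≈-1 : ∀ n → (- 1#) ^ suc (n ℕ.+ n) ≈ - 1#
  -1^odd≈-1 n = trans (-x^odd≈-[x^odd] 1# n) (-‿cong (1^n≈1 (suc (n ℕ.+ n))))

  ^-2* : ∀ x n → x ^ (2 ℕ.* n) ≈ x ^ (n ℕ.+ n)
  ^-2* x n = ^-congʳ x (≡.cong (n ℕ.+_) (ℕₚ.+-identityʳ n))

isHom-id : {c ℓ : Level} (R : CommutativeRing c ℓ) → IsHom R R (λ x → x)
isHom-id R = isHom R R (λ x → x) (λ e → e) (λ _ _ → refl) (λ _ _ → refl) refl refl
  where open CommutativeRing R

isHom-∘ : {c ℓ : Level} (R S T : CommutativeRing c ℓ) →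
  {f : CommutativeRing.Carrier R → CommutativeRing.Carrier S} →
  {g : CommutativeRing.Carrier S → CommutativeRing.Carrier T} →
  IsHom R S f → IsHom S T g → IsHom R T (λ x → g (f x))
isHom-∘ R S T {f} {g} f-hom g-hom = isHom R T (λ x → g (f x))
  (λ e → G.⟦⟧-cong (F.⟦⟧-cong e))
  (λ x y → trans (G.⟦⟧-cong (F.+-homo x y)) (G.+-homo (f x) (f y)))
  (λ x y → trans (G.⟦⟧-cong (F.*-homo x y)) (G.*-homo (f x) (f y)))
  (trans (G.⟦⟧-cong F.0#-homo) G.0#-homo)
  (trans (G.⟦⟧-cong F.1#-homo) G.1#-homo)
  where
  open CommutativeRing T using (trans)
  module F = HomProperties R S f f-hom
  module G = HomProperties S T g g-hom

-- Polynomial rings, evaluation and an irreducibility criterion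

module Polynomials {c ℓ : Level} (R : CommutativeRing c ℓ) where
  open CommutativeRing R
  open RingProperties ring using (-0#≈0#)
  open SetoidReasoning setoid

  infix  4 _≐_
  infixl 6 _⊞_
  infixl 7 _⊠_

  _⊞_ _⊠_ : Poly R → Poly R → Poly R
  _⊞_ = _+ₚ_ R
  _⊠_ = _*ₚ_ R

  -- _≋_ R unfolds to a Π-type, from which Agda cannot infer the two polynomials.
  record _≐_ (p q : Poly R) : Set ℓ where
    constructor mk
    field at : ∀ n → coeff R p n ≈ coeff R q n
  open _≐_ public

  ≐-refl : ∀ {p} → p ≐ p
  ≐-refl = mk λ _ → refl

  ≐-sym : ∀ {p q} → p ≐ q → q ≐ p
  ≐-sym e = mk λ n → sym (at e n)

  ≐-trans : ∀ {p q r} → p ≐ q → q ≐ r → p ≐ r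
  ≐-trans e e′ = mk λ n → trans (at e n) (at e′ n)

  coeff-⊞ : ∀ p q n → coeff R (p ⊞ q) n ≈ coeff R p n + coeff R q n
  coeff-⊞ []      q       n       = sym (+-identityˡ _)
  coeff-⊞ (a ∷ p) []      n       = sym (+-identityʳ _)
  coeff-⊞ (a ∷ p) (b ∷ q) zero    = refl
  coeff-⊞ (a ∷ p) (b ∷ q) (suc n) = coeff-⊞ p q n

  coeff-· : ∀ a p n → coeff R (_·ₚ_ R a p) n ≈ a * coeff R p n
  coeff-· a []      n       = sym (zeroʳ a)
  coeff-· a (b ∷ p) zero    = refl
  coeff-· a (b ∷ p) (suc n) = coeff-· a p n

  ∷-cong : ∀ {a b p q} → a ≈ b → p ≐ q → (a ∷ p) ≐ (b ∷ q)
  ∷-cong e e′ = mk λ { zero → e ; (suc n) → at e′ n }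

  ∷-head : ∀ {a b p q} → (a ∷ p) ≐ (b ∷ q) → a ≈ b
  ∷-head e = at e 0

  ∷-tail : ∀ {a b p q} → (a ∷ p) ≐ (b ∷ q) → p ≐ q
  ∷-tail e = mk λ n → at e (suc n)

  -- Products leave trailing zeros, so one polynomial has many coefficient lists; this is the basic
  -- identification among them.
  0∷[]≐[] : (0# ∷ []) ≐ []
  0∷[]≐[] = mk λ { zero → refl ; (suc n) → refl }

  ⊞-cong : ∀ {p q r s} → p ≐ q → r ≐ s → p ⊞ r ≐ q ⊞ s
  ⊞-cong {p} {q} {r} {s} e e′ = mk λ n → begin
    coeff R (p ⊞ r) n             ≈⟨ coeff-⊞ p r n ⟩
    coeff R p n + coeff R r n     ≈⟨ +-cong (at e n) (at e′ n) ⟩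
    coeff R q n + coeff R s n     ≈⟨ coeff-⊞ q s n ⟨
    coeff R (q ⊞ s) n             ∎

  ⊞-assoc : ∀ p q r → (p ⊞ q) ⊞ r ≐ p ⊞ (q ⊞ r)
  ⊞-assoc p q r = mk λ n → begin
    coeff R ((p ⊞ q) ⊞ r) n                      ≈⟨ trans (coeff-⊞ (p ⊞ q) r n) (+-congʳ (coeff-⊞ p q n)) ⟩
    (coeff R p n + coeff R q n) + coeff R r n    ≈⟨ +-assoc _ _ _ ⟩
    coeff R p n + (coeff R q n + coeff R r n)    ≈⟨ trans (coeff-⊞ p (q ⊞ r) n) (+-congˡ (coeff-⊞ q r n)) ⟨
    coeff R (p ⊞ (q ⊞ r)) n                      ∎

  ⊞-comm : ∀ p q → p ⊞ q ≐ q ⊞ p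
  ⊞-comm p q = mk λ n → trans (coeff-⊞ p q n) (trans (+-comm _ _) (sym (coeff-⊞ q p n)))

  ⊞-identityʳ : ∀ p → p ⊞ [] ≐ p
  ⊞-identityʳ p = mk λ n → trans (coeff-⊞ p [] n) (+-identityʳ _)

  ⊟_ : Poly R → Poly R
  ⊟_ = map (-_)

  coeff-⊟ : ∀ p n → coeff R (⊟ p) n ≈ - coeff R p n
  coeff-⊟ []      n       = sym -0#≈0#
  coeff-⊟ (a ∷ p) zero    = refl
  coeff-⊟ (a ∷ p) (suc n) = coeff-⊟ p n

  ⊟-cong : ∀ {p q} → p ≐ q → ⊟ p ≐ ⊟ q
  ⊟-cong {p} {q} e = mk λ n → trans (coeff-⊟ p n) (trans (-‿cong (at e n)) (sym (coeff-⊟ q n)))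

  ⊟-inverseˡ : ∀ p → ⊟ p ⊞ p ≐ []
  ⊟-inverseˡ p = mk λ n → trans (coeff-⊞ (⊟ p) p n) (trans (+-congʳ (coeff-⊟ p n)) (-‿inverseˡ _))

  ·-cong : ∀ {a b p q} → a ≈ b → p ≐ q → _·ₚ_ R a p ≐ _·ₚ_ R b q
  ·-cong {a} {b} {p} {q} e e′ = mk λ n →
    trans (coeff-· a p n) (trans (*-cong e (at e′ n)) (sym (coeff-· b q n)))

  ·-distribˡ : ∀ a p q → _·ₚ_ R a (p ⊞ q) ≐ _·ₚ_ R a p ⊞ _·ₚ_ R a q
  ·-distribˡ a p q = mk λ n → begin
    coeff R (_·ₚ_ R a (p ⊞ q)) n             ≈⟨ trans (coeff-· a (p ⊞ q) n) (*-congˡ (coeff-⊞ p q n)) ⟩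
    a * (coeff R p n + coeff R q n)          ≈⟨ distribˡ _ _ _ ⟩
    a * coeff R p n + a * coeff R q n        ≈⟨ +-cong (coeff-· a p n) (coeff-· a q n) ⟨
    coeff R (_·ₚ_ R a p) n + coeff R (_·ₚ_ R a q) n  ≈⟨ coeff-⊞ (_·ₚ_ R a p) _ n ⟨
    coeff R (_·ₚ_ R a p ⊞ _·ₚ_ R a q) n      ∎

  ·-distribʳ : ∀ a b p → _·ₚ_ R (a + b) p ≐ _·ₚ_ R a p ⊞ _·ₚ_ R b p
  ·-distribʳ a b p = mk λ n → begin
    coeff R (_·ₚ_ R (a + b) p) n             ≈⟨ coeff-· (a + b) p n ⟩
    (a + b) * coeff R p n                    ≈⟨ distribʳ _ _ _ ⟩
    a * coeff R p n + b * coeff R p n        ≈⟨ +-cong (coeff-· a p n) (coeff-· b p n) ⟨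
    coeff R (_·ₚ_ R a p) n + coeff R (_·ₚ_ R b p) n  ≈⟨ coeff-⊞ (_·ₚ_ R a p) _ n ⟨
    coeff R (_·ₚ_ R a p ⊞ _·ₚ_ R b p) n      ∎

  ·-assoc : ∀ a b p → _·ₚ_ R (a * b) p ≐ _·ₚ_ R a (_·ₚ_ R b p)
  ·-assoc a b p = mk λ n → trans (coeff-· (a * b) p n) (trans (*-assoc _ _ _)
    (sym (trans (coeff-· a (_·ₚ_ R b p) n) (*-congˡ (coeff-· b p n)))))

  0·p≐[] : ∀ p → _·ₚ_ R 0# p ≐ []
  0·p≐[] p = mk λ n → trans (coeff-· 0# p n) (zeroˡ _)

  1·p≐p : ∀ p → _·ₚ_ R 1# p ≐ p
  1·p≐p p = mk λ n → trans (coeff-· 1# p n) (*-identityˡ _)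

  ⊞-interchange : ∀ p q r s → (p ⊞ q) ⊞ (r ⊞ s) ≐ (p ⊞ r) ⊞ (q ⊞ s)
  ⊞-interchange p q r s = ≐-trans (⊞-assoc p q (r ⊞ s))
    (≐-trans (⊞-cong (≐-refl {p}) (≐-trans (≐-sym (⊞-assoc q r s))
      (≐-trans (⊞-cong (⊞-comm q r) (≐-refl {s})) (⊞-assoc r q s))))
      (≐-sym (⊞-assoc p r (q ⊞ s))))

  ⊠-congˡ : ∀ p {q r} → q ≐ r → p ⊠ q ≐ p ⊠ r
  ⊠-congˡ []      e = ≐-refl
  ⊠-congˡ (a ∷ p) e = ⊞-cong (·-cong refl e) (∷-cong refl (⊠-congˡ p e))

  ⊠-zeroʳ : ∀ p → p ⊠ [] ≐ []
  ⊠-zeroʳ []      = ≐-refl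
  ⊠-zeroʳ (a ∷ p) = ≐-trans (∷-cong refl (⊠-zeroʳ p)) 0∷[]≐[]

  -- The definition recurses on the left factor; this is the mirrored recursion on the right one,
  -- and commutativity follows by comparing the two.
  ⊠-∷ : ∀ p b q → p ⊠ (b ∷ q) ≐ _·ₚ_ R b p ⊞ (0# ∷ (p ⊠ q))
  ⊠-∷ []      b q = ≐-sym 0∷[]≐[]
  ⊠-∷ (a ∷ p) b q = ∷-cong (+-congʳ (*-comm a b))
    (≐-trans (⊞-cong (≐-refl {_·ₚ_ R a q}) (⊠-∷ p b q))
    (≐-trans (≐-sym (⊞-assoc (_·ₚ_ R a q) (_·ₚ_ R b p) (0# ∷ (p ⊠ q))))
    (≐-trans (⊞-cong (⊞-comm (_·ₚ_ R a q) (_·ₚ_ R b p)) (≐-refl {0# ∷ (p ⊠ q)}))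
      (⊞-assoc (_·ₚ_ R b p) (_·ₚ_ R a q) (0# ∷ (p ⊠ q))))))

  ⊠-comm : ∀ p q → p ⊠ q ≐ q ⊠ p
  ⊠-comm []      q = ≐-sym (⊠-zeroʳ q)
  ⊠-comm (a ∷ p) q = ≐-trans (⊞-cong (≐-refl {_·ₚ_ R a q}) (∷-cong refl (⊠-comm p q))) (≐-sym (⊠-∷ q a p))

  ⊠-cong : ∀ {p q r s} → p ≐ q → r ≐ s → p ⊠ r ≐ q ⊠ s
  ⊠-cong {p} {q} {r} {s} e e′ = ≐-trans (⊠-congˡ p e′)
    (≐-trans (⊠-comm p s) (≐-trans (⊠-congˡ s e) (⊠-comm s q)))

  ⊠-distribʳ : ∀ r p q → (p ⊞ q) ⊠ r ≐ (p ⊠ r) ⊞ (q ⊠ r)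
  ⊠-distribʳ r []      q       = ≐-refl
  ⊠-distribʳ r (a ∷ p) []      = ≐-sym (⊞-identityʳ _)
  ⊠-distribʳ r (a ∷ p) (b ∷ q) = ≐-trans
    (⊞-cong (·-distribʳ a b r) (≐-trans (∷-cong refl (⊠-distribʳ r p q)) (∷-cong (sym (+-identityˡ 0#)) ≐-refl)))
    (⊞-interchange (_·ₚ_ R a r) (_·ₚ_ R b r) (0# ∷ (p ⊠ r)) (0# ∷ (q ⊠ r)))

  ·-⊠ : ∀ a p q → _·ₚ_ R a p ⊠ q ≐ _·ₚ_ R a (p ⊠ q)
  ·-⊠ a []      q = ≐-refl
  ·-⊠ a (b ∷ p) q = ≐-trans
    (⊞-cong (·-assoc a b q) (∷-cong (sym (zeroʳ a)) (·-⊠ a p q)))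
    (≐-sym (·-distribˡ a (_·ₚ_ R b q) (0# ∷ (p ⊠ q))))

  ⊠-assoc : ∀ p q r → (p ⊠ q) ⊠ r ≐ p ⊠ (q ⊠ r)
  ⊠-assoc []      q r = ≐-refl
  ⊠-assoc (a ∷ p) q r = ≐-trans (⊠-distribʳ r (_·ₚ_ R a q) (0# ∷ (p ⊠ q)))
    (⊞-cong (·-⊠ a q r) (≐-trans (⊞-cong (0·p≐[] r) ≐-refl) (∷-cong refl (⊠-assoc p q r))))

  cst-⊠ : ∀ a p → cst R a ⊠ p ≐ _·ₚ_ R a p
  cst-⊠ a p = ≐-trans (⊞-cong (≐-refl {_·ₚ_ R a p}) 0∷[]≐[]) (⊞-identityʳ _)

  ⊠-identityˡ : ∀ p → cst R 1# ⊠ p ≐ p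
  ⊠-identityˡ p = ≐-trans (cst-⊠ 1# p) (1·p≐p p)

  polyRing : CommutativeRing c ℓ
  polyRing = record
    { Carrier = Poly R ; _≈_ = _≐_ ; _+_ = _⊞_ ; _*_ = _⊠_ ; -_ = ⊟_ ; 0# = [] ; 1# = cst R 1#
    ; isCommutativeRing = record
      { isRing = record
        { +-isAbelianGroup = record
          { isGroup = record
            { isMonoid = record
              { isSemigroup = record
                { isMagma = record
                  { isEquivalence = record { refl = ≐-refl ; sym = ≐-sym ; trans = ≐-trans }
                  ; ∙-cong = ⊞-cong }
                ; assoc = ⊞-assoc }
              ; identity = (λ _ → ≐-refl) , ⊞-identityʳ }
            ; inverse = ⊟-inverseˡ , λ p → ≐-trans (⊞-comm p (⊟ p)) (⊟-inverseˡ p)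
            ; ⁻¹-cong = ⊟-cong }
          ; comm = ⊞-comm }
        ; *-cong = ⊠-cong
        ; *-assoc = ⊠-assoc
        ; *-identity = ⊠-identityˡ , λ p → ≐-trans (⊠-comm p _) (⊠-identityˡ p)
        ; distrib = (λ p q r → ≐-trans (⊠-comm p (q ⊞ r)) (≐-trans (⊠-distribʳ p q r)
            (⊞-cong (⊠-comm q p) (⊠-comm r p)))) , ⊠-distribʳ }
      ; *-comm = ⊠-comm } }

  cst-isHom : IsHom R polyRing (cst R)
  cst-isHom = isHom R polyRing (cst R) (λ e → ∷-cong e ≐-refl) (λ _ _ → ≐-refl)
    (λ a b → ≐-sym (≐-trans (cst-⊠ a (cst R b)) ≐-refl)) 0∷[]≐[] ≐-refl

  X : Poly R
  X = Xpow R 1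

  X⊠ : ∀ p → X ⊠ p ≐ (0# ∷ p)
  X⊠ p = ≐-trans (⊞-cong (0·p≐[] p) ≐-refl) (∷-cong refl (⊠-identityˡ p))

  Xpow≐X^ : ∀ n → Xpow R n ≐ pow polyRing X n
  Xpow≐X^ zero    = ≐-refl
  Xpow≐X^ (suc n) = ≐-trans (∷-cong refl (Xpow≐X^ n)) (≐-sym (X⊠ (pow polyRing X n)))

  -- One step of Horner's scheme inside `polyRing`; it turns recursion on lists into identities of
  -- ring elements.
  ∷≐cst⊞X⊠ : ∀ a p → (a ∷ p) ≐ cst R a ⊞ X ⊠ p
  ∷≐cst⊞X⊠ a p = ≐-trans (∷-cong (sym (+-identityʳ a)) ≐-refl) (⊞-cong (≐-refl {cst R a}) (≐-sym (X⊠ p)))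

  coeff-Xpow-≡ : ∀ n → coeff R (Xpow R n) n ≈ 1#
  coeff-Xpow-≡ zero    = refl
  coeff-Xpow-≡ (suc n) = coeff-Xpow-≡ n

  coeff-Xpow-≢ : ∀ n m → ¬ m ≡ n → coeff R (Xpow R n) m ≈ 0#
  coeff-Xpow-≢ zero    zero    m≢n = ⊥-elim (m≢n ≡.refl)
  coeff-Xpow-≢ zero    (suc m) m≢n = refl
  coeff-Xpow-≢ (suc n) zero    m≢n = refl
  coeff-Xpow-≢ (suc n) (suc m) m≢n = coeff-Xpow-≢ n m λ e → m≢n (≡.cong suc e)

  coeff-cst : ∀ a m → 0 < m → coeff R (cst R a) m ≈ 0#
  coeff-cst a (suc m) _ = refl

  -- The bound is strict, so that it also covers the zero polynomial without a convention for its
  -- degree.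
  DegreeBelow : ℕ → Poly R → Set ℓ
  DegreeBelow n p = ∀ m → n ≤ m → coeff R p m ≈ 0#

  MonicOfDegree : ℕ → Poly R → Set ℓ
  MonicOfDegree n p = (coeff R p n ≈ 1#) × DegreeBelow (suc n) p

  -- In the coefficient of index m + k every product other than that of the two top coefficients has
  -- a factor beyond a degree bound.
  coeff-⊠-top : ∀ m k p q → DegreeBelow (suc m) p → DegreeBelow (suc k) q →
    coeff R (p ⊠ q) (m ℕ.+ k) ≈ coeff R p m * coeff R q k
  coeff-⊠-top m k [] q _ _ = sym (zeroˡ _)
  coeff-⊠-top zero k (a ∷ p) q p< q< = begin
    coeff R (_·ₚ_ R a q ⊞ (0# ∷ (p ⊠ q))) k                    ≈⟨ coeff-⊞ (_·ₚ_ R a q) _ k ⟩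
    coeff R (_·ₚ_ R a q) k + coeff R (0# ∷ (p ⊠ q)) k  ≈⟨ +-cong (coeff-· a q k)
      (trans (at (∷-cong refl (⊠-cong p≐[] (≐-refl {q}))) k) (at 0∷[]≐[] k)) ⟩
    a * coeff R q k + 0#                                      ≈⟨ +-identityʳ _ ⟩
    a * coeff R q k                                           ∎
    where
    p≐[] : p ≐ []
    p≐[] = mk λ n → p< (suc n) (s≤s z≤n)
  coeff-⊠-top (suc m) k (a ∷ p) q p< q< = begin
    coeff R (_·ₚ_ R a q ⊞ (0# ∷ (p ⊠ q))) (suc (m ℕ.+ k))     ≈⟨ coeff-⊞ (_·ₚ_ R a q) _ (suc (m ℕ.+ k)) ⟩
    coeff R (_·ₚ_ R a q) (suc (m ℕ.+ k)) + coeff R (p ⊠ q) (m ℕ.+ k)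
      ≈⟨ +-cong (trans (coeff-· a q _) (*-congˡ (q< _ (s≤s (ℕₚ.m≤n+m k m)))))
                (coeff-⊠-top m k p q (λ n m<n → p< (suc n) (s≤s m<n)) q<) ⟩
    a * 0# + coeff R p m * coeff R q k                        ≈⟨ trans (+-congʳ (zeroʳ a)) (+-identityˡ _) ⟩
    coeff R p m * coeff R q k                                 ∎

  -- Because of trailing zeros the length of a list says nothing about the degree; decidable
  -- equality locates the last nonzero coefficient.
  degree : (∀ x y → Dec (x ≈ y)) → ∀ p →
    (p ≐ []) ⊎ (∃ λ n → ¬ (coeff R p n ≈ 0#) × DegreeBelow (suc n) p)
  degree _≟_ [] = inj₁ ≐-refl
  degree _≟_ (a ∷ p) with degree _≟_ p
  ... | inj₂ (n , lead≉0 , p<) = inj₂ (suc n , lead≉0 , λ { (suc m) (s≤s n<m) → p< m n<m })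
  ... | inj₁ p≐[] with a ≟ 0#
  ...   | yes a≈0 = inj₁ (≐-trans (∷-cong a≈0 p≐[]) 0∷[]≐[])
  ...   | no  a≉0 = inj₂ (0 , a≉0 , λ { (suc m) _ → at p≐[] m })

-- Coefficients pass through φ on the way. With S a field extension this gives values at ω and along
-- the tower; with S a polynomial ring it gives substitution and coefficientwise maps.
module Evaluation {c ℓ : Level} (R S : CommutativeRing c ℓ)
  (φ : CommutativeRing.Carrier R → CommutativeRing.Carrier S) (φ-hom : IsHom R S φ)
  (a : CommutativeRing.Carrier S) where
  private module R = CommutativeRing R
  open CommutativeRing S
  open Polynomials R
  open HomProperties R S φ φ-hom
  open SetoidReasoning setoid
  open Solver commutativeSemiring using (solve; _:=_; _:+_; _:*_)

  ev : Poly R → Carrier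
  ev []      = 0#
  ev (x ∷ p) = φ x + a * ev p

  -- Equal polynomials can have lists of different lengths; this disposes of the surplus zeros of
  -- the longer one.
  ev-[] : ∀ p → p ≐ [] → ev p ≈ 0#
  ev-[] []      e = refl
  ev-[] (x ∷ p) e = begin
    φ x + a * ev p    ≈⟨ +-cong (trans (⟦⟧-cong (at e 0)) 0#-homo) (*-congˡ (ev-[] p (mk λ n → at e (suc n)))) ⟩
    0# + a * 0#       ≈⟨ trans (+-identityˡ _) (zeroʳ a) ⟩
    0#                ∎

  ev-cong : ∀ {p q} → p ≐ q → ev p ≈ ev q
  ev-cong {[]}    {q}     e = sym (ev-[] q (≐-sym e))
  ev-cong {x ∷ p} {[]}    e = ev-[] (x ∷ p) e
  ev-cong {x ∷ p} {y ∷ q} e = +-cong (⟦⟧-cong (∷-head e)) (*-congˡ (ev-cong (∷-tail e)))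

  ev-⊞ : ∀ p q → ev (p ⊞ q) ≈ ev p + ev q
  ev-⊞ []      q       = sym (+-identityˡ _)
  ev-⊞ (x ∷ p) []      = sym (+-identityʳ _)
  ev-⊞ (x ∷ p) (y ∷ q) = begin
    φ (x R.+ y) + a * ev (p ⊞ q)        ≈⟨ +-cong (+-homo x y) (*-congˡ (ev-⊞ p q)) ⟩
    φ x + φ y + a * (ev p + ev q)       ≈⟨ solve 5 (λ x y a p q →
      x :+ y :+ a :* (p :+ q) := (x :+ a :* p) :+ (y :+ a :* q)) refl (φ x) (φ y) a (ev p) (ev q) ⟩
    (φ x + a * ev p) + (φ y + a * ev q) ∎

  ev-· : ∀ x p → ev (_·ₚ_ R x p) ≈ φ x * ev p
  ev-· x []      = sym (zeroʳ _)
  ev-· x (y ∷ p) = begin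
    φ (x R.* y) + a * ev (_·ₚ_ R x p)   ≈⟨ +-cong (*-homo x y) (*-congˡ (ev-· x p)) ⟩
    φ x * φ y + a * (φ x * ev p)        ≈⟨ solve 4 (λ x y a p →
      x :* y :+ a :* (x :* p) := x :* (y :+ a :* p)) refl (φ x) (φ y) a (ev p) ⟩
    φ x * (φ y + a * ev p)              ∎

  ev-⊠ : ∀ p q → ev (p ⊠ q) ≈ ev p * ev q
  ev-⊠ []      q = sym (zeroˡ _)
  ev-⊠ (x ∷ p) q = begin
    ev (_·ₚ_ R x q ⊞ (R.0# ∷ (p ⊠ q)))            ≈⟨ ev-⊞ (_·ₚ_ R x q) (R.0# ∷ (p ⊠ q)) ⟩
    ev (_·ₚ_ R x q) + (φ R.0# + a * ev (p ⊠ q))   ≈⟨ +-cong (ev-· x q) (trans (+-congʳ 0#-homo) (+-identityˡ _)) ⟩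
    φ x * ev q + a * ev (p ⊠ q)                   ≈⟨ +-congˡ (*-congˡ (ev-⊠ p q)) ⟩
    φ x * ev q + a * (ev p * ev q)                ≈⟨ solve 4 (λ x a p q →
      x :* q :+ a :* (p :* q) := (x :+ a :* p) :* q) refl (φ x) a (ev p) (ev q) ⟩
    (φ x + a * ev p) * ev q                       ∎

  ev-cst : ∀ x → ev (cst R x) ≈ φ x
  ev-cst x = trans (+-congˡ (zeroʳ a)) (+-identityʳ _)

  ev-Xpow : ∀ n → ev (Xpow R n) ≈ pow S a n
  ev-Xpow zero    = trans (ev-cst R.1#) 1#-homo
  ev-Xpow (suc n) = trans (+-cong 0#-homo (*-congˡ (ev-Xpow n))) (+-identityˡ _)

NoZeroDivisors : {c ℓ : Level} → CommutativeRing c ℓ → Set (c ⊔ ℓ)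
NoZeroDivisors S = ∀ x y → x * y ≈ 0# → x ≈ 0# ⊎ y ≈ 0#
  where open CommutativeRing S

Discrete : {c ℓ : Level} → CommutativeRing c ℓ → Set (c ⊔ ℓ)
Discrete S = ∀ x y → Dec (x ≈ y)
  where open CommutativeRing S

module _ {c ℓ : Level} (S : CommutativeRing c ℓ) where
  open CommutativeRing S
  open SetoidReasoning setoid

  field⇒noZeroDivisors : IsField S → Discrete S → NoZeroDivisors S
  field⇒noZeroDivisors (_ , inverse) _≟_ x y xy≈0 with x ≟ 0#
  ... | yes x≈0 = inj₁ x≈0
  ... | no  x≉0 = let x′ , xx′≈1 = inverse x x≉0 in inj₂ (begin
    y               ≈⟨ *-identityˡ y ⟨
    1# * y          ≈⟨ *-congʳ (trans (*-comm x′ x) xx′≈1) ⟨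
    (x′ * x) * y    ≈⟨ *-assoc x′ x y ⟩
    x′ * (x * y)    ≈⟨ *-congˡ xy≈0 ⟩
    x′ * 0#         ≈⟨ zeroʳ x′ ⟩
    0#              ∎)

module _ {c ℓ : Level} (F L : CommutativeRing c ℓ)
  (φ : CommutativeRing.Carrier F → CommutativeRing.Carrier L) (φ-hom : IsHom F L φ)
  (ρ : CommutativeRing.Carrier L) where
  private
    module F = CommutativeRing F
    module L = CommutativeRing L
  open Polynomials F
  open Evaluation F L φ φ-hom ρ

  -- Linear independence of 1, ρ, ..., ρⁿ⁻¹ over F, in terms of polynomials. Together with a monic
  -- relation of degree n it says that ρ has degree n over F.
  Independent : ℕ → Set (c ⊔ ℓ)
  Independent n = ∀ p → DegreeBelow n p → ev p L.≈ L.0# → p ≐ []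

  -- If f = gh, one factor vanishes at ρ because L has no zero divisors. Independence forces that
  -- factor to have degree at least n, so nothing is left for the other one.
  irreducible : IsField F → Discrete F → NoZeroDivisors L → ∀ n f → 1 ≤ n → Independent n →
    MonicOfDegree n f → ev f L.≈ L.0# → Irreducible F f
  irreducible F-field _≟_ noZeroDiv n f 1≤n indep (f-lead , f<) f-root = f-nonconstant , split
    where
    1≉0 : ¬ (F.1# F.≈ F.0#)
    1≉0 = proj₁ F-field

    f-nonconstant : ¬ IsConstant F f
    f-nonconstant const = 1≉0 (F.trans (F.sym f-lead) (const n 1≤n))

    f≭[] : ¬ (f ≐ [])
    f≭[] e = 1≉0 (F.trans (F.sym f-lead) (at e n))

    cofactor-constant : ∀ g h → f ≐ g ⊠ h → ev g L.≈ L.0# → IsConstant F h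
    cofactor-constant g h f≐gh g-root with degree _≟_ g | degree _≟_ h
    ... | inj₁ g≐[] | _ = ⊥-elim (f≭[] (≐-trans f≐gh (⊠-cong g≐[] (≐-refl {h}))))
    ... | inj₂ _ | inj₁ h≐[] = λ m _ → at h≐[] m
    ... | inj₂ (dg , lg , g<) | inj₂ (dh , lh , h<) = λ m 1≤m → h< m (≡.subst (_≤ m) (≡.cong suc (≡.sym dh≡0)) 1≤m)
      where
      lead≉0 : ¬ (coeff F g dg F.* coeff F h dh F.≈ F.0#)
      lead≉0 e with field⇒noZeroDivisors F F-field _≟_ _ _ e
      ... | inj₁ e₁ = lg e₁
      ... | inj₂ e₂ = lh e₂

      n≤dg : n ≤ dg
      n≤dg = ℕₚ.≮⇒≥ λ dg<n → lg (at (indep g (λ m n≤m → g< m (ℕₚ.≤-trans dg<n n≤m)) g-root) dg)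

      dg+dh≤n : dg ℕ.+ dh ≤ n
      dg+dh≤n = ℕₚ.≮⇒≥ λ n< → lead≉0 (F.trans (F.sym (coeff-⊠-top dg dh g h g< h<))
        (F.trans (F.sym (at f≐gh (dg ℕ.+ dh))) (f< _ n<)))

      dh≡0 : dh ≡ 0
      dh≡0 = ℕₚ.n≤0⇒n≡0 (ℕₚ.+-cancelˡ-≤ dg dh 0
        (ℕₚ.≤-trans dg+dh≤n (ℕₚ.≤-trans n≤dg (ℕₚ.≤-reflexive (≡.sym (ℕₚ.+-identityʳ dg))))))

    split : ∀ g h → _≋_ F f (_*ₚ_ F g h) → IsConstant F g ⊎ IsConstant F h
    split g h f≋gh with noZeroDiv (ev g) (ev h)
      (L.trans (L.sym (ev-⊠ g h)) (L.trans (L.sym (ev-cong {f} {g ⊠ h} (mk f≋gh))) f-root))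
    ... | inj₁ g-root = inj₂ (cofactor-constant g h (mk f≋gh) g-root)
    ... | inj₂ h-root = inj₁ (cofactor-constant h g (≐-trans (mk f≋gh) (⊠-comm g h)) h-root)

-- Towers of quadratic extensions

NonSquare : {c ℓ : Level} (L : CommutativeRing c ℓ) → CommutativeRing.Carrier L → Set (c ⊔ ℓ)
NonSquare L ρ = ∀ x → ¬ (x * x ≈ ρ)
  where open CommutativeRing L

module QuadraticExtension {c ℓ : Level} (L : CommutativeRing c ℓ) (ρ : CommutativeRing.Carrier L) where
  open CommutativeRing L
  open RingProperties ring using (-‿distribˡ-*; -‿distribʳ-*; +-inverseˡ-unique; -‿involutive)
  open SetoidReasoning setoid
  open Solver commutativeSemiring using (solve; _:=_; _:+_; _:*_; con)

  -- (a , b) stands for a + b√ρ.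
  extension : CommutativeRing c ℓ
  extension = record
    { Carrier = Carrier × Carrier
    ; _≈_ = λ (a , b) (a′ , b′) → a ≈ a′ × b ≈ b′
    ; _+_ = λ (a , b) (a′ , b′) → a + a′ , b + b′
    ; _*_ = λ (a , b) (a′ , b′) → a * a′ + ρ * (b * b′) , a * b′ + b * a′
    ; -_ = λ (a , b) → - a , - b
    ; 0# = 0# , 0#
    ; 1# = 1# , 0#
    ; isCommutativeRing = record
      { isRing = record
        { +-isAbelianGroup = record
          { isGroup = record
            { isMonoid = record
              { isSemigroup = record
                { isMagma = record
                  { isEquivalence = record
                    { refl = refl , refl
                    ; sym = λ (e , e′) → sym e , sym e′
                    ; trans = λ (e , e′) (f , f′) → trans e f , trans e′ f′ }
                  ; ∙-cong = λ (e , e′) (f , f′) → +-cong e f , +-cong e′ f′ }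
                ; assoc = λ _ _ _ → +-assoc _ _ _ , +-assoc _ _ _ }
              ; identity = (λ _ → +-identityˡ _ , +-identityˡ _) , λ _ → +-identityʳ _ , +-identityʳ _ }
            ; inverse = (λ _ → -‿inverseˡ _ , -‿inverseˡ _) , λ _ → -‿inverseʳ _ , -‿inverseʳ _
            ; ⁻¹-cong = λ (e , e′) → -‿cong e , -‿cong e′ }
          ; comm = λ _ _ → +-comm _ _ , +-comm _ _ }
        ; *-cong = λ (e , e′) (f , f′) →
            +-cong (*-cong e f) (*-congˡ (*-cong e′ f′)) , +-cong (*-cong e f′) (*-cong e′ f)
        ; *-assoc = λ (a , b) (a′ , b′) (a″ , b″) →
            solve 7 (λ r a b c d e f →
              (a :* c :+ r :* (b :* d)) :* e :+ r :* ((a :* d :+ b :* c) :* f)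
              := a :* (c :* e :+ r :* (d :* f)) :+ r :* (b :* (c :* f :+ d :* e)))
              refl ρ a b a′ b′ a″ b″ ,
            solve 7 (λ r a b c d e f →
              (a :* c :+ r :* (b :* d)) :* f :+ (a :* d :+ b :* c) :* e
              := a :* (c :* f :+ d :* e) :+ b :* (c :* e :+ r :* (d :* f)))
              refl ρ a b a′ b′ a″ b″
        ; *-identity =
            (λ (a , b) →
              solve 3 (λ r a b → con 1 :* a :+ r :* (con 0 :* b) := a) refl ρ a b ,
              solve 2 (λ a b → con 1 :* b :+ con 0 :* a := b) refl a b) ,
            (λ (a , b) →
              solve 3 (λ r a b → a :* con 1 :+ r :* (b :* con 0) := a) refl ρ a b ,
              solve 2 (λ a b → a :* con 0 :+ b :* con 1 := b) refl a b)
        ; distrib =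
            (λ (a , b) (a′ , b′) (a″ , b″) →
              solve 7 (λ r a b c d e f → a :* (c :+ e) :+ r :* (b :* (d :+ f))
                := a :* c :+ r :* (b :* d) :+ (a :* e :+ r :* (b :* f))) refl ρ a b a′ b′ a″ b″ ,
              solve 6 (λ a b c d e f → a :* (d :+ f) :+ b :* (c :+ e)
                := a :* d :+ b :* c :+ (a :* f :+ b :* e)) refl a b a′ b′ a″ b″) ,
            (λ (a , b) (a′ , b′) (a″ , b″) →
              solve 7 (λ r a b c d e f → (c :+ e) :* a :+ r :* ((d :+ f) :* b)
                := c :* a :+ r :* (d :* b) :+ (e :* a :+ r :* (f :* b))) refl ρ a b a′ b′ a″ b″ ,
              solve 6 (λ a b c d e f → (c :+ e) :* b :+ (d :+ f) :* a
                := c :* b :+ d :* a :+ (e :* b :+ f :* a)) refl a b a′ b′ a″ b″) }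
      ; *-comm = λ (a , b) (a′ , b′) →
          solve 5 (λ r a b c d → a :* c :+ r :* (b :* d) := c :* a :+ r :* (d :* b)) refl ρ a b a′ b′ ,
          solve 4 (λ a b c d → a :* d :+ b :* c := c :* b :+ d :* a) refl a b a′ b′ } }

  private module E = CommutativeRing extension

  embed : Carrier → E.Carrier
  embed a = a , 0#

  √ρ : E.Carrier
  √ρ = 0# , 1#

  embed-isHom : IsHom L extension embed
  embed-isHom = isHom L extension embed (λ e → e , refl)
    (λ _ _ → refl , sym (+-identityˡ 0#))
    (λ a b → solve 3 (λ r a b → a :* b := a :* b :+ r :* (con 0 :* con 0)) refl ρ a b ,
             solve 2 (λ a b → con 0 := a :* con 0 :+ con 0 :* b) refl a b)
    (refl , refl) (refl , refl)

  √ρ*√ρ≈ρ : √ρ E.* √ρ E.≈ embed ρ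
  √ρ*√ρ≈ρ = solve 1 (λ r → con 0 :* con 0 :+ r :* (con 1 :* con 1) := r) refl ρ ,
            trans (+-cong (zeroˡ 1#) (zeroʳ 1#)) (+-identityˡ 0#)

  extension-discrete : Discrete L → Discrete extension
  extension-discrete _≟_ (a , b) (a′ , b′) with a ≟ a′ | b ≟ b′
  ... | yes e | yes e′ = yes (e , e′)
  ... | no ¬e | _      = no λ (e , _) → ¬e e
  ... | yes _ | no ¬e′ = no λ (_ , e′) → ¬e′ e′

  -- The inverse of a + b√ρ is (a - b√ρ) divided by the norm a² - ρb². A vanishing norm would give ρ
  -- = (a/b)², or a = 0 when b = 0.
  extension-isField : IsField L → Discrete L → NonSquare L ρ → IsField extension
  extension-isField L-field@(1≉0 , inverse) _≟_ ρ-nonsquare = (λ (e , _) → 1≉0 e) , E-inverse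
    where
    norm : Carrier → Carrier → Carrier
    -- The sign sits on b so that this is literally the first coordinate of (a + b√ρ)(a - b√ρ).
    norm a b = a * a + ρ * (b * - b)

    norm≉0 : ∀ a b → ¬ (a ≈ 0# × b ≈ 0#) → ¬ (norm a b ≈ 0#)
    norm≉0 a b ≉0 n≈0 with b ≟ 0#
    ... | yes b≈0 = ≉0 (a≈0 , b≈0)
      where
      aa≈0 : a * a ≈ 0#
      aa≈0 = begin
        a * a                      ≈⟨ +-identityʳ _ ⟨
        a * a + 0#                 ≈⟨ +-congˡ (trans (*-congˡ (trans (*-congʳ b≈0) (zeroˡ _))) (zeroʳ ρ)) ⟨
        a * a + ρ * (b * - b)      ≈⟨ n≈0 ⟩
        0#                         ∎
      a≈0 : a ≈ 0#
      a≈0 with field⇒noZeroDivisors L L-field _≟_ a a aa≈0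
      ... | inj₁ e = e
      ... | inj₂ e = e
    ... | no b≉0 = ρ-nonsquare (a * b′) (begin
        (a * b′) * (a * b′)      ≈⟨ solve 2 (λ a b → (a :* b) :* (a :* b) := (a :* a) :* (b :* b)) refl a b′ ⟩
        (a * a) * (b′ * b′)      ≈⟨ *-congʳ aa≈ρbb ⟩
        (ρ * (b * b)) * (b′ * b′)  ≈⟨ solve 3 (λ r b c → (r :* (b :* b)) :* (c :* c) := r :* ((b :* c) :* (b :* c))) refl ρ b b′ ⟩
        ρ * ((b * b′) * (b * b′))  ≈⟨ *-congˡ (*-cong bb′≈1 bb′≈1) ⟩
        ρ * (1# * 1#)            ≈⟨ trans (*-congˡ (*-identityˡ 1#)) (*-identityʳ ρ) ⟩
        ρ                        ∎)
      where
      b′ = proj₁ (inverse b b≉0)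
      bb′≈1 = proj₂ (inverse b b≉0)
      aa≈ρbb : a * a ≈ ρ * (b * b)
      aa≈ρbb = begin
        a * a                    ≈⟨ +-inverseˡ-unique _ _ n≈0 ⟩
        - (ρ * (b * - b))        ≈⟨ -‿cong (trans (*-congˡ (sym (-‿distribʳ-* b b))) (sym (-‿distribʳ-* ρ _))) ⟩
        - - (ρ * (b * b))        ≈⟨ -‿involutive _ ⟩
        ρ * (b * b)              ∎

    E-inverse : ∀ x → ¬ (x E.≈ E.0#) → ∃ λ y → x E.* y E.≈ E.1#
    E-inverse (a , b) ≉0 = let n′ , nn′≈1 = inverse (norm a b) (norm≉0 a b ≉0) in
      (a * n′ , - b * n′) ,
      (begin
        a * (a * n′) + ρ * (b * (- b * n′))     ≈⟨ solve 5 (λ r a b c n →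
          a :* (a :* n) :+ r :* (b :* (c :* n)) := (a :* a :+ r :* (b :* c)) :* n) refl ρ a b (- b) n′ ⟩
        norm a b * n′                           ≈⟨ nn′≈1 ⟩
        1#                                      ∎) ,
      (begin
        a * (- b * n′) + b * (a * n′)           ≈⟨ solve 4 (λ a b c n →
          a :* (c :* n) :+ b :* (a :* n) := (c :+ b) :* (a :* n)) refl a b (- b) n′ ⟩
        (- b + b) * (a * n′)                    ≈⟨ trans (*-congʳ (-‿inverseˡ b)) (zeroˡ _) ⟩
        0#                                      ∎)

  √ρ-nonsquare : IsField L → Discrete L → (∃ λ i → i * i ≈ - 1#) → NonSquare L ρ → NonSquare extension √ρ
  √ρ-nonsquare (1≉0 , inverse) _≟_ (i , ii≈-1) ρ-nonsquare (a , b) (e , e′) with b ≟ 0#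
  -- The √ρ-coordinate of (a + b√ρ)² is 2ab and has to equal 1, so b is invertible.
  ... | yes b≈0 = 1≉0 (begin
      1#                 ≈⟨ e′ ⟨
      a * b + b * a      ≈⟨ +-cong (*-congˡ b≈0) (*-congʳ b≈0) ⟩
      a * 0# + 0# * a    ≈⟨ trans (+-cong (zeroʳ a) (zeroˡ a)) (+-identityˡ 0#) ⟩
      0#                 ∎)
  ... | no b≉0 = ρ-nonsquare (i * (a * b′)) (begin
      (i * (a * b′)) * (i * (a * b′))    ≈⟨ solve 3 (λ i a b → (i :* (a :* b)) :* (i :* (a :* b))
        := (i :* i) :* ((a :* a) :* (b :* b))) refl i a b′ ⟩
      (i * i) * ((a * a) * (b′ * b′))    ≈⟨ *-cong ii≈-1 (*-congʳ (+-inverseˡ-unique _ _ e)) ⟩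
      - 1# * (- (ρ * (b * b)) * (b′ * b′))  ≈⟨ *-congˡ (-‿distribˡ-* _ _) ⟨
      - 1# * - (ρ * (b * b) * (b′ * b′))  ≈⟨ trans (sym (-‿distribˡ-* _ _)) (trans (-‿cong (*-identityˡ _)) (-‿involutive _)) ⟩
      (ρ * (b * b)) * (b′ * b′)          ≈⟨ solve 3 (λ r b c → (r :* (b :* b)) :* (c :* c)
        := r :* ((b :* c) :* (b :* c))) refl ρ b b′ ⟩
      ρ * ((b * b′) * (b * b′))          ≈⟨ *-congˡ (*-cong bb′≈1 bb′≈1) ⟩
      ρ * (1# * 1#)                      ≈⟨ trans (*-congˡ (*-identityˡ 1#)) (*-identityʳ ρ) ⟩
      ρ                                  ∎)
    where
    b′ = proj₁ (inverse b b≉0)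
    bb′≈1 = proj₂ (inverse b b≉0)

-- On coefficient lists these are the polynomials e and o with p(x) = e(x²) + x · o(x²).
evens odds : {a : Level} {A : Set a} → List A → List A
evens []       = []
evens (x ∷ xs) = x ∷ odds xs
odds []        = []
odds (x ∷ xs)  = evens xs

module _ {c ℓ : Level} (R : CommutativeRing c ℓ) where
  open CommutativeRing R using (_≈_; refl)

  coeff-evens : ∀ p n → coeff R (evens p) n ≈ coeff R p (n ℕ.+ n)
  coeff-odds  : ∀ p n → coeff R (odds p) n ≈ coeff R p (suc (n ℕ.+ n))
  coeff-evens []      n       = refl
  coeff-evens (x ∷ p) zero    = refl
  coeff-evens (x ∷ p) (suc n) rewrite ℕₚ.+-suc n n = coeff-odds p n
  coeff-odds []      n = refl
  coeff-odds (x ∷ p) n = coeff-evens p n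

-- A field generated over F by an element ρ of degree 2M for which ρᴹ is a root of x² + ux + v.
record Generator {c ℓ : Level} (F : CommutativeRing c ℓ) (u v : CommutativeRing.Carrier F) (M : ℕ) :
  Set (Level.suc (c ⊔ ℓ)) where
  field
    L        : CommutativeRing c ℓ
    φ        : CommutativeRing.Carrier F → CommutativeRing.Carrier L
    φ-hom    : IsHom F L φ
    ρ        : CommutativeRing.Carrier L
    isField  : IsField L
    discrete : Discrete L
    indep    : Independent F L φ φ-hom ρ (2 ℕ.* M)
  open CommutativeRing L
  field
    root     : pow L ρ M * pow L ρ M + φ u * pow L ρ M + φ v ≈ 0#

module _ {c ℓ : Level} {F : CommutativeRing c ℓ} {u v : CommutativeRing.Carrier F} {M : ℕ}
  (G : Generator F u v M) where
  open Generator G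
  open QuadraticExtension L ρ
  private
    module L = CommutativeRing L
    module E = CommutativeRing extension
  open Polynomials F
  open SetoidReasoning E.setoid

  private
    φ′ : CommutativeRing.Carrier F → E.Carrier
    φ′ x = embed (φ x)

    φ′-hom : IsHom F extension φ′
    φ′-hom = isHom-∘ F L extension φ-hom embed-isHom

    open Evaluation F L φ φ-hom ρ using (ev)
    open Evaluation F extension φ′ φ′-hom √ρ using () renaming (ev to ev′)
    open HomProperties L extension embed embed-isHom

    open Solver L.commutativeSemiring using (solve; _:=_; _:+_; _:*_; con)

    -- Put x = √ρ in p(x) = e(x²) + x · o(x²). In the induction the two parts trade places because
    -- √ρ(a + b√ρ) = ρb + a√ρ.
    ev-split : ∀ p → ev′ p E.≈ (ev (evens p) , ev (odds p))
    ev-split []      = L.refl , L.refl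
    ev-split (x ∷ p) = let e , e′ = ev-split p in
      L.trans (L.+-congˡ (L.+-cong (L.*-congˡ e) (L.*-congˡ (L.*-congˡ e′))))
        (solve 4 (λ r x a b → x :+ (con 0 :* a :+ r :* (con 1 :* b)) := x :+ r :* b) L.refl ρ (φ x) (ev (evens p)) (ev (odds p))) ,
      L.trans (L.+-congˡ (L.+-cong (L.*-congˡ e′) (L.*-congˡ e)))
        (solve 2 (λ a b → con 0 :+ (con 0 :* b :+ con 1 :* a) := a) L.refl (ev (evens p)) (ev (odds p)))

    merge : ∀ p → evens p ≐ [] → odds p ≐ [] → p ≐ []
    merge []      _ _  = ≐-refl
    merge (x ∷ p) e e′ = mk λ { zero → at e 0 ; (suc n) → at (merge p e′ (mk λ m → at e (suc m))) n }

    √ρ^2M : pow extension √ρ (2 ℕ.* M) E.≈ embed (pow L ρ M)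
    √ρ^2M = begin
      pow extension √ρ (2 ℕ.* M)            ≈⟨ ^-assocʳ √ρ 2 M ⟨
      pow extension (pow extension √ρ 2) M  ≈⟨ ^-congˡ M (E.trans (E.*-congˡ (E.*-identityʳ √ρ)) √ρ*√ρ≈ρ) ⟩
      pow extension (embed ρ) M             ≈⟨ ^-homo ρ M ⟨
      embed (pow L ρ M)                     ∎
      where open Exp E.commutativeSemiring using (^-assocʳ; ^-congˡ)

  -- A relation of degree below 4M for √ρ splits into two relations of degree below 2M for ρ, both
  -- trivial; so the degree doubles. The quadratic equation survives since (√ρ)^(2M) = ρᴹ.
  extendGenerator : NonSquare L ρ → Generator F u v (2 ℕ.* M)
  extendGenerator ρ-nonsquare = record
    { L = extension ; φ = φ′ ; φ-hom = φ′-hom ; ρ = √ρ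
    ; isField = extension-isField isField discrete ρ-nonsquare
    ; discrete = extension-discrete discrete
    ; indep = λ p p< ev≈0 →
        let e , e′ = ev-split p ; z , z′ = ev≈0
            below : ∀ n → 2 ℕ.* M ≤ n → 2 ℕ.* (2 ℕ.* M) ≤ n ℕ.+ n
            below n le = ℕₚ.≤-trans (ℕₚ.*-monoʳ-≤ 2 le) (ℕₚ.≤-reflexive (≡.cong (n ℕ.+_) (ℕₚ.+-identityʳ n)))
        in merge p
          (indep (evens p) (λ n le → F.trans (coeff-evens F p n) (p< _ (below n le))) (L.trans (L.sym e) z))
          (indep (odds p) (λ n le → F.trans (coeff-odds F p n) (p< _ (ℕₚ.m≤n⇒m≤1+n (below n le)))) (L.trans (L.sym e′) z′))
    ; root = begin
        y E.* y E.+ φ′ u E.* y E.+ φ′ v      ≈⟨ E.+-congʳ (E.+-cong (E.*-cong √ρ^2M √ρ^2M) (E.*-congˡ √ρ^2M)) ⟩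
        embed x E.* embed x E.+ φ′ u E.* embed x E.+ φ′ v
                                             ≈⟨ E.+-congʳ (E.+-cong (*-homo x x) (*-homo (φ u) x)) ⟨
        embed (x L.* x) E.+ embed (φ u L.* x) E.+ φ′ v
                                             ≈⟨ E.+-congʳ (+-homo (x L.* x) (φ u L.* x)) ⟨
        embed (x L.* x L.+ φ u L.* x) E.+ φ′ v  ≈⟨ +-homo _ (φ v) ⟨
        embed (x L.* x L.+ φ u L.* x L.+ φ v)  ≈⟨ ⟦⟧-cong root ⟩
        embed L.0#                           ≈⟨ 0#-homo ⟩
        E.0#                                 ∎ }
    where
    module F = CommutativeRing F
    x = pow L ρ M
    y = pow extension √ρ (2 ℕ.* M)

module _ {c ℓ : Level} {F : CommutativeRing c ℓ} {u v : CommutativeRing.Carrier F} where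
  private module F = CommutativeRing F

  -- What one storey of the tower consumes and must hand on: the nonsquare to adjoin a root of, and
  -- a square root of -1 to show that this root is again a nonsquare.
  Extendable : {M : ℕ} → Generator F u v M → Set (c ⊔ ℓ)
  Extendable G = (∃ λ i → i * i ≈ - 1#) × NonSquare L ρ
    where
    open Generator G
    open CommutativeRing L

  tower : (G : Generator F u v 1) → Extendable G → ∀ n → ∃ λ (G′ : Generator F u v (2 ℕ.^ n)) → Extendable G′
  tower G ext zero    = G , ext
  tower G ext (suc n) with tower G ext n
  ... | G′ , (i , ii≈-1) , ρ-nonsquare =
    extendGenerator G′ ρ-nonsquare ,
    (embed i , E.trans (E.sym (*-homo i i)) (E.trans (⟦⟧-cong ii≈-1) (E.trans (-‿homo 1#) (E.-‿cong 1#-homo)))) ,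
    √ρ-nonsquare isField discrete (i , ii≈-1) ρ-nonsquare
    where
    open Generator G′
    open CommutativeRing L using (1#)
    open QuadraticExtension L ρ
    open HomProperties L extension embed embed-isHom
    module E = CommutativeRing extension

  trinomial : ℕ → Poly F
  trinomial M = _+ₚ_ F (_+ₚ_ F (Xpow F (2 ℕ.* M)) (_·ₚ_ F u (Xpow F M))) (cst F v)

  module _ (M : ℕ) (0<M : 0 < M) where
    open Polynomials F

    private
      M<2M : M < 2 ℕ.* M
      M<2M = ℕₚ.≤-trans (ℕₚ.+-monoˡ-≤ M 0<M) (ℕₚ.+-monoʳ-≤ M (ℕₚ.m≤m+n M 0))

      coeff-trinomial : ∀ n → 2 ℕ.* M ≤ n → coeff F (trinomial M) n F.≈ coeff F (Xpow F (2 ℕ.* M)) n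
      coeff-trinomial n le = begin
        coeff F (trinomial M) n
          ≈⟨ F.trans (coeff-⊞ (Xpow F (2 ℕ.* M) ⊞ _·ₚ_ F u (Xpow F M)) (cst F v) n) (F.+-congʳ (coeff-⊞ (Xpow F (2 ℕ.* M)) _ n)) ⟩
        coeff F (Xpow F (2 ℕ.* M)) n F.+ coeff F (_·ₚ_ F u (Xpow F M)) n F.+ coeff F (cst F v) n
          ≈⟨ F.+-cong (F.+-congˡ (F.trans (coeff-· u (Xpow F M) n) (F.trans (F.*-congˡ (coeff-Xpow-≢ M n (ℕₚ.>⇒≢ M<n))) (F.zeroʳ u))))
               (coeff-cst v n (ℕₚ.≤-<-trans z≤n M<n)) ⟩
        coeff F (Xpow F (2 ℕ.* M)) n F.+ F.0# F.+ F.0#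
          ≈⟨ F.trans (F.+-identityʳ _) (F.+-identityʳ _) ⟩
        coeff F (Xpow F (2 ℕ.* M)) n ∎
        where
        open SetoidReasoning F.setoid
        M<n : M < n
        M<n = ℕₚ.<-≤-trans M<2M le

    trinomial-monic : MonicOfDegree (2 ℕ.* M) (trinomial M)
    trinomial-monic =
      F.trans (coeff-trinomial (2 ℕ.* M) ℕₚ.≤-refl) (coeff-Xpow-≡ (2 ℕ.* M)) ,
      λ n lt → F.trans (coeff-trinomial n (ℕₚ.<⇒≤ lt)) (coeff-Xpow-≢ (2 ℕ.* M) n (ℕₚ.>⇒≢ lt))

    trinomial-irreducible : IsField F → Discrete F → Generator F u v M → Irreducible F (trinomial M)
    trinomial-irreducible F-field F-discrete G =
      irreducible F L φ φ-hom ρ F-field F-discrete (field⇒noZeroDivisors L isField discrete)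
        (2 ℕ.* M) (trinomial M) (ℕₚ.<⇒≤ (ℕₚ.≤-<-trans 0<M M<2M)) indep trinomial-monic trinomial-root
      where
      open Generator G
      open CommutativeRing L
      open Evaluation F L φ φ-hom ρ
      open SetoidReasoning setoid
      open Exp commutativeSemiring using (^-homo-*; ^-congʳ)
      trinomial-root : ev (trinomial M) ≈ 0#
      trinomial-root = begin
        ev (trinomial M)
          ≈⟨ trans (ev-⊞ (Xpow F (2 ℕ.* M) ⊞ _·ₚ_ F u (Xpow F M)) (cst F v)) (+-congʳ (ev-⊞ (Xpow F (2 ℕ.* M)) (_·ₚ_ F u (Xpow F M)))) ⟩
        ev (Xpow F (2 ℕ.* M)) + ev (_·ₚ_ F u (Xpow F M)) + ev (cst F v)
          ≈⟨ +-cong (+-cong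
               (trans (ev-Xpow (2 ℕ.* M)) (trans (^-congʳ ρ (≡.cong (M ℕ.+_) (ℕₚ.+-identityʳ M))) (^-homo-* ρ M M)))
               (trans (ev-· u (Xpow F M)) (*-congˡ (ev-Xpow M))))
             (ev-cst v) ⟩
        pow L ρ M * pow L ρ M + φ u * pow L ρ M + φ v
          ≈⟨ root ⟩
        0# ∎

-- Finite fields

-- If k were missed, removing it from the codomain would give an injection into a set with one
-- element fewer.
injective⇒surjective : ∀ {n} (f : Fin n → Fin n) → (∀ {i j} → f i ≡ f j → i ≡ j) → ∀ k → ∃ λ i → f i ≡ k
injective⇒surjective {suc n} f f-inj k with Finₚ.any? (λ i → f i Finₚ.≟ k)
... | yes hit = hit
... | no miss = ⊥-elim (ℕₚ.<-irrefl ≡.refl (Finₚ.injective⇒≤ {f = f′} f′-inj))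
  where
  k≢f : ∀ i → ¬ (k ≡ f i)
  k≢f i e = miss (i , ≡.sym e)
  f′ : Fin (suc n) → Fin n
  f′ i = punchOut (k≢f i)
  f′-inj : ∀ {i j} → f′ i ≡ f′ j → i ≡ j
  f′-inj {i} {j} e = f-inj (Finₚ.punchOut-injective (k≢f i) (k≢f j) e)

module FiniteRing {c ℓ : Level} (R : CommutativeRing c ℓ) {n : ℕ} (card : HasCard R n) where
  open CommutativeRing R

  element : Fin n → Carrier
  element = proj₁ card

  element-injective : ∀ {i j} → element i ≈ element j → i ≡ j
  element-injective = proj₁ (proj₂ card) _ _

  index : Carrier → Fin n
  index x = proj₁ (proj₂ (proj₂ card) x)

  element-index : ∀ x → element (index x) ≈ x
  element-index x = proj₂ (proj₂ (proj₂ card) x)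

  index-cong : ∀ {x y} → x ≈ y → index x ≡ index y
  index-cong {x} {y} e = element-injective (trans (element-index x) (trans e (sym (element-index y))))

  finite-discrete : Discrete R
  finite-discrete x y with index x Finₚ.≟ index y
  ... | yes e = yes (trans (sym (element-index x)) (trans (reflexive (≡.cong element e)) (element-index y)))
  ... | no ¬e = no λ x≈y → ¬e (index-cong x≈y)

-- Multiplication by x permutes the nonzero elements, so their product is xⁿ⁻¹ times itself.
fermat : {c ℓ : Level} (R : CommutativeRing c ℓ) → IsField R → ∀ n → HasCard R n →
  let open CommutativeRing R in ∀ x → ¬ (x ≈ 0#) → pow R x (n ℕ.∸ 1) ≈ 1#
fermat R R-field zero (_ , _ , index) x x≉0 with index x
... | () , _
fermat R R-field@(1≉0 , inverse) (suc m) card x x≉0 = begin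
    pow R x m                  ≈⟨ *-identityʳ _ ⟨
    pow R x m * 1#             ≈⟨ *-congˡ PP′≈1 ⟨
    pow R x m * (P * P′)       ≈⟨ *-assoc _ _ _ ⟨
    pow R x m * P * P′         ≈⟨ *-congʳ P≈x^mP ⟨
    P * P′                     ≈⟨ PP′≈1 ⟩
    1#                         ∎
  where
  open CommutativeRing R
  open FiniteRing R card
  open Sum *-commutativeMonoid using () renaming
    ( sum to ∏; sum-cong-≋ to ∏-cong; sum-permute to ∏-permute; ∑-distrib-+ to ∏-distrib-*
    ; sum-remove to ∏-remove; sum-replicate to ∏-replicate)
  open SetoidReasoning setoid

  _≟_ : Discrete R
  _≟_ = finite-discrete

  noZeroDiv : NoZeroDivisors R
  noZeroDiv = field⇒noZeroDivisors R R-field _≟_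

  x′ = proj₁ (inverse x x≉0)
  xx′≈1 = proj₂ (inverse x x≉0)

  -- Lets the product of the nonzero elements run over the whole ring, on which multiplication by x
  -- is a permutation: the entry at zero is replaced by 1.
  ifZero : Carrier → Carrier → Carrier
  ifZero z y with y ≟ 0#
  ... | yes _ = 1#
  ... | no  _ = z

  nonzeroPart : Carrier → Carrier
  nonzeroPart y = ifZero y y

  nonzeroPart-cong : ∀ {y z} → y ≈ z → nonzeroPart y ≈ nonzeroPart z
  nonzeroPart-cong {y} {z} e with y ≟ 0# | z ≟ 0#
  ... | yes _   | yes _   = refl
  ... | no _    | no _    = e
  ... | yes y≈0 | no z≉0  = ⊥-elim (z≉0 (trans (sym e) y≈0))
  ... | no y≉0  | yes z≈0 = ⊥-elim (y≉0 (trans e z≈0))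

  nonzeroPart≉0 : ∀ y → ¬ (nonzeroPart y ≈ 0#)
  nonzeroPart≉0 y with y ≟ 0#
  ... | yes _   = 1≉0
  ... | no y≉0  = y≉0

  nonzeroPart-* : ∀ y → nonzeroPart (x * y) ≈ ifZero x y * nonzeroPart y
  nonzeroPart-* y with y ≟ 0# | (x * y) ≟ 0#
  ... | yes _   | yes _    = sym (*-identityˡ 1#)
  ... | no _    | no _     = refl
  ... | yes y≈0 | no xy≉0  = ⊥-elim (xy≉0 (trans (*-congˡ y≈0) (zeroʳ x)))
  ... | no y≉0  | yes xy≈0 with noZeroDiv x y xy≈0
  ...   | inj₁ x≈0 = ⊥-elim (x≉0 x≈0)
  ...   | inj₂ y≈0 = ⊥-elim (y≉0 y≈0)

  multiply : Carrier → Fin (suc m) → Fin (suc m)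
  multiply y i = index (y * element i)

  multiply-inverse : ∀ {y z} → y * z ≈ 1# → ∀ i → multiply y (multiply z i) ≡ i
  multiply-inverse {y} {z} yz≈1 i = element-injective (begin
    element (multiply y (multiply z i))   ≈⟨ element-index _ ⟩
    y * element (multiply z i)            ≈⟨ *-congˡ (element-index _) ⟩
    y * (z * element i)                   ≈⟨ *-assoc _ _ _ ⟨
    y * z * element i                     ≈⟨ trans (*-congʳ yz≈1) (*-identityˡ _) ⟩
    element i                             ∎)

  π : Permutation (suc m) (suc m)
  π = permutation (multiply x) (multiply x′)
    (multiply-inverse xx′≈1) (multiply-inverse (trans (*-comm x′ x) xx′≈1))

  ∏≉0 : ∀ {k} (t : Fin k → Carrier) → (∀ i → ¬ (t i ≈ 0#)) → ¬ (∏ t ≈ 0#)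
  ∏≉0 {zero}  t t≉0 e = 1≉0 e
  ∏≉0 {suc k} t t≉0 e with noZeroDiv _ _ e
  ... | inj₁ e₀ = t≉0 Fin.zero e₀
  ... | inj₂ e₁ = ∏≉0 (λ i → t (Fin.suc i)) (λ i → t≉0 (Fin.suc i)) e₁

  P : Carrier
  P = ∏ (λ i → nonzeroPart (element i))

  P≉0 : ¬ (P ≈ 0#)
  P≉0 = ∏≉0 (λ i → nonzeroPart (element i)) (λ i → nonzeroPart≉0 (element i))

  P′ = proj₁ (inverse P P≉0)
  PP′≈1 = proj₂ (inverse P P≉0)

  -- The factor by which multiplication by x changes the entry at i: 1 at the zero element and x at
  -- the m others, whence the exponent n - 1 = m.
  scale : Fin (suc m) → Carrier
  scale i = ifZero x (element i)

  i₀ = index 0#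

  scale-i₀ : scale i₀ ≈ 1#
  scale-i₀ with element i₀ ≟ 0#
  ... | yes _ = refl
  ... | no ¬e = ⊥-elim (¬e (element-index 0#))

  scale-rest : ∀ j → removeAt scale i₀ j ≈ x
  scale-rest j with element (punchIn i₀ j) ≟ 0#
  ... | yes e = ⊥-elim (Finₚ.punchInᵢ≢i i₀ j (element-injective (trans e (sym (element-index 0#)))))
  ... | no _  = refl

  ∏scale≈x^m : ∏ scale ≈ pow R x m
  ∏scale≈x^m = begin
    ∏ scale                            ≈⟨ ∏-remove {i = i₀} scale ⟩
    scale i₀ * ∏ (removeAt scale i₀)   ≈⟨ *-cong scale-i₀ (∏-cong {m} scale-rest) ⟩
    1# * ∏ (replicate m x)             ≈⟨ *-identityˡ _ ⟩
    ∏ (replicate m x)                  ≈⟨ ∏-replicate m ⟩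
    pow R x m                          ∎

  P≈x^mP : P ≈ pow R x m * P
  P≈x^mP = begin
    P                                                   ≈⟨ ∏-permute (λ i → nonzeroPart (element i)) π ⟩
    ∏ (λ i → nonzeroPart (element (multiply x i)))      ≈⟨ ∏-cong {suc m} (λ i →
      trans (nonzeroPart-cong (element-index _)) (nonzeroPart-* (element i))) ⟩
    ∏ (λ i → scale i * nonzeroPart (element i))         ≈⟨ ∏-distrib-* scale (λ i → nonzeroPart (element i)) ⟩
    ∏ scale * P                                         ≈⟨ *-congʳ ∏scale≈x^m ⟩
    pow R x m * P                                       ∎

-- Products of linear factors

module Products {c ℓ : Level} (A : CommutativeRing c ℓ) where
  open CommutativeRing A
  open RingProperties ring using (-‿distribʳ-*; -1*x≈-x; -‿involutive)
  open Exp commutativeSemiring using (_^_; ^-congˡ; ^-congʳ; ^-homo-*; ^-assocʳ; ^-distrib-*)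
  open SetoidReasoning setoid
  open Solver commutativeSemiring using (solve; _:=_; _:+_; _:*_)

  ∏< : ℕ → (ℕ → Carrier) → Carrier
  ∏< zero    f = 1#
  ∏< (suc n) f = f 0 * ∏< n (f ∘ suc)

  ∏<-cong : ∀ n {f g} → (∀ i → i < n → f i ≈ g i) → ∏< n f ≈ ∏< n g
  ∏<-cong zero    e = refl
  ∏<-cong (suc n) e = *-cong (e 0 (s≤s z≤n)) (∏<-cong n λ i i<n → e (suc i) (s≤s i<n))

  ∏<-* : ∀ n f g → ∏< n (λ i → f i * g i) ≈ ∏< n f * ∏< n g
  ∏<-* zero    f g = sym (*-identityˡ 1#)
  ∏<-* (suc n) f g = trans (*-congˡ (∏<-* n (f ∘ suc) (g ∘ suc)))
    (solve 4 (λ a b c d → (a :* b) :* (c :* d) := (a :* c) :* (b :* d)) refl (f 0) (g 0) _ _)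

  ∏<-+ : ∀ m n f → ∏< (m ℕ.+ n) f ≈ ∏< m f * ∏< n (λ i → f (m ℕ.+ i))
  ∏<-+ zero    n f = sym (*-identityˡ _)
  ∏<-+ (suc m) n f = trans (*-congˡ (∏<-+ m n (f ∘ suc))) (sym (*-assoc _ _ _))

  -- The list `exponents` grows at its large end while `∏<` recurses at the small one; this
  -- reconciles them in `ev-prod`.
  ∏<-last : ∀ n f → ∏< (suc n) f ≈ f n * ∏< n f
  ∏<-last zero    f = refl
  ∏<-last (suc n) f = trans (*-congˡ (∏<-last n (f ∘ suc)))
    (solve 3 (λ a b c → a :* (b :* c) := b :* (a :* c)) refl (f 0) (f (suc n)) _)

  foldr-++ : ∀ xs ys → foldr _*_ 1# (xs ++ ys) ≈ foldr _*_ 1# xs * foldr _*_ 1# ys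
  foldr-++ []       ys = sym (*-identityˡ _)
  foldr-++ (x ∷ xs) ys = trans (*-congˡ (foldr-++ xs ys)) (sym (*-assoc _ _ _))

  foldr-concatMap-oneTo : ∀ n (f : ℕ → List Carrier) →
    foldr _*_ 1# (concatMap f (oneTo n)) ≈ ∏< n (λ i → foldr _*_ 1# (f (suc i)))
  foldr-concatMap-oneTo n f = go n (λ i → i)
    where
    -- `upTo` is `applyUpTo` at the identity, and its recursion composes that function with `suc`;
    -- hence an arbitrary g.
    go : ∀ n (g : ℕ → ℕ) → foldr _*_ 1# (concatMap f (map suc (applyUpTo g n)))
       ≈ ∏< n (λ i → foldr _*_ 1# (f (suc (g i))))
    go zero    g = refl
    go (suc n) g = trans (foldr-++ (f (suc (g 0))) _) (*-congˡ (go n (g ∘ suc)))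

  [y+t][y-t] : ∀ y t → (y + t) * (y - t) ≈ y * y - t * t
  [y+t][y-t] y t = begin
    (y + t) * (y - t)                    ≈⟨ solve 3 (λ y t n → (y :+ t) :* (y :+ n)
      := y :* y :+ t :* n :+ y :* (t :+ n)) refl y t (- t) ⟩
    y * y + t * - t + y * (t - t)        ≈⟨ +-congˡ (trans (*-congˡ (-‿inverseʳ t)) (zeroʳ y)) ⟩
    y * y + t * - t + 0#                 ≈⟨ +-identityʳ _ ⟩
    y * y + t * - t                      ≈⟨ +-congˡ (sym (-‿distribʳ-* t t)) ⟩
    y * y - t * t                        ∎

  -- The factors i and i + 2ⁿ of the product for n + 1 are Y ∓ ηⁱ, so they combine to the i-th
  -- factor of the product for n, Y² and η².
  ∏-odd-powers : ∀ n η Y → η ^ (2 ℕ.^ n) ≈ - 1# →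
    ∏< (2 ℕ.^ n) (λ i → Y - η ^ suc (2 ℕ.* i)) ≈ Y ^ (2 ℕ.^ n) + 1#
  ∏-odd-powers zero η Y η≈-1 = begin
    (Y - η * 1#) * 1#     ≈⟨ *-identityʳ _ ⟩
    Y - η * 1#            ≈⟨ +-congˡ (trans (-‿cong η≈-1) (-‿involutive 1#)) ⟩
    Y + 1#                ≈⟨ +-congʳ (*-identityʳ Y) ⟨
    Y * 1# + 1#           ∎
  ∏-odd-powers (suc n) η Y η^≈-1 = begin
    ∏< (2 ℕ.^ suc n) f                                          ≈⟨ ∏<-+ N (N ℕ.+ 0) f ⟩
    ∏< N f * ∏< (N ℕ.+ 0) (λ i → f (N ℕ.+ i))                   ≈⟨ *-congˡ (reflexive (≡.cong (λ k → ∏< k (λ i → f (N ℕ.+ i))) (ℕₚ.+-identityʳ N))) ⟩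
    ∏< N f * ∏< N (λ i → f (N ℕ.+ i))                           ≈⟨ ∏<-* N f (λ i → f (N ℕ.+ i)) ⟨
    ∏< N (λ i → f i * f (N ℕ.+ i))                              ≈⟨ ∏<-cong N (λ i _ → pair i) ⟩
    ∏< N (λ i → Y * Y - (η * η) ^ suc (2 ℕ.* i))                ≈⟨ ∏-odd-powers n (η * η) (Y * Y) ηη^≈-1 ⟩
    (Y * Y) ^ N + 1#                                            ≈⟨ +-congʳ (square-^ Y N) ⟩
    Y ^ (2 ℕ.^ suc n) + 1#                                      ∎
    where
    N = 2 ℕ.^ n
    f : ℕ → Carrier
    f i = Y - η ^ suc (2 ℕ.* i)
    square-^ : ∀ x m → (x * x) ^ m ≈ x ^ (2 ℕ.* m)
    square-^ x m = trans (^-congˡ m (*-congˡ (sym (*-identityʳ x)))) (^-assocʳ x 2 m)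
    ηη^≈-1 : (η * η) ^ N ≈ - 1#
    ηη^≈-1 = trans (square-^ η N) η^≈-1
    shift : ∀ i → η ^ suc (2 ℕ.* (N ℕ.+ i)) ≈ - (η ^ suc (2 ℕ.* i))
    shift i = begin
      η ^ suc (2 ℕ.* (N ℕ.+ i))               ≈⟨ ^-congʳ η (≡.trans (≡.cong suc (ℕₚ.*-distribˡ-+ 2 N i)) (≡.sym (ℕₚ.+-suc (2 ℕ.* N) (2 ℕ.* i)))) ⟩
      η ^ (2 ℕ.* N ℕ.+ suc (2 ℕ.* i))         ≈⟨ ^-homo-* η (2 ℕ.* N) _ ⟩
      η ^ (2 ℕ.* N) * η ^ suc (2 ℕ.* i)       ≈⟨ *-congʳ η^≈-1 ⟩
      - 1# * η ^ suc (2 ℕ.* i)                ≈⟨ -1*x≈-x _ ⟩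
      - (η ^ suc (2 ℕ.* i))                   ∎
    pair : ∀ i → f i * f (N ℕ.+ i) ≈ Y * Y - (η * η) ^ suc (2 ℕ.* i)
    pair i = begin
      f i * f (N ℕ.+ i)         ≈⟨ *-congˡ (+-congˡ (trans (-‿cong (shift i)) (-‿involutive t))) ⟩
      (Y - t) * (Y + t)         ≈⟨ *-comm _ _ ⟩
      (Y + t) * (Y - t)         ≈⟨ [y+t][y-t] Y t ⟩
      Y * Y - t * t             ≈⟨ +-congˡ (-‿cong (^-distrib-* η η (suc (2 ℕ.* i)))) ⟨
      Y * Y - (η * η) ^ suc (2 ℕ.* i) ∎
      where t = η ^ suc (2 ℕ.* i)

  -- The inductive step of division by x - a, with n in the role of -a. Adding (a + n)e = 0 leaves
  -- an identity that holds in every commutative semiring.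
  division-step : ∀ x a n q e k → a + n ≈ 0# → k + x * ((x + n) * q + e) ≈ (x + n) * (e + x * q) + (k + a * e)
  division-step x a n q e k a+n≈0 = begin
    k + x * ((x + n) * q + e)                    ≈⟨ +-identityʳ _ ⟨
    k + x * ((x + n) * q + e) + 0#               ≈⟨ +-congˡ (trans (*-congʳ a+n≈0) (zeroˡ e)) ⟨
    k + x * ((x + n) * q + e) + (a + n) * e      ≈⟨ solve 6 (λ x a n q e k →
      k :+ x :* ((x :+ n) :* q :+ e) :+ (a :+ n) :* e := (x :+ n) :* (e :+ x :* q) :+ (k :+ a :* e)) refl x a n q e k ⟩
    (x + n) * (e + x * q) + (k + a * e)          ∎

module FactorTheorem {c ℓ : Level} (K : CommutativeRing c ℓ) where
  open CommutativeRing K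
  open Polynomials K
  private
    module P = CommutativeRing polyRing
    module E (a : Carrier) = Evaluation K K (λ x → x) (isHom-id K) a
  open RingProperties ring using (x∙y⁻¹≈ε⇒x≈y)

  evalAt : Carrier → Poly K → Carrier
  evalAt a = E.ev a

  linear : Carrier → Poly K
  linear a = X ⊞ cst K (- a)

  -- Synthetic division: the coefficients of (p - p(a))/(x - a) are the values at a of the
  -- successive tails of p.
  quotient : Carrier → Poly K → Poly K
  quotient a []      = []
  quotient a (x ∷ p) = evalAt a p ∷ quotient a p

  division : ∀ a p → p ≐ linear a ⊠ quotient a p ⊞ cst K (evalAt a p)
  division a []      = ≐-sym (≐-trans (⊞-cong (⊠-zeroʳ (linear a)) ≐-refl) 0∷[]≐[])
  division a (x ∷ p) = begin
    (x ∷ p)                                      ≈⟨ ∷≐cst⊞X⊠ x p ⟩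
    cst K x ⊞ X ⊠ p                              ≈⟨ ⊞-cong (≐-refl {cst K x}) (⊠-congˡ X (division a p)) ⟩
    cst K x ⊞ X ⊠ (linear a ⊠ q ⊞ cst K e)       ≈⟨ division-step X (cst K a) (cst K (- a)) q (cst K e) (cst K x)
      (≐-trans (∷-cong (-‿inverseʳ a) ≐-refl) 0∷[]≐[]) ⟩
    linear a ⊠ (cst K e ⊞ X ⊠ q) ⊞ (cst K x ⊞ cst K a ⊠ cst K e)
      ≈⟨ ⊞-cong (⊠-congˡ (linear a) (≐-sym (∷≐cst⊞X⊠ e q)))
           (⊞-cong (≐-refl {cst K x}) (≐-sym (*-homo a e))) ⟩
    linear a ⊠ (e ∷ q) ⊞ cst K (x + a * e)       ∎
    where
    open SetoidReasoning P.setoid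
    open Products polyRing using (division-step)
    open HomProperties K polyRing (cst K) cst-isHom using (*-homo)
    q = quotient a p
    e = evalAt a p

  coeff-quotient : ∀ a p m → coeff K (quotient a p) m ≈ evalAt a (drop (suc m) p)
  coeff-quotient a []      m       = refl
  coeff-quotient a (x ∷ p) zero    = refl
  coeff-quotient a (x ∷ p) (suc m) = coeff-quotient a p m

  coeff-drop : ∀ k p m → coeff K (drop k p) m ≈ coeff K p (k ℕ.+ m)
  coeff-drop zero    p       m = refl
  coeff-drop (suc k) []      m = refl
  coeff-drop (suc k) (x ∷ p) m = coeff-drop k p m

  -- The n-th coefficient of the quotient is the value at a of p without its first n + 1 entries,
  -- and this tail is the constant 1; later tails are zero.
  quotient-monic : ∀ a n p → MonicOfDegree (suc n) p → MonicOfDegree n (quotient a p)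
  quotient-monic a n p (lead , p<) =
    trans (coeff-quotient a p n) (trans (E.ev-cong a top) (E.ev-cst a 1#)) ,
    λ m n<m → trans (coeff-quotient a p m) (E.ev-[] a (drop (suc m) p)
      (mk λ k → trans (coeff-drop (suc m) p k) (p< _ (s≤s (ℕₚ.≤-trans n<m (ℕₚ.m≤m+n m k))))))
    where
    top : drop (suc n) p ≐ cst K 1#
    top = mk λ
      { zero    → trans (coeff-drop (suc n) p 0) (trans (reflexive (≡.cong (coeff K p) (ℕₚ.+-identityʳ (suc n)))) lead)
      ; (suc k) → trans (coeff-drop (suc n) p (suc k)) (p< _ (s≤s (ℕₚ.m<m+n n (s≤s z≤n)))) }

  -- After x - a is split off, any other root b is a root of the quotient, since b - a is nonzero
  -- and cannot be a zero divisor. The degree count leaves 1 at the end.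
  splits : NoZeroDivisors K → ∀ as f → AllPairs (λ a b → ¬ (a ≈ b)) as →
    All (λ a → evalAt a f ≈ 0#) as → MonicOfDegree (length as) f → f ≐ prodₚ K (map linear as)
  splits _ [] f _ _ (lead , f<) = mk λ { zero → lead ; (suc n) → f< (suc n) (s≤s z≤n) }
  splits noZeroDiv (a ∷ as) f (a≉as ∷ as≉) (a-root ∷ as-roots) monic =
    ≐-trans f≐ (⊠-congˡ (linear a) (splits noZeroDiv as q as≉ (roots as a≉as as-roots) (quotient-monic a (length as) f monic)))
    where
    q = quotient a f
    f≐ : f ≐ linear a ⊠ q
    f≐ = ≐-trans (division a f)
      (≐-trans (⊞-cong (≐-refl {linear a ⊠ q}) (≐-trans (∷-cong a-root ≐-refl) 0∷[]≐[])) (⊞-identityʳ _))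
    evalAt-linear : ∀ b → evalAt b (linear a) ≈ b - a
    evalAt-linear b = trans (E.ev-⊞ b X (cst K (- a)))
      (+-cong (trans (E.ev-Xpow b 1) (*-identityʳ b)) (E.ev-cst b (- a)))
    roots : ∀ bs → All (λ b → ¬ (a ≈ b)) bs → All (λ b → evalAt b f ≈ 0#) bs → All (λ b → evalAt b q ≈ 0#) bs
    roots []       []           []                 = []
    roots (b ∷ bs) (a≉b ∷ a≉bs) (b-root ∷ bs-roots) = b-root-q ∷ roots bs a≉bs bs-roots
      where
      b-root-q : evalAt b q ≈ 0#
      b-root-q with noZeroDiv (b - a) (evalAt b q)
        (trans (*-congʳ (sym (evalAt-linear b)))
          (trans (sym (E.ev-⊠ b (linear a) q)) (trans (sym (E.ev-cong b {f} {linear a ⊠ q} f≐)) b-root)))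
      ... | inj₁ b-a≈0 = ⊥-elim (a≉b (sym (x∙y⁻¹≈ε⇒x≈y b a b-a≈0)))
      ... | inj₂ e     = e

-- Exponents of the d-th roots of unity, ordered so that mutually inverse roots are adjacent.
module Exponents (h : ℕ) where
  d : ℕ
  d = suc (h ℕ.+ h)

  exponents : ℕ → List ℕ
  exponents zero    = 0 ∷ []
  exponents (suc n) = suc n ∷ d ℕ.∸ suc n ∷ exponents n

  length-exponents : ∀ n → length (exponents n) ≡ suc (n ℕ.+ n)
  length-exponents zero    = ≡.refl
  length-exponents (suc n) = ≡.trans (≡.cong (λ k → suc (suc k)) (length-exponents n))
    (≡.cong suc (≡.cong suc (≡.sym (ℕₚ.+-suc n n))))

  -- The invariant behind uniqueness: all entries lie within n of one end of the range, so the next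
  -- two, n + 1 and d - n - 1, are new, and distinct because 2(n + 1) ≤ 2h < d.
  exponents-outer : ∀ n → n ≤ h → All (λ m → (m ≤ n ⊎ d ℕ.∸ n ≤ m) × m < d) (exponents n)
  exponents-outer zero    _   = (inj₁ z≤n , s≤s z≤n) ∷ []
  exponents-outer (suc n) n<h =
    (inj₁ ℕₚ.≤-refl , s≤s (ℕₚ.≤-trans n<h (ℕₚ.m≤m+n h h))) ∷
    (inj₂ ℕₚ.≤-refl , s≤s (ℕₚ.m∸n≤m (h ℕ.+ h) n)) ∷
    All.map (λ { (inj₁ m≤n , m<d) → inj₁ (ℕₚ.m≤n⇒m≤1+n m≤n) , m<d
               ; (inj₂ d-n≤m , m<d) → inj₂ (ℕₚ.≤-trans (ℕₚ.∸-monoʳ-≤ d (ℕₚ.n≤1+n n)) d-n≤m) , m<d })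
      (exponents-outer n (ℕₚ.<⇒≤ n<h))

  exponents-unique : ∀ n → n ≤ h → AllPairs (λ m m′ → ¬ (m ≡ m′)) (exponents n)
  exponents-unique zero    _   = [] ∷ []
  exponents-unique (suc n) n<h =
    (ℕₚ.<⇒≢ gap ∷ All.map (λ { (inj₁ m≤n , _) → ℕₚ.>⇒≢ (s≤s m≤n)
                             ; (inj₂ d-n≤m , _) → ℕₚ.<⇒≢ (ℕₚ.<-≤-trans gap (ℕₚ.≤-trans (ℕₚ.<⇒≤ step) d-n≤m)) }) outer) ∷
    All.map (λ { (inj₁ m≤n , _) → ℕₚ.>⇒≢ (ℕₚ.≤-<-trans (ℕₚ.m≤n⇒m≤1+n m≤n) gap)
               ; (inj₂ d-n≤m , _) → ℕₚ.<⇒≢ (ℕₚ.<-≤-trans step d-n≤m) }) outer ∷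
    exponents-unique n (ℕₚ.<⇒≤ n<h)
    where
    outer = exponents-outer n (ℕₚ.<⇒≤ n<h)
    gap : suc n < d ℕ.∸ suc n
    gap = ℕₚ.m+n≤o⇒m≤o∸n (suc (suc n)) (≡.subst (_≤ h ℕ.+ h) (≡.cong suc (ℕₚ.+-suc n n)) (ℕₚ.+-mono-≤ n<h n<h))
    step : d ℕ.∸ suc n < d ℕ.∸ n
    step = ℕₚ.≤-reflexive (≡.sym (ℕₚ.+-∸-assoc 1 (ℕₚ.≤-trans (ℕₚ.<⇒≤ n<h) (ℕₚ.m≤m+n h h))))

-- The inverse `γ̄` is a parameter; it will be γ^q, which q ≡ -1 (mod d) makes inverse to γ.
module CyclicProduct {c ℓ : Level} (K : CommutativeRing c ℓ) (1≉0 : ¬ (CommutativeRing._≈_ K (CommutativeRing.1# K) (CommutativeRing.0# K)))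
  (noZeroDiv : NoZeroDivisors K) (h : ℕ) (γ γ̄ : CommutativeRing.Carrier K)
  (γ-primitive : IsPrimitiveRoot K (suc (h ℕ.+ h)) γ)
  (γγ̄≈1 : CommutativeRing._≈_ K (CommutativeRing._*_ K γ γ̄) (CommutativeRing.1# K)) where
  open CommutativeRing K
  open RingProperties ring using (-‿distribʳ-*; -‿distribˡ-*; -1*x≈-x; -‿involutive; -‿+-comm; -0#≈0#; x∙y⁻¹≈ε⇒x≈y)
  open Exp commutativeSemiring using (_^_; ^-congˡ; ^-congʳ; ^-homo-*; ^-assocʳ; ^-distrib-*)
  open CommutativeRingProperties K
  open Exponents h
  open FactorTheorem K
  open Polynomials K

  γ^d≈1 : γ ^ d ≈ 1#
  γ^d≈1 = proj₁ γ-primitive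

  γ^jγ̄^j≈1 : ∀ j → γ ^ j * γ̄ ^ j ≈ 1#
  γ^jγ̄^j≈1 j = trans (sym (^-distrib-* γ γ̄ j)) (trans (^-congˡ j γγ̄≈1) (1^n≈1 j))

  private
    γ̄^≈γ^ : ∀ j → j ≤ d → γ ^ (d ℕ.∸ j) ≈ γ̄ ^ j
    γ̄^≈γ^ j j≤d = begin
      γ ^ (d ℕ.∸ j)                         ≈⟨ *-identityʳ _ ⟨
      γ ^ (d ℕ.∸ j) * 1#                    ≈⟨ *-congˡ (γ^jγ̄^j≈1 j) ⟨
      γ ^ (d ℕ.∸ j) * (γ ^ j * γ̄ ^ j)       ≈⟨ *-assoc _ _ _ ⟨
      γ ^ (d ℕ.∸ j) * γ ^ j * γ̄ ^ j         ≈⟨ *-congʳ (^-homo-* γ (d ℕ.∸ j) j) ⟨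
      γ ^ (d ℕ.∸ j ℕ.+ j) * γ̄ ^ j           ≈⟨ *-congʳ (^-congʳ γ (ℕₚ.m∸n+n≡m j≤d)) ⟩
      γ ^ d * γ̄ ^ j                         ≈⟨ trans (*-congʳ γ^d≈1) (*-identityˡ _) ⟩
      γ̄ ^ j                                 ∎
      where open SetoidReasoning setoid

    module _ (w : Carrier) (w≉0 : ¬ (w ≈ 0#)) where
      open SetoidReasoning setoid

      -- Equality would make wγᵐ(γⁿ⁻ᵐ - 1) zero, where w and γᵐ are nonzero and γⁿ⁻ᵐ ≠ 1 by
      -- primitivity.
      distinct-< : ∀ m n → m < n → n < d → ¬ (w * γ ^ m ≈ w * γ ^ n)
      distinct-< m n m<n n<d e with noZeroDiv (w * γ ^ m) (γ ^ (n ℕ.∸ m) - 1#) (begin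
          w * γ ^ m * (γ ^ (n ℕ.∸ m) - 1#)                  ≈⟨ distribˡ _ _ _ ⟩
          w * γ ^ m * γ ^ (n ℕ.∸ m) + w * γ ^ m * - 1#      ≈⟨ +-cong (begin
              w * γ ^ m * γ ^ (n ℕ.∸ m)      ≈⟨ *-assoc _ _ _ ⟩
              w * (γ ^ m * γ ^ (n ℕ.∸ m))    ≈⟨ *-congˡ (^-homo-* γ m (n ℕ.∸ m)) ⟨
              w * γ ^ (m ℕ.+ (n ℕ.∸ m))      ≈⟨ *-congˡ (^-congʳ γ (ℕₚ.m+[n∸m]≡n (ℕₚ.<⇒≤ m<n))) ⟩
              w * γ ^ n                      ≈⟨ e ⟨
              w * γ ^ m                      ∎)
            (trans (sym (-‿distribʳ-* _ 1#)) (-‿cong (*-identityʳ _))) ⟩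
          w * γ ^ m - w * γ ^ m                             ≈⟨ -‿inverseʳ _ ⟩
          0#                                                ∎)
      ... | inj₂ e₂ = proj₂ γ-primitive (n ℕ.∸ m) (ℕₚ.m<n⇒0<n∸m m<n) (ℕₚ.≤-<-trans (ℕₚ.m∸n≤m n m) n<d)
                        (x∙y⁻¹≈ε⇒x≈y _ _ e₂)
      ... | inj₁ e₁ with noZeroDiv w (γ ^ m) e₁
      ...   | inj₁ w≈0  = w≉0 w≈0
      ...   | inj₂ γ^≈0 = 1≉0 (trans (sym (γ^jγ̄^j≈1 m)) (trans (*-congʳ γ^≈0) (zeroˡ _)))

      distinct : ∀ m n → m < d → n < d → ¬ (m ≡ n) → ¬ (w * γ ^ m ≈ w * γ ^ n)
      distinct m n m<d n<d m≢n e with ℕₚ.<-cmp m n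
      ... | tri< m<n _ _ = distinct-< m n m<n n<d e
      ... | tri≈ _ m≡n _ = m≢n m≡n
      ... | tri> _ _ n<m = distinct-< n m n<m m<d (sym e)

      roots : List Carrier
      roots = map (λ m → w * γ ^ m) (exponents h)

      roots-distinct : AllPairs (λ a b → ¬ (a ≈ b)) roots
      roots-distinct = go (exponents h) (All.map proj₂ (exponents-outer h ℕₚ.≤-refl)) (exponents-unique h ℕₚ.≤-refl)
        where
        go : ∀ ms → All (_< d) ms → AllPairs (λ m n → ¬ (m ≡ n)) ms →
          AllPairs (λ a b → ¬ (a ≈ b)) (map (λ m → w * γ ^ m) ms)
        go []       []           []           = []
        go (m ∷ ms) (m<d ∷ ms<d) (m≢ms ∷ ms≢) =
          Allₚ.map⁺ (All.zipWith (λ (n<d , m≢n) → distinct m _ m<d n<d m≢n) (ms<d , m≢ms)) ∷ go ms ms<d ms≢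

      binomial : Poly K
      binomial = Xpow K d ⊞ cst K (- (w ^ d))

      binomial-monic : MonicOfDegree d binomial
      binomial-monic =
        trans (coeff-⊞ (Xpow K d) (cst K (- (w ^ d))) d) (trans (+-cong (coeff-Xpow-≡ d) (coeff-cst (- (w ^ d)) d (s≤s z≤n))) (+-identityʳ 1#)) ,
        λ m d<m → trans (coeff-⊞ (Xpow K d) (cst K (- (w ^ d))) m)
          (trans (+-cong (coeff-Xpow-≢ d m (ℕₚ.>⇒≢ d<m)) (coeff-cst (- (w ^ d)) m (ℕₚ.≤-<-trans z≤n d<m))) (+-identityʳ 0#))

      binomial-root : ∀ m → evalAt (w * γ ^ m) binomial ≈ 0#
      binomial-root m = begin
        evalAt (w * γ ^ m) binomial             ≈⟨ ev-⊞ (Xpow K d) (cst K (- (w ^ d))) ⟩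
        evalAt (w * γ ^ m) (Xpow K d) + evalAt (w * γ ^ m) (cst K (- (w ^ d)))
                                                ≈⟨ +-cong (ev-Xpow d) (ev-cst _) ⟩
        (w * γ ^ m) ^ d - w ^ d                 ≈⟨ +-congʳ (^-distrib-* w (γ ^ m) d) ⟩
        w ^ d * (γ ^ m) ^ d - w ^ d             ≈⟨ +-congʳ (*-congˡ (begin
            (γ ^ m) ^ d     ≈⟨ ^-assocʳ γ m d ⟩
            γ ^ (m ℕ.* d)   ≈⟨ ^-congʳ γ (ℕₚ.*-comm m d) ⟩
            γ ^ (d ℕ.* m)   ≈⟨ ^-assocʳ γ d m ⟨
            (γ ^ d) ^ m     ≈⟨ ^-congˡ m γ^d≈1 ⟩
            1# ^ m          ≈⟨ 1^n≈1 m ⟩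
            1#              ∎)) ⟩
        w ^ d * 1# - w ^ d                      ≈⟨ +-congʳ (*-identityʳ _) ⟩
        w ^ d - w ^ d                           ≈⟨ -‿inverseʳ _ ⟩
        0#                                      ∎
        where open Evaluation K K (λ x → x) (isHom-id K) (w * γ ^ m)

      binomial-splits : binomial ≐ prodₚ K (map linear roots)
      binomial-splits = splits noZeroDiv roots binomial roots-distinct
        (Allₚ.map⁺ (All.universal binomial-root (exponents h)))
        (≡.subst (λ n → MonicOfDegree n binomial)
          (≡.sym (≡.trans (Listₚ.length-map _ (exponents h)) (length-exponents h))) binomial-monic)

  -- The identities in K[y] are transported to a K-algebra: `A` will be K[x], with y = x for (i) and
  -- y = x^(2^(r-1)) for (ii).
  module _ (A : CommutativeRing c ℓ) (κ : Carrier → CommutativeRing.Carrier A) (κ-hom : IsHom K A κ)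
    (y : CommutativeRing.Carrier A) where
    private module A = CommutativeRing A
    open HomProperties K A κ κ-hom
    open Products A
    open SetoidReasoning A.setoid
    open Solver A.commutativeSemiring using (solve; _:=_; _:+_; _:*_)
    open Exp A.commutativeSemiring using () renaming (_^_ to _^ᴬ_)
    open Evaluation K A κ κ-hom y

    rootPair : Carrier → ℕ → A.Carrier
    rootPair w j = (y A.+ κ (- (w * γ ^ j))) A.* (y A.+ κ (- (w * γ̄ ^ j)))

    private
      ev-linear : ∀ a → ev (linear a) A.≈ y A.+ κ (- a)
      ev-linear a = A.trans (ev-⊞ X (cst K (- a))) (A.+-cong (A.trans (ev-Xpow 1) (A.*-identityʳ y)) (ev-cst (- a)))

      ev-prod : ∀ w n → n ≤ h → ev (prodₚ K (map linear (map (λ m → w * γ ^ m) (exponents n)))) A.≈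
        (y A.+ κ (- w)) A.* ∏< n (λ j → rootPair w (suc j))
      ev-prod w zero _ = A.trans (ev-⊠ (linear (w * γ ^ 0)) (cst K 1#))
        (A.*-cong (A.trans (ev-linear _) (A.+-congˡ (⟦⟧-cong (-‿cong (*-identityʳ w))))) (A.trans (ev-cst 1#) 1#-homo))
      ev-prod w (suc n) n<h = begin
        ev (linear a ⊠ (linear b ⊠ r))                      ≈⟨ A.trans (ev-⊠ (linear a) (linear b ⊠ r)) (A.*-congˡ (ev-⊠ (linear b) r)) ⟩
        ev (linear a) A.* (ev (linear b) A.* ev r)          ≈⟨ A.*-cong (ev-linear a) (A.*-cong
          (A.trans (ev-linear b) (A.+-congˡ (⟦⟧-cong (-‿cong (*-congˡ (γ̄^≈γ^ (suc n) (ℕₚ.≤-trans n<h (ℕₚ.m≤n⇒m≤1+n (ℕₚ.m≤m+n h h)))))))))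
          (ev-prod w n (ℕₚ.<⇒≤ n<h))) ⟩
        p A.* (q A.* (t A.* ∏< n (λ j → rootPair w (suc j))))  ≈⟨ solve 4 (λ p q t r →
          p :* (q :* (t :* r)) := t :* ((p :* q) :* r)) A.refl p q t _ ⟩
        t A.* (rootPair w (suc n) A.* ∏< n (λ j → rootPair w (suc j)))  ≈⟨ A.*-congˡ (∏<-last n (λ j → rootPair w (suc j))) ⟨
        t A.* ∏< (suc n) (λ j → rootPair w (suc j))         ∎
        where
        a = w * γ ^ suc n
        b = w * γ ^ (d ℕ.∸ suc n)
        r = prodₚ K (map linear (map (λ m → w * γ ^ m) (exponents n)))
        p = y A.+ κ (- a)
        q = y A.+ κ (- (w * γ̄ ^ suc n))
        t = y A.+ κ (- w)

    cyclic : ∀ w → ¬ (w ≈ 0#) →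
      (y A.+ κ (- w)) A.* ∏< h (λ j → rootPair w (suc j)) A.≈ y ^ᴬ d A.+ κ (- (w ^ d))
    cyclic w w≉0 = begin
      (y A.+ κ (- w)) A.* ∏< h (λ j → rootPair w (suc j))   ≈⟨ ev-prod w h ℕₚ.≤-refl ⟨
      ev (prodₚ K (map linear (roots w w≉0)))               ≈⟨ ev-cong {binomial w w≉0} (binomial-splits w w≉0) ⟨
      ev (binomial w w≉0)                                   ≈⟨ A.trans (ev-⊞ (Xpow K d) (cst K (- (w ^ d)))) (A.+-cong (ev-Xpow d) (ev-cst _)) ⟩
      y ^ᴬ d A.+ κ (- (w ^ d))                              ∎

    trinomialAt : Carrier → Carrier → A.Carrier
    trinomialAt u v = y A.* y A.+ κ u A.* y A.+ κ v

    trinomialAt-splits : ∀ {u v} a b → u ≈ a + b → v ≈ a * b → trinomialAt u v A.≈ (y A.+ κ a) A.* (y A.+ κ b)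
    trinomialAt-splits {u} {v} a b u≈ v≈ = begin
      y A.* y A.+ κ u A.* y A.+ κ v                       ≈⟨ A.+-cong
        (A.+-congˡ (A.*-congʳ (A.trans (⟦⟧-cong u≈) (+-homo a b)))) (A.trans (⟦⟧-cong v≈) (*-homo a b)) ⟩
      y A.* y A.+ (κ a A.+ κ b) A.* y A.+ κ a A.* κ b     ≈⟨ solve 3 (λ y a b →
        y :* y :+ (a :+ b) :* y :+ a :* b := (y :+ a) :* (y :+ b)) A.refl y (κ a) (κ b) ⟩
      (y A.+ κ a) A.* (y A.+ κ b)                         ∎

    difference-of-squares : ∀ z a → (z A.+ κ a) A.* (z A.+ κ (- a)) A.≈ z A.* z A.+ κ (- (a * a))
    difference-of-squares z a = begin
      (z A.+ κ a) A.* (z A.+ κ (- a))         ≈⟨ A.*-congˡ (A.+-congˡ (-‿homo a)) ⟩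
      (z A.+ κ a) A.* (z A.- κ a)             ≈⟨ [y+t][y-t] z (κ a) ⟩
      z A.* z A.- κ a A.* κ a                 ≈⟨ A.+-congˡ (A.trans (-‿homo (a * a)) (A.-‿cong (*-homo a a))) ⟨
      z A.* z A.+ κ (- (a * a))               ∎

    -w≉0 : ∀ {w} → ¬ (w ≈ 0#) → ¬ (- w ≈ 0#)
    -w≉0 w≉0 e = w≉0 (trans (sym (-‿involutive _)) (trans (-‿cong e) -0#≈0#))

    -- Since d is odd, (-w)^d = -w^d, and the two products are y^d + w^d and y^d - w^d.
    cyclic-± : ∀ w → ¬ (w ≈ 0#) →
      ((y A.+ κ (- - w)) A.* ∏< h (λ j → rootPair (- w) (suc j))) A.*
      ((y A.+ κ (- w)) A.* ∏< h (λ j → rootPair w (suc j)))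
      A.≈ y ^ᴬ d A.* y ^ᴬ d A.+ κ (- (w ^ d * w ^ d))
    cyclic-± w w≉0 = begin
      _                                                 ≈⟨ A.*-cong (cyclic (- w) (-w≉0 w≉0)) (cyclic w w≉0) ⟩
      (z A.+ κ (- ((- w) ^ d))) A.* (z A.+ κ (- (w ^ d)))  ≈⟨ A.*-congʳ (A.+-congˡ (⟦⟧-cong
        (trans (-‿cong (-x^odd≈-[x^odd] w h)) (-‿involutive _)))) ⟩
      (z A.+ κ (w ^ d)) A.* (z A.+ κ (- (w ^ d)))       ≈⟨ difference-of-squares z (w ^ d) ⟩
      z A.* z A.+ κ (- (w ^ d * w ^ d))                 ∎
      where z = y ^ᴬ d

    -- With a plus sign in front of w² each trinomial takes both roots from one sign: y² + wδy + w²
    -- vanishes at -wγʲ and -wγ⁻ʲ, its negated partner at wγʲ and wγ⁻ʲ.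
    cyclic-δ : ∀ w → ¬ (w ≈ 0#) →
      ((y A.+ κ w) A.* (y A.+ κ (- w))) A.* ∏< h (λ j →
        trinomialAt (w * (γ ^ suc j + γ̄ ^ suc j)) (w * w) A.* trinomialAt (- (w * (γ ^ suc j + γ̄ ^ suc j))) (w * w))
      A.≈ y ^ᴬ d A.* y ^ᴬ d A.+ κ (- (w ^ d * w ^ d))
    cyclic-δ w w≉0 = A.trans
      (A.trans (A.*-cong (A.*-congʳ (A.+-congˡ (⟦⟧-cong (sym (-‿involutive w)))))
        (A.trans (∏<-cong h λ j _ → pair (suc j)) (∏<-* h (λ j → rootPair (- w) (suc j)) (λ j → rootPair w (suc j)))))
        (solve 4 (λ a b c d → (a :* b) :* (c :* d) := (a :* c) :* (b :* d)) A.refl _ _ _ _))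
      (cyclic-± w w≉0)
      where
      pair : ∀ j → trinomialAt (w * (γ ^ j + γ̄ ^ j)) (w * w) A.* trinomialAt (- (w * (γ ^ j + γ̄ ^ j))) (w * w)
        A.≈ rootPair (- w) j A.* rootPair w j
      pair j = A.*-cong
        (trinomialAt-splits (- (- w * g)) (- (- w * ḡ))
          (trans (distribˡ w g ḡ) (+-cong (sym (neg²-* g)) (sym (neg²-* ḡ))))
          (trans (sym ww) (*-cong (sym (neg²-* g)) (sym (neg²-* ḡ)))))
        (trinomialAt-splits (- (w * g)) (- (w * ḡ))
          (trans (-‿cong (distribˡ w g ḡ)) (sym (-‿+-comm _ _)))
          (trans (sym ww) (sym (-x*-y≈xy _ _))))
        where
        g = γ ^ j
        ḡ = γ̄ ^ j
        neg²-* : ∀ x → - (- w * x) ≈ w * x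
        neg²-* x = trans (-‿distribˡ-* (- w) x) (*-congʳ (-‿involutive w))
        ww : (w * g) * (w * ḡ) ≈ w * w
        ww = trans (*-interchange w g w ḡ) (trans (*-congˡ (γ^jγ̄^j≈1 j)) (*-identityʳ _))

    -- The constant term -w² mixes the signs: y² + wθy - w² = (y + wγʲ)(y - wγ⁻ʲ). The four linear
    -- factors belonging to j are therefore regrouped before the products for -w and w appear.
    cyclic-θ : ∀ w → ¬ (w ≈ 0#) →
      (y A.* y A.+ κ (- (w * w))) A.* ∏< h (λ j →
        trinomialAt (w * (γ ^ suc j - γ̄ ^ suc j)) (- (w * w)) A.* trinomialAt (- (w * (γ ^ suc j - γ̄ ^ suc j))) (- (w * w)))
      A.≈ y ^ᴬ d A.* y ^ᴬ d A.+ κ (- (w ^ d * w ^ d))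
    cyclic-θ w w≉0 = A.trans
      (A.trans (A.*-cong (A.trans (A.sym (difference-of-squares y w)) (A.*-congʳ (A.+-congˡ (⟦⟧-cong (sym (-‿involutive w))))))
        (A.trans (∏<-cong h λ j _ → pair (suc j)) (∏<-* h (λ j → rootPair (- w) (suc j)) (λ j → rootPair w (suc j)))))
        (solve 4 (λ a b c d → (a :* b) :* (c :* d) := (a :* c) :* (b :* d)) A.refl _ _ _ _))
      (cyclic-± w w≉0)
      where
      pair : ∀ j → trinomialAt (w * (γ ^ j - γ̄ ^ j)) (- (w * w)) A.* trinomialAt (- (w * (γ ^ j - γ̄ ^ j))) (- (w * w))
        A.≈ rootPair (- w) j A.* rootPair w j
      pair j = A.trans (A.*-cong
        (trinomialAt-splits (- (- w * g)) (- (w * ḡ))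
          (trans (distribˡ w g (- ḡ)) (+-cong (sym (neg²-* g)) (sym (-‿distribʳ-* w ḡ))))
          (trans (-‿cong (sym ww)) (trans (-‿distribʳ-* _ _) (*-congʳ (sym (neg²-* g))))))
        (trinomialAt-splits (- (w * g)) (- (- w * ḡ))
          (trans (-‿cong (distribˡ w g (- ḡ))) (trans (sym (-‿+-comm _ _))
            (+-congˡ (trans (-‿cong (trans (sym (-‿distribʳ-* w ḡ)) (-‿distribˡ-* w ḡ))) refl))))
          (trans (-‿cong (sym ww)) (trans (-‿distribˡ-* _ _) (*-congˡ (sym (neg²-* ḡ)))))))
        (solve 4 (λ a b c d → (a :* b) :* (c :* d) := (a :* d) :* (c :* b)) A.refl _ _ _ _)
        where
        g = γ ^ j
        ḡ = γ̄ ^ j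
        neg²-* : ∀ x → - (- w * x) ≈ w * x
        neg²-* x = trans (-‿distribˡ-* (- w) x) (*-congʳ (-‿involutive w))
        ww : (w * g) * (w * ḡ) ≈ w * w
        ww = trans (*-interchange w g w ḡ) (trans (*-congˡ (γ^jγ̄^j≈1 j)) (*-identityʳ _))

    -- The index l of (ii): l = 0 belongs to w, l = 1 to iw, whose square is -w². As d is odd,
    -- (iw)^(2d) = -w^(2d), and the two products form another difference of squares.
    cyclic-θ-± : ∀ i w → i * i ≈ - 1# → ¬ (w ≈ 0#) → ¬ (i * w ≈ 0#) →
      ((y A.* y A.+ κ (w * w)) A.* (y A.* y A.+ κ (- (w * w)))) A.* ∏< h (λ j →
        (trinomialAt (w * (γ ^ suc j - γ̄ ^ suc j)) (- (w * w)) A.* trinomialAt (- (w * (γ ^ suc j - γ̄ ^ suc j))) (- (w * w))) A.*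
        (trinomialAt (i * w * (γ ^ suc j - γ̄ ^ suc j)) (w * w) A.* trinomialAt (- (i * w * (γ ^ suc j - γ̄ ^ suc j))) (w * w)))
      A.≈ (y ^ᴬ d A.* y ^ᴬ d) A.* (y ^ᴬ d A.* y ^ᴬ d) A.+ κ (- ((w ^ d * w ^ d) * (w ^ d * w ^ d)))
    cyclic-θ-± i w ii≈-1 w≉0 iw≉0 = begin
      _ ≈⟨ A.*-cong (A.*-congʳ (A.+-congˡ (⟦⟧-cong (sym -[iw]²≈w²))))
             (A.trans (∏<-cong h λ j _ → A.*-congˡ (A.*-cong (A.+-congˡ (⟦⟧-cong (sym -[iw]²≈w²))) (A.+-congˡ (⟦⟧-cong (sym -[iw]²≈w²)))))
                      (∏<-* h T T′)) ⟩
      _ ≈⟨ solve 4 (λ a b c d → (a :* b) :* (c :* d) := (a :* d) :* (b :* c)) A.refl _ _ (∏< h T) (∏< h T′) ⟩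
      _ ≈⟨ A.*-cong (cyclic-θ (i * w) iw≉0) (cyclic-θ w w≉0) ⟩
      (Z A.+ κ (- ((i * w) ^ d * (i * w) ^ d))) A.* (Z A.+ κ (- (w ^ d * w ^ d)))
        ≈⟨ A.*-congʳ (A.+-congˡ (⟦⟧-cong -[iw]^2d≈w^2d)) ⟩
      (Z A.+ κ (w ^ d * w ^ d)) A.* (Z A.+ κ (- (w ^ d * w ^ d)))  ≈⟨ difference-of-squares Z (w ^ d * w ^ d) ⟩
      _ ∎
      where
      Z = y ^ᴬ d A.* y ^ᴬ d
      T T′ : ℕ → A.Carrier
      T j = trinomialAt (w * (γ ^ suc j - γ̄ ^ suc j)) (- (w * w)) A.* trinomialAt (- (w * (γ ^ suc j - γ̄ ^ suc j))) (- (w * w))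
      T′ j = trinomialAt (i * w * (γ ^ suc j - γ̄ ^ suc j)) (- (i * w * (i * w))) A.*
             trinomialAt (- (i * w * (γ ^ suc j - γ̄ ^ suc j))) (- (i * w * (i * w)))
      [iw]²≈-w² : i * w * (i * w) ≈ - (w * w)
      [iw]²≈-w² = trans (*-interchange i w i w)
          (trans (*-congʳ ii≈-1) (-1*x≈-x _))
      -[iw]²≈w² : - (i * w * (i * w)) ≈ w * w
      -[iw]²≈w² = trans (-‿cong [iw]²≈-w²) (-‿involutive _)
      -[iw]^2d≈w^2d : - ((i * w) ^ d * (i * w) ^ d) ≈ w ^ d * w ^ d
      -[iw]^2d≈w^2d = trans (-‿cong (trans (sym (^-distrib-* _ _ d)) (trans (^-congˡ d [iw]²≈-w²) (-x^odd≈-[x^odd] _ h))))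
        (trans (-‿involutive _) (^-distrib-* w w d))

-- The extension K of F

module MapPolynomials {c ℓ : Level} (F K : CommutativeRing c ℓ)
  (ι : CommutativeRing.Carrier F → CommutativeRing.Carrier K) (ι-hom : IsHom F K ι) where
  private
    module F = CommutativeRing F
    module K = CommutativeRing K
    module PF = Polynomials F
  open Polynomials K
  open HomProperties F K ι ι-hom
  private
    module E = Evaluation F polyRing (λ x → cst K (ι x)) (isHom-∘ F K polyRing ι-hom cst-isHom) X

  -- Applying ι to the coefficients is evaluation at x in K[x], which supplies the homomorphism
  -- laws; `compose` is treated likewise below.
  mapₚ≐ev : ∀ p → mapₚ F K ι p ≐ E.ev p
  mapₚ≐ev []      = ≐-refl
  mapₚ≐ev (a ∷ p) = ≐-trans (∷≐cst⊞X⊠ (ι a) (mapₚ F K ι p)) (⊞-cong (≐-refl {cst K (ι a)}) (⊠-congˡ X (mapₚ≐ev p)))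

  mapₚ-isHom : IsHom PF.polyRing polyRing (mapₚ F K ι)
  mapₚ-isHom = isHom PF.polyRing polyRing (mapₚ F K ι)
    (λ {p} {q} e → ≐-trans (mapₚ≐ev p) (≐-trans (E.ev-cong {p} {q} e) (≐-sym (mapₚ≐ev q))))
    (λ p q → ≐-trans (mapₚ≐ev (_+ₚ_ F p q)) (≐-trans (E.ev-⊞ p q) (≐-sym (⊞-cong (mapₚ≐ev p) (mapₚ≐ev q)))))
    (λ p q → ≐-trans (mapₚ≐ev (_*ₚ_ F p q)) (≐-trans (E.ev-⊠ p q) (≐-sym (⊠-cong (mapₚ≐ev p) (mapₚ≐ev q)))))
    ≐-refl (∷-cong 1#-homo ≐-refl)

  mapₚ-Xpow : ∀ n → mapₚ F K ι (Xpow F n) ≐ Xpow K n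
  mapₚ-Xpow zero    = ∷-cong 1#-homo ≐-refl
  mapₚ-Xpow (suc n) = ∷-cong 0#-homo (mapₚ-Xpow n)

  mapₚ-· : ∀ u {U} p {P} → ι u K.≈ U → mapₚ F K ι p ≐ P → mapₚ F K ι (_·ₚ_ F u p) ≐ _·ₚ_ K U P
  mapₚ-· u p ιu≈U e = ≐-trans (go p) (·-cong ιu≈U e)
    where
    go : ∀ p → mapₚ F K ι (_·ₚ_ F u p) ≐ _·ₚ_ K (ι u) (mapₚ F K ι p)
    go []      = ≐-refl
    go (a ∷ p) = ∷-cong (*-homo u a) (go p)

  compose≐ev : ∀ g p → PF._≐_ (compose F p g) (Evaluation.ev F PF.polyRing (cst F) PF.cst-isHom g p)
  compose≐ev g []      = PF.≐-refl
  compose≐ev g (a ∷ p) = PF.⊞-cong (PF.≐-refl {cst F a}) (PF.⊠-congˡ g (compose≐ev g p))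

  mapₚ-compose : ∀ n d → mapₚ F K ι (compose F (_+ₚ_ F (Xpow F n) (cst F F.1#)) (Xpow F d)) ≐
    pow polyRing (Xpow K d) n ⊞ cst K K.1#
  mapₚ-compose n d = ≐-trans (M.⟦⟧-cong {compose F (_+ₚ_ F (Xpow F n) (cst F F.1#)) g} {pow PF.polyRing g n PF.⊞ cst F F.1#}
      (PF.≐-trans (compose≐ev g (_+ₚ_ F (Xpow F n) (cst F F.1#)))
        (PF.≐-trans (ev-⊞ (Xpow F n) (cst F F.1#)) (PF.⊞-cong (ev-Xpow n) (ev-cst F.1#)))))
    (≐-trans (M.+-homo (pow PF.polyRing g n) (cst F F.1#))
      (⊞-cong (≐-trans (M.^-homo g n) (^-congˡ n (mapₚ-Xpow d))) (∷-cong 1#-homo ≐-refl)))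
    where
    g = Xpow F d
    module M = HomProperties PF.polyRing polyRing (mapₚ F K ι) mapₚ-isHom
    open Evaluation F PF.polyRing (cst F) PF.cst-isHom g
    open Exp (CommutativeRing.commutativeSemiring polyRing) using (^-congˡ)

trinomialOver : {c ℓ : Level} (K : CommutativeRing c ℓ) → ℕ → ℕ → (u v : CommutativeRing.Carrier K) → Poly K
trinomialOver K n m u v = _+ₚ_ K (_+ₚ_ K (Xpow K n) (_·ₚ_ K u (Xpow K m))) (cst K v)

-- The order of x divides both d ∣ q + 1 and q − 1, hence 2; but d = 2h + 1 is odd.
coprime-orders : {c ℓ : Level} (R : CommutativeRing c ℓ) → IsField R → ∀ q-1 h → suc (h ℕ.+ h) ∣ suc (suc q-1) →
  let open CommutativeRing R in
  ∀ x → (¬ (x ≈ 0#) → pow R x q-1 ≈ 1#) → pow R x (suc (h ℕ.+ h)) ≈ 1# → x ≈ 1#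
coprime-orders R R-field q-1 h (divides m 1+q≡md) x x^[q-1]≈1 x^d≈1 = begin
    x                    ≈⟨ *-identityʳ x ⟨
    x * 1#               ≈⟨ *-congˡ (trans (^-congˡ h xx≈1) (1^n≈1 h)) ⟨
    x * (x * x) ^ h      ≈⟨ *-congˡ (trans (^-distrib-* x x h) (sym (^-homo-* x h h))) ⟩
    x ^ d                ≈⟨ x^d≈1 ⟩
    1#                   ∎
  where
  open CommutativeRing R
  open Exp commutativeSemiring using (_^_; ^-congˡ; ^-congʳ; ^-homo-*; ^-assocʳ; ^-distrib-*)
  open CommutativeRingProperties R
  open SetoidReasoning setoid
  d = suc (h ℕ.+ h)
  x≉0 : ¬ (x ≈ 0#)
  x≉0 x≈0 = proj₁ R-field (trans (sym x^d≈1) (trans (*-congʳ x≈0) (zeroˡ _)))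
  xx≈1 : x * x ≈ 1#
  xx≈1 = begin
    x * x                        ≈⟨ *-congˡ (*-identityʳ x) ⟨
    x * (x * 1#)                 ≈⟨ *-congˡ (*-congˡ (x^[q-1]≈1 x≉0)) ⟨
    x ^ suc (suc q-1)            ≈⟨ ^-congʳ x (≡.trans 1+q≡md (ℕₚ.*-comm m d)) ⟩
    x ^ (d ℕ.* m)                ≈⟨ ^-assocʳ x d m ⟨
    (x ^ d) ^ m                  ≈⟨ trans (^-congˡ m x^d≈1) (1^n≈1 m) ⟩
    1#                           ∎

-- Writing q = 1 + 4C makes (q - 1)/2 = 2C and (q + 1)/2 = 2C + 1 available without division. The
-- hypothesis α^(2C) = -1 is Euler's condition for a nonsquare of F.
module FieldExtension {c ℓ : Level} (F K : CommutativeRing c ℓ) (C h : ℕ)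
  (F-field : IsField F) (F-card : HasCard F (suc (2 ℕ.* (2 ℕ.* C))))
  (K-field : IsField K) (K-card : HasCard K (suc (2 ℕ.* (2 ℕ.* C)) ℕ.* suc (2 ℕ.* (2 ℕ.* C))))
  (ι : CommutativeRing.Carrier F → CommutativeRing.Carrier K) (ι-hom : IsHom F K ι)
  (α : CommutativeRing.Carrier F)
  (α^2C≈-1 : CommutativeRing._≈_ F (pow F α (2 ℕ.* C)) (CommutativeRing.-_ F (CommutativeRing.1# F)))
  (-1≉1 : ¬ (CommutativeRing._≈_ F (CommutativeRing.-_ F (CommutativeRing.1# F)) (CommutativeRing.1# F)))
  (β : CommutativeRing.Carrier K)
  (β²≈α : CommutativeRing._≈_ K (CommutativeRing._*_ K β β) (ι α))
  (d∣1+q : suc (h ℕ.+ h) ∣ suc (suc (2 ℕ.* (2 ℕ.* C)))) where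

  private
    module F where
      open CommutativeRing F public
      open RingProperties ring public using (x∙y⁻¹≈ε⇒x≈y)
      open Exp commutativeSemiring public using (_^_; ^-congˡ; ^-homo-*; ^-assocʳ)
      open CommutativeRingProperties F public using (1^n≈1; ^-2*)
  open CommutativeRingProperties K
  open CommutativeRing K
  open RingProperties ring using (-‿distribˡ-*; -‿distribʳ-*; -‿+-comm; -‿involutive; -0#≈0#; x∙y⁻¹≈ε⇒x≈y; x≈y⇒x∙y⁻¹≈ε; +-inverseʳ-unique)
  open Exp commutativeSemiring using (_^_; ^-congˡ; ^-congʳ; ^-homo-*; ^-assocʳ; ^-distrib-*)
  open HomProperties F K ι ι-hom
  open SetoidReasoning setoid
  open Solver commutativeSemiring using (solve; _:=_; _:+_; _:*_)

  q d M : ℕ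
  q = suc (2 ℕ.* (2 ℕ.* C))
  d = suc (h ℕ.+ h)
  -- (q² − 1)/2
  M = 2 ℕ.* (2 ℕ.* C) ℕ.* suc (2 ℕ.* C)

  F-discrete : Discrete F
  F-discrete = FiniteRing.finite-discrete F F-card

  K-discrete : Discrete K
  K-discrete = FiniteRing.finite-discrete K K-card

  K-noZeroDiv : NoZeroDivisors K
  K-noZeroDiv = field⇒noZeroDivisors K K-field K-discrete

  ι≈0⇒≈0 : ∀ {x} → ι x ≈ 0# → x F.≈ F.0#
  ι≈0⇒≈0 {x} ιx≈0 with F-discrete x F.0#
  ... | yes x≈0 = x≈0
  ... | no x≉0 = let x′ , xx′≈1 = proj₂ F-field x x≉0 in ⊥-elim (proj₁ K-field (begin
    1#            ≈⟨ 1#-homo ⟨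
    ι F.1#        ≈⟨ ⟦⟧-cong xx′≈1 ⟨
    ι (x F.* x′)  ≈⟨ *-homo x x′ ⟩
    ι x * ι x′    ≈⟨ trans (*-congʳ ιx≈0) (zeroˡ _) ⟩
    0#            ∎))

  ι-injective : ∀ {x y} → ι x ≈ ι y → x F.≈ y
  ι-injective {x} {y} e = F.x∙y⁻¹≈ε⇒x≈y x y (ι≈0⇒≈0 (begin
    ι (x F.- y)      ≈⟨ trans (+-homo x (F.- y)) (+-congˡ (-‿homo y)) ⟩
    ι x - ι y        ≈⟨ x≈y⇒x∙y⁻¹≈ε e ⟩
    0#               ∎))

  K-1≉1 : ¬ (- 1# ≈ 1#)
  K-1≉1 e = -1≉1 (ι-injective (trans (-‿homo F.1#) (trans (-‿cong 1#-homo) (trans e (sym 1#-homo)))))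

  private
    F^M≈1 : ∀ x → ¬ (x F.≈ F.0#) → x F.^ M F.≈ F.1#
    F^M≈1 x x≉0 = F.trans (F.sym (F.^-assocʳ x (2 ℕ.* (2 ℕ.* C)) (suc (2 ℕ.* C))))
      (F.trans (F.^-congˡ (suc (2 ℕ.* C)) (fermat F F-field q F-card x x≉0)) (F.1^n≈1 (suc (2 ℕ.* C))))

    β^M≈-1 : β ^ M ≈ - 1#
    β^M≈-1 = begin
      β ^ M                                      ≈⟨ ^-congʳ β (ℕₚ.*-assoc 2 (2 ℕ.* C) (suc (2 ℕ.* C))) ⟩
      β ^ (2 ℕ.* (2 ℕ.* C ℕ.* suc (2 ℕ.* C)))    ≈⟨ ^-assocʳ β 2 (2 ℕ.* C ℕ.* suc (2 ℕ.* C)) ⟨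
      (β ^ 2) ^ (2 ℕ.* C ℕ.* suc (2 ℕ.* C))      ≈⟨ ^-congˡ (2 ℕ.* C ℕ.* suc (2 ℕ.* C)) (trans (*-congˡ (*-identityʳ β)) β²≈α) ⟩
      ι α ^ (2 ℕ.* C ℕ.* suc (2 ℕ.* C))          ≈⟨ ^-assocʳ (ι α) (2 ℕ.* C) (suc (2 ℕ.* C)) ⟨
      (ι α ^ (2 ℕ.* C)) ^ suc (2 ℕ.* C)          ≈⟨ ^-congˡ (suc (2 ℕ.* C)) (^-homo α (2 ℕ.* C)) ⟨
      ι (α F.^ (2 ℕ.* C)) ^ suc (2 ℕ.* C)        ≈⟨ ^-congˡ (suc (2 ℕ.* C)) (trans (⟦⟧-cong α^2C≈-1) (trans (-‿homo F.1#) (-‿cong 1#-homo))) ⟩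
      (- 1#) ^ suc (2 ℕ.* C)                     ≈⟨ trans (*-congˡ (^-2* (- 1#) C)) (-1^odd≈-1 C) ⟩
      - 1#                                       ∎

    M≡2C*[1+q] : M ≡ suc q ℕ.* (2 ℕ.* C)
    M≡2C*[1+q] = ≡.sym (+-*-Solver.solve 1 (λ c → (con 2 :+ℕ con 2 :*ℕ (con 2 :*ℕ c)) :*ℕ (con 2 :*ℕ c)
        :=ℕ con 2 :*ℕ (con 2 :*ℕ c) :*ℕ (con 1 :+ℕ con 2 :*ℕ c)) ≡.refl C)
      where open +-*-Solver using (con) renaming (_:+_ to _:+ℕ_; _:*_ to _:*ℕ_; _:=_ to _:=ℕ_)

    2M≡q²-1 : 2 ℕ.* M ≡ q ℕ.* q ℕ.∸ 1
    2M≡q²-1 = ≡.cong ℕ.pred (+-*-Solver.solve 1 (λ c →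
        con 1 :+ℕ con 2 :*ℕ (con 2 :*ℕ (con 2 :*ℕ c) :*ℕ (con 1 :+ℕ con 2 :*ℕ c))
        :=ℕ (con 1 :+ℕ con 2 :*ℕ (con 2 :*ℕ c)) :*ℕ (con 1 :+ℕ con 2 :*ℕ (con 2 :*ℕ c))) ≡.refl C)
      where open +-*-Solver using (con) renaming (_:+_ to _:+ℕ_; _:*_ to _:*ℕ_; _:=_ to _:=ℕ_)

  -- Both q - 1 and q + 1 divide `M`, so x and g contribute 1 and β supplies the sign.
  ω^M≈-1 : ∀ x g → ¬ (x F.≈ F.0#) → g ^ suc q ≈ 1# → (ι x * (β * g)) ^ M ≈ - 1#
  ω^M≈-1 x g x≉0 g^≈1 = begin
    (ι x * (β * g)) ^ M           ≈⟨ trans (^-distrib-* (ι x) (β * g) M) (*-congˡ (^-distrib-* β g M)) ⟩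
    ι x ^ M * (β ^ M * g ^ M)     ≈⟨ *-cong
      (trans (sym (^-homo x M)) (trans (⟦⟧-cong (F^M≈1 x x≉0)) 1#-homo))
      (*-cong β^M≈-1 (trans (^-congʳ g M≡2C*[1+q]) (trans (sym (^-assocʳ g (suc q) (2 ℕ.* C)))
        (trans (^-congˡ (2 ℕ.* C) g^≈1) (1^n≈1 (2 ℕ.* C)))))) ⟩
    1# * (- 1# * 1#)              ≈⟨ trans (*-identityˡ _) (*-identityʳ _) ⟩
    - 1#                          ∎

  private
    0^n≉-1 : ∀ {x} → x ≈ 0# → ∀ n → ¬ (x ^ n ≈ - 1#)
    0^n≉-1 x≈0 zero    e = K-1≉1 (sym e)
    0^n≉-1 x≈0 (suc n) e = proj₁ K-field (begin
      1#            ≈⟨ -‿involutive 1# ⟨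
      - - 1#        ≈⟨ -‿cong e ⟨
      - (_ * _)     ≈⟨ -‿cong (trans (*-congʳ x≈0) (zeroˡ _)) ⟩
      - 0#          ≈⟨ -0#≈0# ⟩
      0#            ∎)

  -- Nonzero elements of F have power 1, because `M` is a multiple of q - 1.
  ^M≈-1⇒∉F : ∀ ω → ω ^ M ≈ - 1# → ∀ x → ¬ (ι x ≈ ω)
  ^M≈-1⇒∉F ω ω^≈-1 x ιx≈ω with F-discrete x F.0#
  ... | yes x≈0 = 0^n≉-1 (trans (sym ιx≈ω) (trans (⟦⟧-cong x≈0) 0#-homo)) M ω^≈-1
  ... | no x≉0  = K-1≉1 (begin
    - 1#           ≈⟨ ω^≈-1 ⟨
    ω ^ M          ≈⟨ ^-congˡ M ιx≈ω ⟨
    ι x ^ M        ≈⟨ ^-homo x M ⟨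
    ι (x F.^ M)    ≈⟨ ⟦⟧-cong (F^M≈1 x x≉0) ⟩
    ι F.1#         ≈⟨ 1#-homo ⟩
    1#             ∎)

  -- Half of Euler's criterion in K: a nonzero square x² has power x^(2M) = x^(q² - 1) = 1.
  ^M≈-1⇒nonSquare : ∀ ω → ω ^ M ≈ - 1# → NonSquare K ω
  ^M≈-1⇒nonSquare ω ω^≈-1 x xx≈ω with K-discrete x 0#
  ... | yes x≈0 = 0^n≉-1 (trans (sym xx≈ω) (trans (*-congʳ x≈0) (zeroˡ x))) M ω^≈-1
  ... | no x≉0  = K-1≉1 (begin
    - 1#              ≈⟨ ω^≈-1 ⟨
    ω ^ M             ≈⟨ ^-congˡ M (trans (*-congˡ (*-identityʳ x)) xx≈ω) ⟨
    (x ^ 2) ^ M       ≈⟨ ^-assocʳ x 2 M ⟩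
    x ^ (2 ℕ.* M)     ≈⟨ ^-congʳ x 2M≡q²-1 ⟩
    x ^ (q ℕ.* q ℕ.∸ 1)  ≈⟨ fermat K K-field (q ℕ.* q) K-card x x≉0 ⟩
    1#                ∎)

  linear-independence : ∀ ω → (∀ x → ¬ (ι x ≈ ω)) → ∀ a b → ι a + ω * ι b ≈ 0# → (a F.≈ F.0#) × (b F.≈ F.0#)
  linear-independence ω ω∉F a b e with F-discrete b F.0#
  ... | yes b≈0 = ι≈0⇒≈0 (begin
      ι a                 ≈⟨ +-identityʳ _ ⟨
      ι a + 0#            ≈⟨ +-congˡ (trans (*-congˡ (trans (⟦⟧-cong b≈0) 0#-homo)) (zeroʳ ω)) ⟨
      ι a + ω * ι b       ≈⟨ e ⟩
      0#                  ∎) , b≈0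
  ... | no b≉0 = let b′ , bb′≈1 = proj₂ F-field b b≉0 in ⊥-elim (ω∉F (F.- a F.* b′) (begin
      ι (F.- a F.* b′)         ≈⟨ *-homo (F.- a) b′ ⟩
      ι (F.- a) * ι b′         ≈⟨ *-congʳ (trans (-‿homo a) (sym (+-inverseʳ-unique _ _ e))) ⟩
      ω * ι b * ι b′           ≈⟨ *-assoc _ _ _ ⟩
      ω * (ι b * ι b′)         ≈⟨ *-congˡ (*-homo b b′) ⟨
      ω * ι (b F.* b′)         ≈⟨ *-congˡ (trans (⟦⟧-cong bb′≈1) 1#-homo) ⟩
      ω * 1#                   ≈⟨ *-identityʳ ω ⟩
      ω                        ∎))

  β∉F : ∀ x → ¬ (ι x ≈ β)
  β∉F = ^M≈-1⇒∉F β β^M≈-1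

  coordinates-unique : ∀ a b a′ b′ → ι a + β * ι b ≈ ι a′ + β * ι b′ → (a F.≈ a′) × (b F.≈ b′)
  coordinates-unique a b a′ b′ e =
    let z , z′ = linear-independence β β∉F (a F.- a′) (b F.- b′) (begin
          ι (a F.- a′) + β * ι (b F.- b′)             ≈⟨ +-cong (ι-- a a′) (*-congˡ (ι-- b b′)) ⟩
          (ι a + ι⁻ a′) + β * (ι b + ι⁻ b′)           ≈⟨ solve 5 (λ a n b m t →
            (a :+ n) :+ t :* (b :+ m) := (a :+ t :* b) :+ (n :+ t :* m)) refl (ι a) (ι⁻ a′) (ι b) (ι⁻ b′) β ⟩
          (ι a + β * ι b) + (ι⁻ a′ + β * ι⁻ b′)       ≈⟨ +-congʳ e ⟩
          (ι a′ + β * ι b′) + (ι⁻ a′ + β * ι⁻ b′)     ≈⟨ solve 5 (λ a n b m t →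
            (a :+ t :* b) :+ (n :+ t :* m) := (a :+ n) :+ t :* (b :+ m)) refl (ι a′) (ι⁻ a′) (ι b′) (ι⁻ b′) β ⟩
          (ι a′ + ι⁻ a′) + β * (ι b′ + ι⁻ b′)         ≈⟨ +-cong (-‿inverseʳ _) (trans (*-congˡ (-‿inverseʳ _)) (zeroʳ β)) ⟩
          0# + 0#                                     ≈⟨ +-identityˡ 0# ⟩
          0#                                          ∎)
    in F.x∙y⁻¹≈ε⇒x≈y a a′ z , F.x∙y⁻¹≈ε⇒x≈y b b′ z′
    where
    ι⁻ : F.Carrier → Carrier
    ι⁻ x = - ι x
    ι-- : ∀ x y → ι (x F.- y) ≈ ι x + ι⁻ y
    ι-- x y = trans (+-homo x (F.- y)) (+-congˡ (-‿homo y))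

  -- F ⊕ Fβ has q² elements, as many as K.
  coordinates : ∀ x → ∃₂ λ a b → x ≈ ι a + β * ι b
  coordinates x =
    let k , fk≡ = injective⇒surjective f f-injective (K.index x)
    in a k , b k , (begin
      x                         ≈⟨ K.element-index x ⟨
      K.element (K.index x)     ≈⟨ reflexive (≡.cong K.element fk≡) ⟨
      K.element (f k)           ≈⟨ K.element-index _ ⟩
      ι (a k) + β * ι (b k)     ∎)
    where
    module FF = FiniteRing F F-card
    module K = FiniteRing K K-card
    a b : Fin (q ℕ.* q) → F.Carrier
    a k = FF.element (proj₁ (Fin.remQuot {q} q k))
    b k = FF.element (proj₂ (Fin.remQuot {q} q k))
    f : Fin (q ℕ.* q) → Fin (q ℕ.* q)
    f k = K.index (ι (a k) + β * ι (b k))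
    f-injective : ∀ {k k′} → f k ≡ f k′ → k ≡ k′
    f-injective {k} {k′} e =
      let ea , eb = coordinates-unique (a k) (b k) (a k′) (b k′)
            (trans (sym (K.element-index _)) (trans (reflexive (≡.cong K.element e)) (K.element-index _)))
      in ≡.trans (≡.sym (Finₚ.combine-remQuot {q} q k))
          (≡.trans (≡.cong₂ Fin.combine (FF.element-injective ea) (FF.element-injective eb))
            (Finₚ.combine-remQuot {q} q k′))

  -- The conjugation of K over F, as a relation.
  Conjugate : Carrier → Carrier → Set (c ⊔ ℓ)
  Conjugate x y = ∃₂ λ a b → (x ≈ ι a + β * ι b) × (y ≈ ι a + - β * ι b)

  private
    -β²≈α : - β * - β ≈ ι α
    -β²≈α = trans (-x*-y≈xy β β) β²≈α

    -- Stated for any square root τ of α, so that β and -β yield the same coordinates; this is why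
    -- conjugation is multiplicative.
    coordinates-* : ∀ τ → τ * τ ≈ ι α → ∀ a b a′ b′ → (ι a + τ * ι b) * (ι a′ + τ * ι b′)
      ≈ ι (a F.* a′ F.+ α F.* (b F.* b′)) + τ * ι (a F.* b′ F.+ b F.* a′)
    coordinates-* τ ττ≈α a b a′ b′ = begin
      (ι a + τ * ι b) * (ι a′ + τ * ι b′)                                 ≈⟨ solve 5 (λ t a b c d →
        (a :+ t :* b) :* (c :+ t :* d) := (a :* c :+ (t :* t) :* (b :* d)) :+ t :* (a :* d :+ b :* c)) refl τ (ι a) (ι b) (ι a′) (ι b′) ⟩
      (ι a * ι a′ + (τ * τ) * (ι b * ι b′)) + τ * (ι a * ι b′ + ι b * ι a′)  ≈⟨ +-cong
        (sym (trans (+-homo _ _) (+-cong (*-homo _ _) (trans (*-homo _ _) (*-cong (sym ττ≈α) (*-homo _ _))))))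
        (*-congˡ (sym (trans (+-homo _ _) (+-cong (*-homo _ _) (*-homo _ _))))) ⟩
      _ ∎

  conjugate-1 : Conjugate 1# 1#
  conjugate-1 = F.1# , F.0# , e β , e (- β)
    where
    e : ∀ τ → 1# ≈ ι F.1# + τ * ι F.0#
    e τ = sym (trans (+-cong 1#-homo (trans (*-congˡ 0#-homo) (zeroʳ τ))) (+-identityʳ 1#))

  conjugate-* : ∀ {x y x′ y′} → Conjugate x y → Conjugate x′ y′ → Conjugate (x * x′) (y * y′)
  conjugate-* (a , b , e₁ , e₂) (a′ , b′ , e₁′ , e₂′) = _ , _ ,
    trans (*-cong e₁ e₁′) (coordinates-* β β²≈α a b a′ b′) ,
    trans (*-cong e₂ e₂′) (coordinates-* (- β) -β²≈α a b a′ b′)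

  conjugate-^ : ∀ {x y} → Conjugate x y → ∀ n → Conjugate (x ^ n) (y ^ n)
  conjugate-^ x~y zero    = conjugate-1
  conjugate-^ x~y (suc n) = conjugate-* x~y (conjugate-^ x~y n)

  -- Uniqueness of coordinates makes the relation single-valued, which is what carries an equation
  -- over to conjugates.
  conjugate-unique : ∀ {x y y′} → Conjugate x y → Conjugate x y′ → y ≈ y′
  conjugate-unique (a , b , e₁ , e₂) (a′ , b′ , e₁′ , e₂′) =
    let ea , eb = coordinates-unique a b a′ b′ (trans (sym e₁) e₁′)
    in trans e₂ (trans (+-cong (⟦⟧-cong ea) (*-congˡ (⟦⟧-cong eb))) (sym e₂′))

  conjugate-cong : ∀ {x x′ y} → x ≈ x′ → Conjugate x y → Conjugate x′ y
  conjugate-cong e (a , b , e₁ , e₂) = a , b , trans (sym e) e₁ , e₂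

  norm∈F : ∀ {x y} → Conjugate x y → ∃ λ n → ι n ≈ x * y
  norm∈F {x} {y} (a , b , e₁ , e₂) = a F.* a F.+ α F.* (F.- (b F.* b)) , (begin
    ι (a F.* a F.+ α F.* (F.- (b F.* b)))    ≈⟨ trans (+-homo _ _) (+-cong (*-homo a a)
      (trans (*-homo α _) (*-cong (sym β²≈α) (trans (-‿homo _) (-‿cong (*-homo b b)))))) ⟩
    ι a * ι a + β * β * - (ι b * ι b)        ≈⟨ +-congˡ (trans (sym (-‿distribʳ-* _ _)) (-‿cong
      (solve 2 (λ t b → (t :* t) :* (b :* b) := (t :* b) :* (t :* b)) refl β (ι b)))) ⟩
    ι a * ι a - (β * ι b) * (β * ι b)        ≈⟨ [y+t][y-t] (ι a) (β * ι b) ⟨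
    (ι a + β * ι b) * (ι a - β * ι b)        ≈⟨ *-cong e₁ (trans e₂ (+-congˡ (sym (-‿distribˡ-* β (ι b))))) ⟨
    x * y                                    ∎)
    where open Products K using ([y+t][y-t])

  ^d≈1⇒≈1 : ∀ n → n F.^ d F.≈ F.1# → n F.≈ F.1#
  ^d≈1⇒≈1 n = coprime-orders F F-field (2 ℕ.* (2 ℕ.* C)) h d∣1+q n (fermat F F-field q F-card n)

  -- As gcd(d, q - 1) = 1, the only d-th root of unity in F is 1. This keeps the roots of the
  -- quadratic factors of (i) outside F.
  ^d≈1⇒∉F : ∀ g → g ^ d ≈ 1# → ¬ (g ≈ 1#) → ∀ x → ¬ (ι x ≈ g)
  ^d≈1⇒∉F g g^d≈1 g≉1 x ιx≈g = g≉1 (trans (sym ιx≈g) (trans (⟦⟧-cong (^d≈1⇒≈1 x x^d≈1)) 1#-homo))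
    where
    x^d≈1 : x F.^ d F.≈ F.1#
    x^d≈1 = ι-injective (trans (^-homo x d) (trans (^-congˡ d ιx≈g) (trans g^d≈1 (sym 1#-homo))))

  -- The norm of g is a d-th root of unity in F, hence 1.
  inverse-conjugate : ∀ g ḡ → g ^ d ≈ 1# → g * ḡ ≈ 1# → Conjugate g ḡ
  inverse-conjugate g ḡ g^d≈1 gḡ≈1 = a , b , g≈ , ḡ≈ĝ
    where
    coords = coordinates g
    a = proj₁ coords
    b = proj₁ (proj₂ coords)
    g≈ = proj₂ (proj₂ coords)
    ĝ = ι a + - β * ι b
    g~ĝ : Conjugate g ĝ
    g~ĝ = a , b , g≈ , refl
    n = proj₁ (norm∈F g~ĝ)
    ιn≈ = proj₂ (norm∈F g~ĝ)
    -- Conjugate both sides of g^d = 1; the only conjugate of 1 is 1.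
    ĝ^d≈1 : ĝ ^ d ≈ 1#
    ĝ^d≈1 = conjugate-unique (conjugate-cong g^d≈1 (conjugate-^ g~ĝ d)) conjugate-1
    n^d≈1 : n F.^ d F.≈ F.1#
    n^d≈1 = ι-injective (begin
      ι (n F.^ d)       ≈⟨ ^-homo n d ⟩
      ι n ^ d           ≈⟨ ^-congˡ d ιn≈ ⟩
      (g * ĝ) ^ d       ≈⟨ ^-distrib-* g ĝ d ⟩
      g ^ d * ĝ ^ d     ≈⟨ trans (*-cong g^d≈1 ĝ^d≈1) (*-identityˡ 1#) ⟩
      1#                ≈⟨ 1#-homo ⟨
      ι F.1#            ∎)
    gĝ≈1 : g * ĝ ≈ 1#
    gĝ≈1 = trans (sym ιn≈) (trans (⟦⟧-cong (^d≈1⇒≈1 n n^d≈1)) 1#-homo)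
    ḡ≈ĝ : ḡ ≈ ĝ
    ḡ≈ĝ = begin
      ḡ              ≈⟨ *-identityʳ ḡ ⟨
      ḡ * 1#         ≈⟨ *-congˡ gĝ≈1 ⟨
      ḡ * (g * ĝ)    ≈⟨ *-assoc _ _ _ ⟨
      ḡ * g * ĝ      ≈⟨ *-congʳ (trans (*-comm ḡ g) gḡ≈1) ⟩
      1# * ĝ         ≈⟨ *-identityˡ ĝ ⟩
      ĝ              ∎

  ^d≈1⇒^[1+q]≈1 : ∀ g → g ^ d ≈ 1# → g ^ suc q ≈ 1#
  ^d≈1⇒^[1+q]≈1 g g^d≈1 = case d∣1+q of λ { (divides m 1+q≡md) → begin
    g ^ suc q          ≈⟨ ^-congʳ g (≡.trans 1+q≡md (ℕₚ.*-comm m d)) ⟩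
    g ^ (d ℕ.* m)      ≈⟨ ^-assocʳ g d m ⟨
    (g ^ d) ^ m        ≈⟨ trans (^-congˡ m g^d≈1) (1^n≈1 m) ⟩
    1#                 ∎ }

  √-1∈F : ∃ λ i → i F.* i F.≈ F.- F.1#
  √-1∈F = α F.^ C , F.trans (F.sym (F.^-homo-* α C C))
    (F.trans (F.sym (F.^-2* α C)) α^2C≈-1)

  √-1∈K : ∃ λ i → i * i ≈ - 1#
  √-1∈K = let i , ii≈-1 = √-1∈F in
    ι i , trans (sym (*-homo i i)) (trans (⟦⟧-cong ii≈-1) (trans (-‿homo F.1#) (-‿cong 1#-homo)))

  -- The ground floor of the tower is K itself: 1 and ω are independent over F because ω is outside
  -- F.
  generator : ∀ u v ω → (∀ x → ¬ (ι x ≈ ω)) → ω * ω + ι u * ω + ι v ≈ 0# → Generator F u v 1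
  generator u v ω ω∉F ω-root = record
    { L = K ; φ = ι ; φ-hom = ι-hom ; ρ = ω ; isField = K-field ; discrete = K-discrete
    ; indep = indep
    ; root = trans (+-congʳ (+-cong (*-cong (*-identityʳ ω) (*-identityʳ ω)) (*-congˡ (*-identityʳ ω)))) ω-root }
    where
    open Polynomials F
    open Evaluation F K ι ι-hom ω
    indep : Independent F K ι ι-hom ω 2
    indep p p< ev≈0 = mk λ
      { zero          → proj₁ coeffs≈0
      ; (suc zero)    → proj₂ coeffs≈0
      ; (suc (suc n)) → p< (suc (suc n)) (s≤s (s≤s z≤n)) }
      where
      a = coeff F p 0
      b = coeff F p 1
      p≐ : p ≐ (a ∷ b ∷ [])
      p≐ = mk λ { zero → F.refl ; (suc zero) → F.refl ; (suc (suc n)) → p< (suc (suc n)) (s≤s (s≤s z≤n)) }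
      coeffs≈0 : (a F.≈ F.0#) × (b F.≈ F.0#)
      coeffs≈0 = linear-independence ω ω∉F a b (begin
        ι a + ω * ι b               ≈⟨ +-congˡ (*-congˡ (ev-cst b)) ⟨
        ev (a ∷ b ∷ [])             ≈⟨ ev-cong {p} p≐ ⟨
        ev p                        ≈⟨ ev≈0 ⟩
        0#                          ∎)

  trinomial-over : ∀ {U V} u v m → 0 < m → ι u ≈ U → ι v ≈ V → Generator F u v m →
    MonicIrreducibleOver F K ι (trinomialOver K (2 ℕ.* m) m U V)
  trinomial-over u v m 0<m ιu≈U ιv≈V G =
    trinomial {F = F} {u} {v} m , (2 ℕ.* m , trinomial-monic {F = F} {u} {v} m 0<m) ,
    trinomial-irreducible {F = F} {u} {v} m 0<m F-field F-discrete G ,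
    at (≐-trans (M.+-homo (_+ₚ_ F (Xpow F (2 ℕ.* m)) (_·ₚ_ F u (Xpow F m))) (cst F v))
      (⊞-cong (≐-trans (M.+-homo (Xpow F (2 ℕ.* m)) (_·ₚ_ F u (Xpow F m)))
                (⊞-cong (mapₚ-Xpow (2 ℕ.* m)) (mapₚ-· u (Xpow F m) ιu≈U (mapₚ-Xpow m))))
              (∷-cong ιv≈V ≐-refl)))
    where
    open MapPolynomials F K ι ι-hom
    module M = HomProperties (Polynomials.polyRing F) (Polynomials.polyRing K) (mapₚ F K ι) mapₚ-isHom
    open Polynomials K

  private
    vieta-root : ∀ {u v} s t → u ≈ - (s + t) → v ≈ s * t → s * s + u * s + v ≈ 0#
    vieta-root {u} {v} s t u≈ v≈ = begin
      s * s + u * s + v                   ≈⟨ +-cong (+-congˡ (*-congʳ u≈)) v≈ ⟩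
      s * s + - (s + t) * s + s * t       ≈⟨ solve 3 (λ s t n → s :* s :+ n :* s :+ s :* t
        := (s :+ t :+ n) :* s) refl s t (- (s + t)) ⟩
      (s + t - (s + t)) * s               ≈⟨ trans (*-congʳ (-‿inverseʳ _)) (zeroˡ s) ⟩
      0#                                  ∎

    root-∉F : ∀ z g → ¬ (z F.≈ F.0#) → g ^ d ≈ 1# → ¬ (g ≈ 1#) → ∀ x → ¬ (ι x ≈ ι z * g)
    root-∉F z g z≉0 g^d≈1 g≉1 x ιx≈ = let z′ , zz′≈1 = proj₂ F-field z z≉0 in
      ^d≈1⇒∉F g g^d≈1 g≉1 (z′ F.* x) (begin
        ι (z′ F.* x)         ≈⟨ *-homo z′ x ⟩
        ι z′ * ι x           ≈⟨ *-congˡ ιx≈ ⟩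
        ι z′ * (ι z * g)     ≈⟨ *-assoc _ _ _ ⟨
        ι z′ * ι z * g       ≈⟨ *-congʳ (trans (*-comm _ _) (trans (sym (*-homo z z′)) (trans (⟦⟧-cong zz′≈1) 1#-homo))) ⟩
        1# * g               ≈⟨ *-identityˡ g ⟩
        g                    ∎)

  -- The criterion `irreducible` with F as its own extension, ρ = -z and n = 1: a constant that
  -- vanishes at ρ is zero.
  linear-factor : ∀ {V} z → ι z ≈ V → MonicIrreducibleOver F K ι (_+ₚ_ K (Xpow K 1) (cst K V))
  linear-factor {V} z ιz≈V = f , (1 , f-monic) ,
    irreducible F F (λ x → x) (isHom-id F) (F.- z) F-field F-discrete
      (field⇒noZeroDivisors F F-field F-discrete) 1 f (s≤s z≤n) indep f-monic f-root ,
    at (≐-trans (M.+-homo (Xpow F 1) (cst F z)) (⊞-cong (mapₚ-Xpow 1) (∷-cong ιz≈V (≐-refl {[]}))))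
    where
    open MapPolynomials F K ι ι-hom
    module PF = Polynomials F
    module M = HomProperties PF.polyRing (Polynomials.polyRing K) (mapₚ F K ι) mapₚ-isHom
    open Polynomials K
    open Evaluation F F (λ x → x) (isHom-id F) (F.- z)
    f : Poly F
    f = _+ₚ_ F (Xpow F 1) (cst F z)
    f-monic : PF.MonicOfDegree 1 f
    f-monic = F.refl , λ { (suc (suc n)) _ → F.refl ; (suc zero) (s≤s ()) }
    f-root : ev f F.≈ F.0#
    f-root = F.trans (ev-⊞ (Xpow F 1) (cst F z)) (F.trans (F.+-cong (F.trans (ev-Xpow 1) (F.*-identityʳ _)) (ev-cst z)) (F.-‿inverseˡ z))
    indep : Independent F F (λ x → x) (isHom-id F) (F.- z) 1
    indep p p< ev≈0 = PF.mk λ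
      { zero    → F.trans (F.sym (ev-cst _)) (F.trans (F.sym (ev-cong {p} {cst F (coeff F p 0)} p≐)) ev≈0)
      ; (suc n) → p< (suc n) (s≤s z≤n) }
      where
      p≐ : p PF.≐ cst F (coeff F p 0)
      p≐ = PF.mk λ { zero → F.refl ; (suc n) → p< (suc n) (s≤s z≤n) }

  -- With g = a + bβ and ḡ = a - bβ one has g + ḡ = 2a, so the coefficients lie in F. The roots are
  -- zg and zḡ, and zg is outside F because g is.
  δ-factor : ∀ {U V} z g ḡ → ¬ (z F.≈ F.0#) → g ^ d ≈ 1# → ¬ (g ≈ 1#) → g * ḡ ≈ 1# →
    U ≈ - (ι z * (g + ḡ)) → V ≈ ι z * ι z → MonicIrreducibleOver F K ι (trinomialOver K 2 1 U V)
  δ-factor {U} {V} z g ḡ z≉0 g^d≈1 g≉1 gḡ≈1 U≈ V≈ =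
    trinomial-over u v 1 (s≤s z≤n) ιu≈U ιv≈V
      (generator u v (ι z * g) (root-∉F z g z≉0 g^d≈1 g≉1)
        (vieta-root (ι z * g) (ι z * ḡ)
          (trans ιu≈U (trans U≈ (-‿cong (distribˡ (ι z) g ḡ))))
          (trans ιv≈V (trans V≈ (sym (trans (*-interchange (ι z) g (ι z) ḡ) (trans (*-congˡ gḡ≈1) (*-identityʳ _))))))))
    where
    conj = inverse-conjugate g ḡ g^d≈1 gḡ≈1
    a = proj₁ conj
    b = proj₁ (proj₂ conj)
    u = F.- (z F.* (a F.+ a))
    v = z F.* z
    g+ḡ≈ : g + ḡ ≈ ι (a F.+ a)
    g+ḡ≈ = begin
      g + ḡ                                   ≈⟨ +-cong (proj₁ (proj₂ (proj₂ conj))) (proj₂ (proj₂ (proj₂ conj))) ⟩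
      (ι a + β * ι b) + (ι a + - β * ι b)     ≈⟨ solve 4 (λ a b t n → (a :+ t :* b) :+ (a :+ n :* b)
        := (a :+ a) :+ (t :+ n) :* b) refl (ι a) (ι b) β (- β) ⟩
      (ι a + ι a) + (β - β) * ι b             ≈⟨ +-cong (sym (+-homo a a)) (trans (*-congʳ (-‿inverseʳ β)) (zeroˡ _)) ⟩
      ι (a F.+ a) + 0#                        ≈⟨ +-identityʳ _ ⟩
      ι (a F.+ a)                             ∎
    ιu≈U : ι u ≈ U
    ιu≈U = trans (-‿homo _) (trans (-‿cong (trans (*-homo z _) (*-congˡ (sym g+ḡ≈)))) (sym U≈))
    ιv≈V : ι v ≈ V
    ιv≈V = trans (*-homo z z) (sym V≈)

  -- Here g - ḡ = 2bβ, and the factor w = xβ turns it into 2αbx, an element of F. The roots of Y² +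
  -- UY + V are wḡ and -wg; the former is taken as `ω`, and n quadratic steps adjoin a 2ⁿ-th root of
  -- it.
  θ-factor : ∀ {U V} n x g ḡ → ¬ (x F.≈ F.0#) → g ^ d ≈ 1# → g * ḡ ≈ 1# →
    U ≈ ι x * β * (g - ḡ) → V ≈ - (ι x * β * (ι x * β)) →
    MonicIrreducibleOver F K ι (trinomialOver K (2 ℕ.^ suc n) (2 ℕ.^ n) U V)
  θ-factor {U} {V} n x g ḡ x≉0 g^d≈1 gḡ≈1 U≈ V≈ =
    trinomial-over u v (2 ℕ.^ n) (ℕₚ.m^n>0 2 n) ιu≈U ιv≈V
      (proj₁ (tower (generator u v ω (^M≈-1⇒∉F ω ω^≈-1) ω-root) (√-1∈K , ^M≈-1⇒nonSquare ω ω^≈-1) n))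
    where
    conj = inverse-conjugate g ḡ g^d≈1 gḡ≈1
    a = proj₁ conj
    b = proj₁ (proj₂ conj)
    w = ι x * β
    u = x F.* (α F.* (b F.+ b))
    v = F.- (x F.* x F.* α)
    ω = ι x * (β * ḡ)
    ḡ^≈1 : ḡ ^ suc q ≈ 1#
    ḡ^≈1 = begin
      ḡ ^ suc q                ≈⟨ *-identityˡ _ ⟨
      1# * ḡ ^ suc q           ≈⟨ *-congʳ (^d≈1⇒^[1+q]≈1 g g^d≈1) ⟨
      g ^ suc q * ḡ ^ suc q    ≈⟨ ^-distrib-* g ḡ (suc q) ⟨
      (g * ḡ) ^ suc q          ≈⟨ trans (^-congˡ (suc q) gḡ≈1) (1^n≈1 (suc q)) ⟩
      1#                       ∎
    ω^≈-1 : ω ^ M ≈ - 1#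
    ω^≈-1 = ω^M≈-1 x ḡ x≉0 ḡ^≈1
    g-ḡ≈ : g - ḡ ≈ β * ι (b F.+ b)
    g-ḡ≈ = begin
      g - ḡ                                   ≈⟨ +-cong (proj₁ (proj₂ (proj₂ conj)))
        (-‿cong (trans (proj₂ (proj₂ (proj₂ conj))) (+-congˡ (sym (-‿distribˡ-* β (ι b)))))) ⟩
      (ι a + β * ι b) - (ι a - β * ι b)       ≈⟨ +-congˡ (trans (sym (-‿+-comm _ _)) (+-congˡ (-‿involutive _))) ⟩
      (ι a + β * ι b) + (- ι a + β * ι b)     ≈⟨ solve 4 (λ a b t n → (a :+ t :* b) :+ (n :+ t :* b)
        := (a :+ n) :+ t :* (b :+ b)) refl (ι a) (ι b) β (- ι a) ⟩
      (ι a - ι a) + β * (ι b + ι b)           ≈⟨ +-cong (-‿inverseʳ _) (*-congˡ (sym (+-homo b b))) ⟩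
      0# + β * ι (b F.+ b)                    ≈⟨ +-identityˡ _ ⟩
      β * ι (b F.+ b)                         ∎
    ιu≈U : ι u ≈ U
    ιu≈U = begin
      ι u                                     ≈⟨ trans (*-homo x _) (*-congˡ (*-homo α _)) ⟩
      ι x * (ι α * ι (b F.+ b))               ≈⟨ *-congˡ (*-congʳ β²≈α) ⟨
      ι x * (β * β * ι (b F.+ b))             ≈⟨ solve 3 (λ x t b → x :* (t :* t :* b) := x :* t :* (t :* b)) refl (ι x) β _ ⟩
      ι x * β * (β * ι (b F.+ b))             ≈⟨ *-congˡ g-ḡ≈ ⟨
      ι x * β * (g - ḡ)                       ≈⟨ U≈ ⟨
      U                                       ∎
    ιv≈V : ι v ≈ V
    ιv≈V = begin
      ι v                                     ≈⟨ trans (-‿homo _) (-‿cong (trans (*-homo _ α) (*-cong (*-homo x x) (sym β²≈α)))) ⟩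
      - (ι x * ι x * (β * β))                 ≈⟨ -‿cong (*-interchange (ι x) (ι x) β β) ⟩
      - (w * w)                               ≈⟨ V≈ ⟨
      V                                       ∎
    ω-root : ω * ω + ι u * ω + ι v ≈ 0#
    ω-root = vieta-root ω (- (w * g))
      (begin
        ι u                        ≈⟨ trans ιu≈U U≈ ⟩
        w * (g - ḡ)                ≈⟨ trans (distribˡ w g (- ḡ)) (+-congˡ (sym (-‿distribʳ-* w ḡ))) ⟩
        w * g - w * ḡ              ≈⟨ +-comm _ _ ⟩
        - (w * ḡ) + w * g          ≈⟨ +-cong (-‿cong (*-assoc (ι x) β ḡ)) (sym (-‿involutive _)) ⟩
        - ω + - - (w * g)          ≈⟨ -‿+-comm _ _ ⟩
        - (ω + - (w * g))          ∎)
      (begin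
        ι v                        ≈⟨ trans ιv≈V V≈ ⟩
        - (w * w)                  ≈⟨ -‿cong (*-identityʳ _) ⟨
        - (w * w * 1#)             ≈⟨ -‿cong (*-congˡ (trans (*-comm ḡ g) gḡ≈1)) ⟨
        - (w * w * (ḡ * g))        ≈⟨ -‿cong (*-interchange w w ḡ g) ⟩
        - ((w * ḡ) * (w * g))      ≈⟨ -‿distribʳ-* _ _ ⟩
        w * ḡ * - (w * g)          ≈⟨ *-congʳ (*-assoc (ι x) β ḡ) ⟩
        ω * - (w * g)              ∎)

  -- With g = ḡ = 1 in `θ-factor` the middle coefficient is zero; it then only has to be erased from
  -- the polynomial.
  binomial-factor : ∀ {V} n x → ¬ (x F.≈ F.0#) → V ≈ - (ι x * β * (ι x * β)) →
    MonicIrreducibleOver F K ι (_+ₚ_ K (Xpow K (2 ℕ.^ suc n)) (cst K V))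
  binomial-factor {V} n x x≉0 V≈ =
    let f , monic , irred , e = θ-factor {0#} n x 1# 1# x≉0 (1^n≈1 d) (*-identityˡ 1#)
          (sym (trans (*-congˡ (-‿inverseʳ 1#)) (zeroʳ _))) V≈
    in f , monic , irred , at (≐-trans {mapₚ F K ι f} (mk e)
      (⊞-cong (≐-trans (⊞-cong (≐-refl {Xpow K (2 ℕ.^ suc n)}) (0·p≐[] (Xpow K (2 ℕ.^ n)))) (⊞-identityʳ _)) (≐-refl {cst K V})))
    where open Polynomials K

-- The two factorisations

All-concatMap-oneTo : {a p : Level} {A : Set a} {P : A → Set p} (f : ℕ → List A) → ∀ n →
  (∀ i → i < n → All P (f (suc i))) → All P (concatMap f (oneTo n))
All-concatMap-oneTo f n Pf = Allₚ.concat⁺ (Allₚ.map⁺ (Allₚ.map⁺ (Allₚ.applyUpTo⁺₁ (λ i → i) n (Pf _))))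

length-concatMap-oneTo : {a : Level} {A : Set a} (f : ℕ → List A) (m n : ℕ) →
  (∀ i → length (f i) ≡ m) → length (concatMap f (oneTo n)) ≡ n ℕ.* m
length-concatMap-oneTo f m n eq = go n (λ i → i)
  where
  go : ∀ n (g : ℕ → ℕ) → length (concatMap f (map suc (applyUpTo g n))) ≡ n ℕ.* m
  go zero    g = ≡.refl
  go (suc n) g = ≡.trans (Listₚ.length-++ (f (suc (g 0)))) (≡.cong₂ ℕ._+_ (eq _) (go n (g ∘ suc)))

-- Two powers of α equal to -1 are carried along: exponent 2^(s-1) drives the products over i,
-- exponent 2C = (q - 1)/2 makes the roots in (ii) nonsquares.
module Factorisation {c ℓ : Level} (F K : CommutativeRing c ℓ) (C h s′ : ℕ)
  (F-field : IsField F) (F-card : HasCard F (suc (2 ℕ.* (2 ℕ.* C))))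
  (K-field : IsField K) (K-card : HasCard K (suc (2 ℕ.* (2 ℕ.* C)) ℕ.* suc (2 ℕ.* (2 ℕ.* C))))
  (ι : CommutativeRing.Carrier F → CommutativeRing.Carrier K) (ι-hom : IsHom F K ι)
  (α : CommutativeRing.Carrier F)
  (α^2^[s-1]≈-1 : CommutativeRing._≈_ F (pow F α (2 ℕ.^ suc s′)) (CommutativeRing.-_ F (CommutativeRing.1# F)))
  (α^2C≈-1 : CommutativeRing._≈_ F (pow F α (2 ℕ.* C)) (CommutativeRing.-_ F (CommutativeRing.1# F)))
  (-1≉1 : ¬ (CommutativeRing._≈_ F (CommutativeRing.-_ F (CommutativeRing.1# F)) (CommutativeRing.1# F)))
  (β : CommutativeRing.Carrier K)
  (β²≈α : CommutativeRing._≈_ K (CommutativeRing._*_ K β β) (ι α))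
  (d∣1+q : suc (h ℕ.+ h) ∣ suc (suc (2 ℕ.* (2 ℕ.* C))))
  (γ : CommutativeRing.Carrier K) (γ-primitive : IsPrimitiveRoot K (suc (h ℕ.+ h)) γ) where

  private
    module F where
      open CommutativeRing F public
      open RingProperties ring public using (-‿involutive; -0#≈0#)
      open Exp commutativeSemiring public using (_^_)
  open CommutativeRing K
  open RingProperties ring using (-‿distribˡ-*; -1*x≈-x; -‿involutive)
  open Exp commutativeSemiring using (_^_; ^-congˡ; ^-congʳ; ^-homo-*; ^-assocʳ; ^-distrib-*)
  open HomProperties F K ι ι-hom
  open CommutativeRingProperties K
  open FieldExtension F K C h F-field F-card K-field K-card ι ι-hom α α^2C≈-1 -1≉1 β β²≈α d∣1+q
  open Polynomials K
  private module P = CommutativeRing polyRing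

  s : ℕ
  s = suc (suc s′)

  open Factors K q d s (ι α) β γ renaming (α to αₖ)

  private
    γ̄ : Carrier
    γ̄ = γ ^ q

    γγ̄≈1 : γ * γ̄ ≈ 1#
    γγ̄≈1 = ^d≈1⇒^[1+q]≈1 γ (proj₁ γ-primitive)

  open CyclicProduct K (proj₁ K-field) K-noZeroDiv h γ γ̄ γ-primitive γγ̄≈1
    using (γ^jγ̄^j≈1; trinomialAt; cyclic-δ; cyclic-θ-±)
  open Products polyRing
  open MapPolynomials F K ι ι-hom using (mapₚ-compose)

  private
    half : ⌊ h ℕ.+ h /2⌋ ≡ h
    half = ≡.sym (ℕₚ.n≡⌊n+n/2⌋ h)

    odd-suc : ∀ i → odd (suc i) ≡ suc (2 ℕ.* i)
    odd-suc i = ℕₚ.+-suc i (i ℕ.+ 0)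

    γ̄^j≈γ^qj : ∀ j → γ̄ ^ j ≈ γ ^ (q ℕ.* j)
    γ̄^j≈γ^qj j = ^-assocʳ γ q j

    [γ^j]^d≈1 : ∀ j → (γ ^ j) ^ d ≈ 1#
    [γ^j]^d≈1 j = trans (^-assocʳ γ j d) (trans (^-congʳ γ (ℕₚ.*-comm j d))
      (trans (sym (^-assocʳ γ d j)) (trans (^-congˡ j (proj₁ γ-primitive)) (1^n≈1 j))))

    γ^j≉1 : ∀ j → j < h → ¬ (γ ^ suc j ≈ 1#)
    γ^j≉1 j j<h = proj₂ γ-primitive (suc j) (s≤s z≤n) (s≤s (ℕₚ.≤-trans j<h (ℕₚ.m≤m+n h h)))

    F-noZeroDiv : NoZeroDivisors F
    F-noZeroDiv = field⇒noZeroDivisors F F-field F-discrete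

    *≉0 : ∀ {x y} → ¬ (x F.≈ F.0#) → ¬ (y F.≈ F.0#) → ¬ (x F.* y F.≈ F.0#)
    *≉0 x≉0 y≉0 e with F-noZeroDiv _ _ e
    ... | inj₁ x≈0 = x≉0 x≈0
    ... | inj₂ y≈0 = y≉0 y≈0

    ^≉0 : ∀ {x} → ¬ (x F.≈ F.0#) → ∀ n → ¬ (x F.^ n F.≈ F.0#)
    ^≉0 x≉0 zero    = proj₁ F-field
    ^≉0 x≉0 (suc n) = *≉0 x≉0 (^≉0 x≉0 n)

    neg≉0 : ∀ {x} → ¬ (x F.≈ F.0#) → ¬ (F.- x F.≈ F.0#)
    neg≉0 x≉0 e = x≉0 (F.trans (F.sym (F.-‿involutive _)) (F.trans (F.-‿cong e) F.-0#≈0#))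

    α≉0 : ¬ (α F.≈ F.0#)
    α≉0 α≈0 = go (2 ℕ.* C) α^2C≈-1
      where
      go : ∀ n → ¬ (α F.^ n F.≈ F.- F.1#)
      go zero    e = -1≉1 (F.sym e)
      go (suc n) e = neg≉0 (proj₁ F-field) (F.trans (F.sym e) (F.trans (F.*-congʳ α≈0) (F.zeroˡ _)))

    ι≉0 : ∀ {x} → ¬ (x F.≈ F.0#) → ¬ (ι x ≈ 0#)
    ι≉0 x≉0 e = x≉0 (ι≈0⇒≈0 e)

    ια^2^[s-1]≈-1 : ι α ^ (2 ℕ.^ suc s′) ≈ - 1#
    ια^2^[s-1]≈-1 = trans (sym (^-homo α (2 ℕ.^ suc s′))) (trans (⟦⟧-cong α^2^[s-1]≈-1) (trans (-‿homo F.1#) (-‿cong 1#-homo)))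

    -- Bridge from the coefficient lists of `Factors` to ring expressions in y = xᵐ, for which the
    -- cyclic products are computed.
    trinomialOver≐ : ∀ m {u u′ v v′} → u ≈ u′ → v ≈ v′ →
      trinomialOver K (2 ℕ.* m) m u v ≐ trinomialAt polyRing (cst K) cst-isHom (Xpow K m) u′ v′
    trinomialOver≐ m {u} {u′} {v} {v′} u≈ v≈ = ⊞-cong (⊞-cong (Xpow-2* m)
        (≐-trans (·-cong u≈ (≐-refl {Xpow K m})) (≐-sym (cst-⊠ u′ (Xpow K m))))) (∷-cong v≈ (≐-refl {[]}))
      where
      Xpow-2* : ∀ m → Xpow K (2 ℕ.* m) ≐ Xpow K m ⊠ Xpow K m
      Xpow-2* m = ≐-trans (Xpow≐X^ (2 ℕ.* m)) (≐-trans (Xᴱ.^-congʳ X (≡.cong (m ℕ.+_) (ℕₚ.+-identityʳ m)))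
        (≐-trans (Xᴱ.^-homo-* X m m) (≐-sym (⊠-cong (Xpow≐X^ m) (Xpow≐X^ m)))))
        where module Xᴱ = Exp P.commutativeSemiring

    foldr-2 : ∀ {p q p′ q′} → p ≐ p′ → q ≐ q′ → p ⊠ (q ⊠ cst K 1#) ≐ p′ ⊠ q′
    foldr-2 {p} {q} e e′ = ⊠-cong e (≐-trans (P.*-identityʳ q) e′)

    foldr-4 : ∀ {p q r t p′ q′ r′ t′} → p ≐ p′ → q ≐ q′ → r ≐ r′ → t ≐ t′ →
      p ⊠ (q ⊠ (r ⊠ (t ⊠ cst K 1#))) ≐ (p′ ⊠ q′) ⊠ (r′ ⊠ t′)
    foldr-4 {p} {q} {r} {t} {p′} {q′} {r′} {t′} e₁ e₂ e₃ e₄ =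
      ≐-trans (⊠-cong e₁ (⊠-cong e₂ (foldr-2 e₃ e₄))) (≐-sym (⊠-assoc p′ q′ (r′ ⊠ t′)))

    ∏<-half : ∀ f → ∏< ⌊ h ℕ.+ h /2⌋ f ≐ ∏< h f
    ∏<-half f = P.reflexive (≡.cong (λ n → ∏< n f) half)

    module _ (a : Carrier) where
      -- A block collapses to Y - w^(2d) with w an odd power a^(2i+1); this is Y - η^(2i+1), the
      -- shape of the factors in `∏-odd-powers`.
      η : Carrier
      η = a ^ d * a ^ d

      -η^ : ∀ i w → w ≈ a ^ suc (2 ℕ.* i) → cst K (- (w ^ d * w ^ d)) ≐ P.- pow polyRing (cst K η) (suc (2 ℕ.* i))
      -η^ i w w≈ = ≐-trans (∷-cong (-‿cong w^d*w^d≈) (≐-refl {[]}))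
          (≐-trans (C.-‿homo (η ^ o)) (⊟-cong (C.^-homo η o)))
        where
        open SetoidReasoning setoid
        module C = HomProperties K polyRing (cst K) cst-isHom
        o = suc (2 ℕ.* i)
        swap : (a ^ o) ^ d ≈ (a ^ d) ^ o
        swap = trans (^-assocʳ a o d) (trans (^-congʳ a (ℕₚ.*-comm o d)) (sym (^-assocʳ a d o)))
        w^d*w^d≈ : w ^ d * w ^ d ≈ η ^ o
        w^d*w^d≈ = begin
          w ^ d * w ^ d                ≈⟨ *-cong (^-congˡ d w≈) (^-congˡ d w≈) ⟩
          (a ^ o) ^ d * (a ^ o) ^ d    ≈⟨ *-cong swap swap ⟩
          (a ^ d) ^ o * (a ^ d) ^ o    ≈⟨ ^-distrib-* (a ^ d) (a ^ d) o ⟨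
          η ^ o                        ∎

      -- The product formula applies since η^(2ⁿ) = (a^(2ⁿ⁺¹))^d = (-1)^d = -1 for odd d.
      ∏-η : ∀ n → a ^ (2 ℕ.* 2 ℕ.^ n) ≈ - 1# → ∀ Y →
        ∏< (2 ℕ.^ n) (λ i → Y ⊞ P.- pow polyRing (cst K η) (suc (2 ℕ.* i))) ≐ pow polyRing Y (2 ℕ.^ n) ⊞ cst K 1#
      ∏-η n a^≈-1 Y = ∏-odd-powers n (cst K η) Y
          (≐-trans (≐-sym (C.^-homo η (2 ℕ.^ n))) (≐-trans (∷-cong η^≈-1 (≐-refl {[]})) (C.-‿homo 1#)))
        where
        open SetoidReasoning setoid
        module C = HomProperties K polyRing (cst K) cst-isHom
        N = 2 ℕ.^ n
        η^≈-1 : η ^ N ≈ - 1#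
        η^≈-1 = begin
          (a ^ d * a ^ d) ^ N           ≈⟨ ^-congˡ N (^-distrib-* a a d) ⟨
          ((a * a) ^ d) ^ N             ≈⟨ ^-assocʳ (a * a) d N ⟩
          (a * a) ^ (d ℕ.* N)           ≈⟨ ^-congʳ (a * a) (ℕₚ.*-comm d N) ⟩
          (a * a) ^ (N ℕ.* d)           ≈⟨ ^-assocʳ (a * a) N d ⟨
          ((a * a) ^ N) ^ d             ≈⟨ ^-congˡ d (^-congˡ N (*-congˡ (*-identityʳ a))) ⟨
          ((a ^ 2) ^ N) ^ d             ≈⟨ ^-congˡ d (^-assocʳ a 2 N) ⟩
          (a ^ (2 ℕ.* N)) ^ d           ≈⟨ ^-congˡ d a^≈-1 ⟩
          (- 1#) ^ d                    ≈⟨ -1^odd≈-1 h ⟩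
          - 1#                          ∎

  module PartI (k′ : ℕ) (k≤s : suc (suc k′) ≤ s) where
    k : ℕ
    k = suc (suc k′)

    private
      a : F.Carrier
      a = α F.^ (2 ℕ.^ (s ℕ.∸ k))

      ζ : ℕ → F.Carrier
      ζ i = a F.^ odd i

      αₖ≈ : ∀ i → αₖ k ^ odd i ≈ ι (ζ i)
      αₖ≈ i = sym (trans (^-homo a (odd i)) (^-congˡ (odd i) (^-homo α (2 ℕ.^ (s ℕ.∸ k)))))

      ζ≉0 : ∀ i → ¬ (ζ i F.≈ F.0#)
      ζ≉0 i = ^≉0 (^≉0 α≉0 (2 ℕ.^ (s ℕ.∸ k))) (odd i)

      w : ℕ → Carrier
      w i = αₖ k ^ odd i

      αₖ₋₁≈ : ∀ i → αₖ (suc k′) ^ odd i ≈ w i * w i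
      αₖ₋₁≈ i = trans (^-congˡ (odd i) (begin
          ι α ^ (2 ℕ.^ (s ℕ.∸ suc k′))                    ≈⟨ ^-congʳ (ι α) (≡.cong (2 ℕ.^_) (ℕₚ.+-∸-assoc 1 k≤s)) ⟩
          ι α ^ (2 ℕ.* 2 ℕ.^ (s ℕ.∸ k))                   ≈⟨ ^-congʳ (ι α) (ℕₚ.*-comm 2 (2 ℕ.^ (s ℕ.∸ k))) ⟩
          ι α ^ (2 ℕ.^ (s ℕ.∸ k) ℕ.* 2)                   ≈⟨ ^-assocʳ (ι α) (2 ℕ.^ (s ℕ.∸ k)) 2 ⟨
          αₖ k * (αₖ k * 1#)                              ≈⟨ *-congˡ (*-identityʳ _) ⟩
          αₖ k * αₖ k                                     ∎))
        (^-distrib-* (αₖ k) (αₖ k) (odd i))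
        where open SetoidReasoning setoid

      -- The exponents of 2 add up to (s - k) + (k - 1) = s - 1.
      αₖ^≈-1 : αₖ k ^ (2 ℕ.* 2 ℕ.^ k′) ≈ - 1#
      αₖ^≈-1 = trans (^-assocʳ (ι α) (2 ℕ.^ (s ℕ.∸ k)) (2 ℕ.^ suc k′))
        (trans (^-congʳ (ι α) (≡.trans (≡.sym (ℕₚ.^-distribˡ-+-* 2 (s ℕ.∸ k) (suc k′)))
          (≡.cong (2 ℕ.^_) (≡.trans (ℕₚ.+-suc (s′ ℕ.∸ k′) k′) (≡.cong suc (ℕₚ.m∸n+n≡m (ℕ.s≤s⁻¹ (ℕ.s≤s⁻¹ k≤s)))))))) ια^2^[s-1]≈-1)

      δ≈ : ∀ j → γ ^ j + γ̄ ^ j ≈ δ j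
      δ≈ j = +-congˡ (γ̄^j≈γ^qj j)

      trinomials : ℕ → ℕ → List (Poly K)
      trinomials i j = pmTri K 2 1 (w i * δ j) (αₖ (suc k′) ^ odd i)

      block : ℕ → List (Poly K)
      block i = pmBin K 1 (w i) ++ concatMap (trinomials i) (oneTo ⌊ h ℕ.+ h /2⌋)

      Y : Poly K
      Y = pow polyRing X d ⊠ pow polyRing X d

      block-product : ∀ i → prodₚ K (block (suc i)) ≐ Y ⊞ P.- pow polyRing (cst K (η (αₖ k))) (suc (2 ℕ.* i))
      block-product i = begin
        prodₚ K (block (suc i))
          ≈⟨ foldr-++ (pmBin K 1 (w (suc i))) (concatMap (trinomials (suc i)) (oneTo ⌊ h ℕ.+ h /2⌋)) ⟩
        prodₚ K (pmBin K 1 (w (suc i))) ⊠ prodₚ K (concatMap (trinomials (suc i)) (oneTo ⌊ h ℕ.+ h /2⌋))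
          ≈⟨ ⊠-cong {prodₚ K (pmBin K 1 (w (suc i)))} {(X ⊞ cst K (w (suc i))) ⊠ (X ⊞ cst K (- w (suc i)))}
               (foldr-2 (≐-refl {X ⊞ cst K (w (suc i))}) (≐-refl {X ⊞ cst K (- w (suc i))}))
               (≐-trans (foldr-concatMap-oneTo ⌊ h ℕ.+ h /2⌋ (trinomials (suc i)))
               (≐-trans (∏<-half (λ j → prodₚ K (trinomials (suc i) (suc j))))
                 (∏<-cong h (λ j _ → foldr-2
                   (trinomialOver≐ 1 (*-congˡ (sym (δ≈ (suc j)))) (αₖ₋₁≈ (suc i)))
                   (trinomialOver≐ 1 (-‿cong (*-congˡ (sym (δ≈ (suc j))))) (αₖ₋₁≈ (suc i))))))) ⟩
        _ ≈⟨ cyclic-δ polyRing (cst K) cst-isHom X (w (suc i)) (λ e → ι≉0 (ζ≉0 (suc i)) (trans (sym (αₖ≈ (suc i))) e)) ⟩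
        Y ⊞ cst K (- (w (suc i) ^ d * w (suc i) ^ d))
          ≈⟨ ⊞-cong (≐-refl {Y}) (-η^ (αₖ k) i (w (suc i)) (^-congʳ (αₖ k) (odd-suc i))) ⟩
        Y ⊞ P.- pow polyRing (cst K (η (αₖ k))) (suc (2 ℕ.* i)) ∎
        where open SetoidReasoning P.setoid

    lengthI : length (factorsI k) ≡ 2 ℕ.^ k′ ℕ.* (d ℕ.+ 1)
    lengthI = length-concatMap-oneTo block (d ℕ.+ 1) (2 ℕ.^ k′) λ i →
      ≡.trans (≡.cong (2 ℕ.+_) (≡.trans (length-concatMap-oneTo (trinomials i) 2 ⌊ h ℕ.+ h /2⌋ (λ _ → ≡.refl)) (≡.cong (ℕ._* 2) half)))
        (solve 1 (λ h → con 2 :+ h :* con 2 := con 1 :+ (h :+ h) :+ con 1) ≡.refl h)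
      where open +-*-Solver

    productI : prodₚ K (factorsI k) ≐ mapₚ F K ι (compose F (cyclo2pow F k) (Xpow F d))
    productI = begin
      prodₚ K (factorsI k)                                     ≈⟨ foldr-concatMap-oneTo (2 ℕ.^ k′) block ⟩
      ∏< (2 ℕ.^ k′) (λ i → prodₚ K (block (suc i)))            ≈⟨ ∏<-cong (2 ℕ.^ k′) (λ i _ → block-product i) ⟩
      _                                                        ≈⟨ ∏-η (αₖ k) k′ αₖ^≈-1 Y ⟩
      pow polyRing Y (2 ℕ.^ k′) ⊞ cst K 1#                     ≈⟨ ⊞-cong Y^ (≐-refl {cst K 1#}) ⟩
      pow polyRing (Xpow K d) (2 ℕ.^ suc k′) ⊞ cst K 1#        ≈⟨ mapₚ-compose (2 ℕ.^ suc k′) d ⟨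
      _                                                        ∎
      where
      open SetoidReasoning P.setoid
      module Xᴱ = Exp P.commutativeSemiring
      x : Poly K
      x = pow polyRing X d
      Y^ : pow polyRing Y (2 ℕ.^ k′) ≐ pow polyRing (Xpow K d) (2 ℕ.^ suc k′)
      Y^ = ≐-trans (Xᴱ.^-congˡ (2 ℕ.^ k′) (⊠-cong (≐-refl {x}) (≐-sym (P.*-identityʳ x))))
        (≐-trans (Xᴱ.^-assocʳ x 2 (2 ℕ.^ k′)) (Xᴱ.^-congˡ (2 ℕ.^ suc k′) (≐-sym (Xpow≐X^ d))))

    irreducibleI : All (MonicIrreducibleOver F K ι) (factorsI k)
    irreducibleI = All-concatMap-oneTo block (2 ℕ.^ k′) λ i _ → Allₚ.++⁺
      (linear-factor (ζ (suc i)) (sym (αₖ≈ (suc i))) ∷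
       linear-factor (F.- ζ (suc i)) (trans (-‿homo _) (-‿cong (sym (αₖ≈ (suc i))))) ∷ [])
      (All-concatMap-oneTo (trinomials (suc i)) ⌊ h ℕ.+ h /2⌋ λ j j<h′ →
        let o = suc i
            j′ = suc j
            g≉1 = γ^j≉1 j (≡.subst (j <_) half j<h′)
        in
        -- `δ-factor` has linear coefficient -z(g + ḡ), so the trinomial with +ζδ is the one for z =
        -- -ζ.
        δ-factor (F.- ζ o) (γ ^ j′) (γ̄ ^ j′) (neg≉0 (ζ≉0 o)) ([γ^j]^d≈1 j′) g≉1 (γ^jγ̄^j≈1 j′)
          (trans (*-cong (αₖ≈ o) (sym (δ≈ j′))) (sym (trans (-‿cong (*-congʳ (-‿homo (ζ o))))
            (trans (-‿distribˡ-* _ _) (*-congʳ (-‿involutive _))))))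
          (trans (αₖ₋₁≈ o) (trans (*-cong (αₖ≈ o) (αₖ≈ o)) (sym (trans (*-cong (-‿homo (ζ o)) (-‿homo (ζ o))) (-x*-y≈xy _ _))))) ∷
        δ-factor (ζ o) (γ ^ j′) (γ̄ ^ j′) (ζ≉0 o) ([γ^j]^d≈1 j′) g≉1 (γ^jγ̄^j≈1 j′)
          (-‿cong (*-cong (αₖ≈ o) (sym (δ≈ j′))))
          (trans (αₖ₋₁≈ o) (*-cong (αₖ≈ o) (αₖ≈ o))) ∷ [])

  module PartII (r′ : ℕ) where
    r : ℕ
    r = suc r′

    private
      -- The paper's α₄.
      i₄ : F.Carrier
      i₄ = α F.^ (2 ℕ.^ s′)

      α₂≈i₄ : αₖ 2 ≈ ι i₄
      α₂≈i₄ = sym (^-homo α (2 ℕ.^ s′))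

      i₄²≈-1 : αₖ 2 * αₖ 2 ≈ - 1#
      i₄²≈-1 = trans (sym (^-homo-* (ι α) (2 ℕ.^ s′) (2 ℕ.^ s′)))
        (trans (sym (^-2* (ι α) (2 ℕ.^ s′))) ια^2^[s-1]≈-1)

      α₁≈-1 : αₖ 1 ≈ - 1#
      α₁≈-1 = ια^2^[s-1]≈-1

      αₛ≈ : αₖ s ≈ ι α
      αₛ≈ = trans (^-congʳ (ι α) (≡.cong (2 ℕ.^_) (ℕₚ.n∸n≡0 s′))) (*-identityʳ (ι α))

      w : ℕ → Carrier
      w i = β ^ odd i

      x : ℕ → F.Carrier
      x i = α F.^ i

      w≈ : ∀ i → w (suc i) ≈ ι (x i) * β
      w≈ i = begin
        β ^ odd (suc i)          ≈⟨ ^-congʳ β (odd-suc i) ⟩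
        β * β ^ (2 ℕ.* i)        ≈⟨ *-congˡ (^-assocʳ β 2 i) ⟨
        β * (β ^ 2) ^ i          ≈⟨ *-congˡ (^-congˡ i (trans (*-congˡ (*-identityʳ β)) β²≈α)) ⟩
        β * ι α ^ i              ≈⟨ *-congˡ (^-homo α i) ⟨
        β * ι (x i)              ≈⟨ *-comm _ _ ⟩
        ι (x i) * β              ∎
        where open SetoidReasoning setoid

      αₛ^≈ : ∀ i → αₖ s ^ odd i ≈ w i * w i
      αₛ^≈ i = trans (^-congˡ (odd i) (trans αₛ≈ (sym β²≈α))) (^-distrib-* β β (odd i))

      i₄w≈ : ∀ i → αₖ 2 * w (suc i) ≈ ι (i₄ F.* x i) * β
      i₄w≈ i = trans (*-cong α₂≈i₄ (w≈ i)) (trans (sym (*-assoc _ _ _)) (*-congʳ (sym (*-homo i₄ (x i)))))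

      x≉0 : ∀ i → ¬ (x i F.≈ F.0#)
      x≉0 = ^≉0 α≉0

      i₄x≉0 : ∀ i → ¬ (i₄ F.* x i F.≈ F.0#)
      i₄x≉0 i = *≉0 (^≉0 α≉0 (2 ℕ.^ s′)) (x≉0 i)

      β≉0 : ¬ (β ≈ 0#)
      β≉0 β≈0 = β∉F F.0# (trans 0#-homo (sym β≈0))

      ιxβ≉0 : ∀ y → ¬ (y F.≈ F.0#) → ¬ (ι y * β ≈ 0#)
      ιxβ≉0 y y≉0 e with K-noZeroDiv _ _ e
      ... | inj₁ ιy≈0 = ι≉0 y≉0 ιy≈0
      ... | inj₂ β≈0  = β≉0 β≈0

      θ≈ : ∀ j → γ ^ j - γ̄ ^ j ≈ θ j
      θ≈ j = +-congˡ (-‿cong (γ̄^j≈γ^qj j))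

      coefficient : ℕ → ℕ → ℕ → Carrier
      coefficient i j l = (αₖ 2 ^ l * β ^ odd i) * θ j

      constant : ℕ → ℕ → Carrier
      constant i l = - (αₖ 1 ^ l * αₖ s ^ odd i)

      coefficient₀ : ∀ i j → coefficient i j 0 ≈ w i * (γ ^ j - γ̄ ^ j)
      coefficient₀ i j = *-cong (*-identityˡ _) (sym (θ≈ j))

      coefficient₁ : ∀ i j → coefficient i j 1 ≈ αₖ 2 * w i * (γ ^ j - γ̄ ^ j)
      coefficient₁ i j = *-cong (*-congʳ (*-identityʳ _)) (sym (θ≈ j))

      constant₀ : ∀ i → constant i 0 ≈ - (w i * w i)
      constant₀ i = -‿cong (trans (*-identityˡ _) (αₛ^≈ i))

      constant₁ : ∀ i → constant i 1 ≈ w i * w i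
      constant₁ i = trans (-‿cong (trans (*-cong (trans (*-identityʳ _) α₁≈-1) (αₛ^≈ i)) (-1*x≈-x _))) (-‿involutive _)

      [i₄w]²≈ : ∀ i → - (αₖ 2 * w i * (αₖ 2 * w i)) ≈ w i * w i
      [i₄w]²≈ i = trans (-‿cong (trans (*-interchange _ _ _ _) (trans (*-congʳ i₄²≈-1) (-1*x≈-x _)))) (-‿involutive _)

      m : ℕ
      m = 2 ℕ.^ r′

      trinomials : ℕ → ℕ → List (Poly K)
      trinomials i j = concatMap (λ l → pmTri K (2 ℕ.* m) m (coefficient i j l) (constant i l)) (0 ∷ 1 ∷ [])

      block : ℕ → List (Poly K)
      block i = pmBin K (2 ℕ.* m) (αₖ s ^ odd i) ++ concatMap (trinomials i) (oneTo ⌊ h ℕ.+ h /2⌋)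

      y z Y : Poly K
      y = Xpow K m
      z = pow polyRing y d
      Y = (z ⊠ z) ⊠ (z ⊠ z)

      -- A zero middle term is inserted and removed again, so that the conversion of trinomials
      -- applies.
      binomial≐ : ∀ {v v′} → v ≈ v′ → Xpow K (2 ℕ.* m) ⊞ cst K v ≐ y ⊠ y ⊞ cst K v′
      binomial≐ {v} {v′} v≈ = ≐-trans
        (⊞-cong (≐-sym (≐-trans (⊞-cong (≐-refl {Xpow K (2 ℕ.* m)}) (0·p≐[] y)) (⊞-identityʳ _))) (≐-refl {cst K v}))
        (≐-trans (trinomialOver≐ m (refl {0#}) v≈)
          (⊞-cong (≐-trans (⊞-cong (≐-refl {y ⊠ y}) (≐-trans (cst-⊠ 0# y) (0·p≐[] y))) (⊞-identityʳ _)) (≐-refl {cst K v′})))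

      block-product : ∀ i → prodₚ K (block (suc i)) ≐ Y ⊞ P.- pow polyRing (cst K (η (ι α))) (suc (2 ℕ.* i))
      block-product i = begin
        prodₚ K (block (suc i))
          ≈⟨ foldr-++ (pmBin K (2 ℕ.* m) (αₖ s ^ odd (suc i))) (concatMap (trinomials (suc i)) (oneTo ⌊ h ℕ.+ h /2⌋)) ⟩
        prodₚ K (pmBin K (2 ℕ.* m) (αₖ s ^ odd (suc i))) ⊠ prodₚ K (concatMap (trinomials (suc i)) (oneTo ⌊ h ℕ.+ h /2⌋))
          ≈⟨ ⊠-cong (foldr-2 (binomial≐ (αₛ^≈ (suc i))) (binomial≐ (-‿cong (αₛ^≈ (suc i)))))
               (≐-trans (foldr-concatMap-oneTo ⌊ h ℕ.+ h /2⌋ (trinomials (suc i)))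
               (≐-trans (∏<-half (λ j → prodₚ K (trinomials (suc i) (suc j))))
                 (∏<-cong h (λ j _ → foldr-4
                   (trinomialOver≐ m (coefficient₀ (suc i) (suc j)) (constant₀ (suc i)))
                   (trinomialOver≐ m (-‿cong (coefficient₀ (suc i) (suc j))) (constant₀ (suc i)))
                   (trinomialOver≐ m (coefficient₁ (suc i) (suc j)) (constant₁ (suc i)))
                   (trinomialOver≐ m (-‿cong (coefficient₁ (suc i) (suc j))) (constant₁ (suc i))))))) ⟩
        _ ≈⟨ cyclic-θ-± polyRing (cst K) cst-isHom y (αₖ 2) (w (suc i)) i₄²≈-1
               (λ e → ιxβ≉0 (x i) (x≉0 i) (trans (sym (w≈ i)) e))
               (λ e → ιxβ≉0 (i₄ F.* x i) (i₄x≉0 i) (trans (sym (i₄w≈ i)) e)) ⟩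
        Y ⊞ cst K (- ((w (suc i) ^ d * w (suc i) ^ d) * (w (suc i) ^ d * w (suc i) ^ d)))
          -- From β² = α one gets w² = α^(2i+1), so w^(4d) = (α^(2i+1))^(2d), and the base for η is
          -- α rather than β.
          ≈⟨ ⊞-cong (≐-refl {Y}) (≐-trans (∷-cong (-‿cong (*-cong (ww i) (ww i))) (≐-refl {[]}))
               (-η^ (ι α) i (αₖ s ^ odd (suc i)) (trans (^-congˡ (odd (suc i)) αₛ≈) (^-congʳ (ι α) (odd-suc i))))) ⟩
        Y ⊞ P.- pow polyRing (cst K (η (ι α))) (suc (2 ℕ.* i)) ∎
        where
        open SetoidReasoning P.setoid
        ww : ∀ i → w (suc i) ^ d * w (suc i) ^ d ≈ (αₖ s ^ odd (suc i)) ^ d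
        ww i = trans (sym (^-distrib-* (w (suc i)) (w (suc i)) d)) (^-congˡ d (sym (αₛ^≈ (suc i))))

    lengthII : length (factorsII r) ≡ 2 ℕ.^ suc s′ ℕ.* d
    lengthII = ≡.trans (length-concatMap-oneTo block (2 ℕ.+ h ℕ.* 4) (2 ℕ.^ s′) (λ i →
        ≡.cong (2 ℕ.+_) (≡.trans (length-concatMap-oneTo (trinomials i) 4 ⌊ h ℕ.+ h /2⌋ (λ _ → ≡.refl)) (≡.cong (ℕ._* 4) half))))
      (solve 2 (λ n h → n :* (con 2 :+ h :* con 4) := con 2 :* n :* (con 1 :+ (h :+ h))) ≡.refl (2 ℕ.^ s′) h)
      where open +-*-Solver

    productII : prodₚ K (factorsII r) ≐ mapₚ F K ι (compose F (cyclo2pow F (s ℕ.+ r)) (Xpow F d))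
    productII = begin
      prodₚ K (factorsII r)                                    ≈⟨ foldr-concatMap-oneTo (2 ℕ.^ s′) block ⟩
      ∏< (2 ℕ.^ s′) (λ i → prodₚ K (block (suc i)))            ≈⟨ ∏<-cong (2 ℕ.^ s′) (λ i _ → block-product i) ⟩
      _                                                        ≈⟨ ∏-η (ι α) s′ ια^2^[s-1]≈-1 Y ⟩
      pow polyRing Y (2 ℕ.^ s′) ⊞ cst K 1#                     ≈⟨ ⊞-cong Y^ (≐-refl {cst K 1#}) ⟩
      pow polyRing (Xpow K d) (2 ℕ.^ suc (s′ ℕ.+ r)) ⊞ cst K 1#  ≈⟨ mapₚ-compose (2 ℕ.^ suc (s′ ℕ.+ r)) d ⟨
      _                                                        ∎
      where
      open SetoidReasoning P.setoid
      module Xᴱ = Exp P.commutativeSemiring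
      -- Comparison of degrees: 4md · 2^(s-2) = d · 2^(s+r-1) with m = 2^(r-1).
      exponent : m ℕ.* d ℕ.* 4 ℕ.* 2 ℕ.^ s′ ≡ d ℕ.* 2 ℕ.^ suc (s′ ℕ.+ r)
      exponent = ≡.trans (solve 3 (λ m d n → m :* d :* con 4 :* n := d :* (con 2 :* (n :* (con 2 :* m)))) ≡.refl m d (2 ℕ.^ s′))
        (≡.cong (λ e → d ℕ.* (2 ℕ.* e)) (≡.sym (ℕₚ.^-distribˡ-+-* 2 s′ r)))
        where open +-*-Solver
      z≐ : z ≐ pow polyRing X (m ℕ.* d)
      z≐ = ≐-trans (Xᴱ.^-congˡ d (Xpow≐X^ m)) (Xᴱ.^-assocʳ X m d)
      Y≐ : Y ≐ pow polyRing X (m ℕ.* d ℕ.* 4)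
      Y≐ = ≐-trans (⊠-assoc z z (z ⊠ z))
        (≐-trans (⊠-cong (≐-refl {z}) (⊠-cong (≐-refl {z}) (⊠-cong (≐-refl {z}) (≐-sym (P.*-identityʳ z)))))
        (≐-trans (Xᴱ.^-congˡ 4 z≐) (Xᴱ.^-assocʳ X (m ℕ.* d) 4)))
      Y^ : pow polyRing Y (2 ℕ.^ s′) ≐ pow polyRing (Xpow K d) (2 ℕ.^ suc (s′ ℕ.+ r))
      Y^ = ≐-trans (Xᴱ.^-congˡ (2 ℕ.^ s′) Y≐)
        (≐-trans (Xᴱ.^-assocʳ X (m ℕ.* d ℕ.* 4) (2 ℕ.^ s′))
        (≐-trans (Xᴱ.^-congʳ X exponent)
        (≐-trans (≐-sym (Xᴱ.^-assocʳ X d (2 ℕ.^ suc (s′ ℕ.+ r))))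
          (Xᴱ.^-congˡ (2 ℕ.^ suc (s′ ℕ.+ r)) (≐-sym (Xpow≐X^ d))))))

    irreducibleII : All (MonicIrreducibleOver F K ι) (factorsII r)
    irreducibleII = All-concatMap-oneTo block (2 ℕ.^ s′) λ i _ → Allₚ.++⁺
      -- `binomial-factor` covers constant terms -w² only; the plus sign is reached by i₄w, whose
      -- square is -w².
      (binomial-factor r′ (i₄ F.* x i) (i₄x≉0 i)
        (trans (αₛ^≈ (suc i)) (trans (sym ([i₄w]²≈ (suc i))) (-‿cong (*-cong (i₄w≈ i) (i₄w≈ i))))) ∷
       binomial-factor r′ (x i) (x≉0 i) (-‿cong (trans (αₛ^≈ (suc i)) (*-cong (w≈ i) (w≈ i)))) ∷ [])
      (All-concatMap-oneTo (trinomials (suc i)) ⌊ h ℕ.+ h /2⌋ λ j _ → pairFactors i (suc j))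
      where
      negate : ∀ y v → v ≈ - (ι y * β * (ι y * β)) → v ≈ - (ι (F.- y) * β * (ι (F.- y) * β))
      negate y v v≈ = trans v≈ (-‿cong (sym (trans (*-cong e e) (-x*-y≈xy _ _))))
        where
        e : ι (F.- y) * β ≈ - (ι y * β)
        e = trans (*-congʳ (-‿homo y)) (sym (-‿distribˡ-* (ι y) β))
      ±θ-factor : ∀ {U V} j y → ¬ (y F.≈ F.0#) → U ≈ ι y * β * (γ ^ j - γ̄ ^ j) → V ≈ - (ι y * β * (ι y * β)) →
        All (MonicIrreducibleOver F K ι) (pmTri K (2 ℕ.* m) m U V)
      ±θ-factor {U} {V} j y y≉0 U≈ V≈ =
        θ-factor r′ y (γ ^ j) (γ̄ ^ j) y≉0 ([γ^j]^d≈1 j) (γ^jγ̄^j≈1 j) U≈ V≈ ∷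
        θ-factor r′ (F.- y) (γ ^ j) (γ̄ ^ j) (neg≉0 y≉0) ([γ^j]^d≈1 j) (γ^jγ̄^j≈1 j)
          (trans (-‿cong U≈) (trans (-‿distribˡ-* _ _) (*-congʳ (trans (-‿distribˡ-* (ι y) β) (*-congʳ (sym (-‿homo y)))))))
          (negate y V V≈) ∷ []
      pairFactors : ∀ i j → All (MonicIrreducibleOver F K ι) (trinomials (suc i) j)
      pairFactors i j = Allₚ.++⁺
        (±θ-factor j (x i) (x≉0 i)
          (trans (coefficient₀ (suc i) j) (*-congʳ (w≈ i)))
          (trans (constant₀ (suc i)) (-‿cong (*-cong (w≈ i) (w≈ i)))))
        (±θ-factor j (i₄ F.* x i) (i₄x≉0 i)
          (trans (coefficient₁ (suc i) j) (*-congʳ (i₄w≈ i)))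
          (trans (constant₁ (suc i)) (trans (sym ([i₄w]²≈ (suc i))) (-‿cong (*-cong (i₄w≈ i) (i₄w≈ i))))))

-- The power of 2 in q - 1, and powers of α equal to -1

odd⇒1+2h : ∀ n → n % 2 ≡ 1 → ∃ λ h → n ≡ suc (h ℕ.+ h)
odd⇒1+2h n n%2≡1 = n / 2 , ≡.trans (m≡m%n+[m/n]*n n 2)
  (≡.cong₂ ℕ._+_ n%2≡1 (≡.trans (ℕₚ.*-comm (n / 2) 2) (≡.cong (n / 2 ℕ.+_) (ℕₚ.+-identityʳ (n / 2)))))

private
  -- An even cofactor would contribute one more factor 2, against maximality.
  exactPower-odd : ∀ {s m} t → m ≡ t ℕ.* 2 ℕ.^ s → ¬ (2 ℕ.^ suc s ∣ m) → t % 2 ≡ 1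
  exactPower-odd {s} {m} t m≡ maximal with t % 2 in eq | m%n<n t 2
  ... | zero        | _              = ⊥-elim (maximal (divides (t / 2) (≡.trans m≡ (≡.trans
      (≡.cong (ℕ._* 2 ℕ.^ s) (≡.trans (m≡m%n+[m/n]*n t 2) (≡.cong (ℕ._+ t / 2 ℕ.* 2) eq)))
      (ℕₚ.*-assoc (t / 2) 2 (2 ℕ.^ s))))))
  ... | suc zero    | _              = ≡.refl
  ... | suc (suc _) | s≤s (s≤s ())

-- As 4 divides q - 1, the values s = 0 and s = 1 violate maximality. For s ≥ 2 the cofactor of 2^s
-- is odd, which gives q = 1 + 4C with C = 2^(s-2)(2t + 1).
exact-power-of-2 : ∀ q s → q % 4 ≡ 1 → 2 ℕ.^ s ∣ q ℕ.∸ 1 → ¬ (2 ℕ.^ suc s ∣ q ℕ.∸ 1) →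
  ∃₂ λ s′ t → s ≡ suc (suc s′) × q ≡ suc (2 ℕ.* (2 ℕ.* (2 ℕ.^ s′ ℕ.* suc (t ℕ.+ t))))
exact-power-of-2 q s q%4≡1 2^s∣ maximal = go s 2^s∣ maximal
  where
  q≡ : q ≡ suc (q / 4 ℕ.* 4)
  q≡ = ≡.trans (m≡m%n+[m/n]*n q 4) (≡.cong (ℕ._+ q / 4 ℕ.* 4) q%4≡1)
  4∣ : 4 ∣ q ℕ.∸ 1
  4∣ = divides (q / 4) (≡.cong ℕ.pred q≡)
  go : ∀ s → 2 ℕ.^ s ∣ q ℕ.∸ 1 → ¬ (2 ℕ.^ suc s ∣ q ℕ.∸ 1) →
    ∃₂ λ s′ t → s ≡ suc (suc s′) × q ≡ suc (2 ℕ.* (2 ℕ.* (2 ℕ.^ s′ ℕ.* suc (t ℕ.+ t))))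
  go zero       _ maximal = ⊥-elim (maximal (∣-trans (divides 2 ≡.refl) 4∣))
  go (suc zero) _ maximal = ⊥-elim (maximal 4∣)
  go (suc (suc s′)) (divides t q-1≡) maximal =
    let t′ , t≡ = odd⇒1+2h t (exactPower-odd {suc (suc s′)} t q-1≡ maximal) in
    s′ , t′ , ≡.refl , ≡.trans q≡ (≡.cong suc (≡.trans (≡.cong ℕ.pred (≡.sym q≡)) (≡.trans q-1≡ (≡.trans
      (solve 2 (λ t n → t :* (con 2 :* (con 2 :* n)) := con 2 :* (con 2 :* (n :* t))) ≡.refl t (2 ℕ.^ s′))
      (≡.cong (λ t → 2 ℕ.* (2 ℕ.* (2 ℕ.^ s′ ℕ.* t))) t≡)))))
    where open +-*-Solver

module PrimitiveRoot {c ℓ : Level} (F : CommutativeRing c ℓ) (noZeroDiv : NoZeroDivisors F) (s : ℕ)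
  (α : CommutativeRing.Carrier F) (α-primitive : IsPrimitiveRoot F (2 ℕ.^ suc s) α) where
  open CommutativeRing F
  open RingProperties ring using (x∙y⁻¹≈ε⇒x≈y; +-inverseˡ-unique)
  open Exp commutativeSemiring using (_^_; ^-congˡ; ^-homo-*; ^-assocʳ)
  open CommutativeRingProperties F
  open Products F using ([y+t][y-t])
  open SetoidReasoning setoid

  private
    x : Carrier
    x = α ^ (2 ℕ.^ s)

    x≉1 : ¬ (x ≈ 1#)
    x≉1 = proj₂ α-primitive (2 ℕ.^ s) (ℕₚ.m^n>0 2 s) (ℕₚ.^-monoʳ-< 2 (s≤s (s≤s z≤n)) (ℕₚ.n<1+n s))

    [x+1][x-1]≈0 : (x + 1#) * (x - 1#) ≈ 0#
    [x+1][x-1]≈0 = begin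
      (x + 1#) * (x - 1#)                 ≈⟨ [y+t][y-t] x 1# ⟩
      x * x - 1# * 1#                     ≈⟨ +-cong (^-homo-* α (2 ℕ.^ s) (2 ℕ.^ s)) (-‿cong (sym (*-identityˡ 1#))) ⟨
      α ^ (2 ℕ.^ s ℕ.+ 2 ℕ.^ s) - 1#      ≈⟨ +-congʳ (trans (sym (^-2* α (2 ℕ.^ s))) (proj₁ α-primitive)) ⟩
      1# - 1#                             ≈⟨ -‿inverseʳ 1# ⟩
      0#                                  ∎

  -- The element x squares to 1 but is not 1, by primitivity; without zero divisors only -1 remains.
  half-power : x ≈ - 1#
  half-power with noZeroDiv (x + 1#) (x - 1#) [x+1][x-1]≈0
  ... | inj₁ e = +-inverseˡ-unique x 1# e
  ... | inj₂ e = ⊥-elim (x≉1 (x∙y⁻¹≈ε⇒x≈y x 1# e))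

  -- Odd characteristic is read off from the order of α: its half power is both -1 and different
  -- from 1.
  -1≉1 : ¬ (- 1# ≈ 1#)
  -1≉1 e = x≉1 (trans half-power e)

  odd-multiple-power : ∀ t → α ^ (2 ℕ.^ s ℕ.* suc (t ℕ.+ t)) ≈ - 1#
  odd-multiple-power t = begin
    α ^ (2 ℕ.^ s ℕ.* suc (t ℕ.+ t))      ≈⟨ ^-assocʳ α (2 ℕ.^ s) (suc (t ℕ.+ t)) ⟨
    x ^ suc (t ℕ.+ t)                    ≈⟨ ^-congˡ (suc (t ℕ.+ t)) half-power ⟩
    (- 1#) ^ suc (t ℕ.+ t)               ≈⟨ -1^odd≈-1 t ⟩
    - 1#                                 ∎

open import Data.Nat.Base using (_+_; _*_; _^_; _∸_)

theorem3p2 : {c ℓ : Level} (F K : CommutativeRing c ℓ) (q d s : ℕ) →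
    IsPrimePower q → q % 4 ≡ 1 →
    d % 2 ≡ 1 → d ∣ suc q →
    (2 ^ s) ∣ (q ∸ 1) → ¬ ((2 ^ suc s) ∣ (q ∸ 1)) →
    IsField F → HasCard F q →
    IsField K → HasCard K (q ^ 2) →
    (ι : CommutativeRing.Carrier F → CommutativeRing.Carrier K) →
    RingMorphisms.IsRingHomomorphism (CommutativeRing.rawRing F) (CommutativeRing.rawRing K) ι →
    (α2s : CommutativeRing.Carrier F) → IsPrimitiveRoot F (2 ^ s) α2s →
    (β : CommutativeRing.Carrier K) → CommutativeRing._≈_ K (pow K β 2) (ι α2s) →
    (γ : CommutativeRing.Carrier K) → IsPrimitiveRoot K d γ →
    let open Factors K q d s (ι α2s) β γ in
    ((k : ℕ) → 2 ≤ k → k ≤ s →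
    (length (factorsI k) ≡ 2 ^ (k ∸ 2) * (d + 1))
    × _≋_ K (prodₚ K (factorsI k)) (mapₚ F K ι (compose F (cyclo2pow F k) (Xpow F d)))
    × All (MonicIrreducibleOver F K ι) (factorsI k))
    × ((r : ℕ) → 1 ≤ r →
    (length (factorsII r) ≡ 2 ^ (s ∸ 1) * d)
    × _≋_ K (prodₚ K (factorsII r)) (mapₚ F K ι (compose F (cyclo2pow F (s + r)) (Xpow F d)))
    × All (MonicIrreducibleOver F K ι) (factorsII r))
theorem3p2 F K q d s _ q%4≡1 d%2≡1 d∣1+q 2^s∣q-1 2^[1+s]∤q-1 F-field F-card K-field K-card ι ι-hom α α-primitive β β²≈α γ γ-primitive
  with odd⇒1+2h d d%2≡1 | exact-power-of-2 q s q%4≡1 2^s∣q-1 2^[1+s]∤q-1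
-- Matching puts d, s and q into the forms 2h + 1, s′ + 2 and 1 + 4C in which the factorisations are
-- proved.
... | h , ≡.refl | s′ , t , ≡.refl , ≡.refl = partI , partII
  where
  module K = CommutativeRing K
  open PrimitiveRoot F (field⇒noZeroDivisors F F-field (FiniteRing.finite-discrete F F-card)) (suc s′) α α-primitive
  α^2C≈-1 : CommutativeRing._≈_ F (pow F α (2 * (2 ^ s′ * suc (t + t)))) (CommutativeRing.-_ F (CommutativeRing.1# F))
  α^2C≈-1 = ≡.subst (λ n → CommutativeRing._≈_ F (pow F α n) (CommutativeRing.-_ F (CommutativeRing.1# F)))
    (ℕₚ.*-assoc 2 (2 ^ s′) (suc (t + t))) (odd-multiple-power t)
  open Factorisation F K (2 ^ s′ * suc (t + t)) h s′ F-field F-card K-field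
    -- The square q ^ 2 unfolds to q * (q * 1).
    (≡.subst (HasCard K) (≡.cong (q *_) (ℕₚ.*-identityʳ q)) K-card) ι ι-hom α half-power α^2C≈-1 -1≉1
    β (K.trans (K.*-congˡ (K.sym (K.*-identityʳ β))) β²≈α) d∣1+q γ γ-primitive
    using (module PartI; module PartII)
  open Factors K q d s (ι α) β γ using (factorsI; factorsII)
  partI : (k : ℕ) → 2 ≤ k → k ≤ s →
      (length (factorsI k) ≡ 2 ^ (k ∸ 2) * (d + 1))
    × _≋_ K (prodₚ K (factorsI k)) (mapₚ F K ι (compose F (cyclo2pow F k) (Xpow F d)))
    × All (MonicIrreducibleOver F K ι) (factorsI k)
  partI (suc zero)     (s≤s ()) _
  partI (suc (suc k′)) _ k≤s = lengthI , Polynomials.at productI , irreducibleI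
    where open PartI k′ k≤s
  partII : (r : ℕ) → 1 ≤ r →
      (length (factorsII r) ≡ 2 ^ (s ∸ 1) * d)
    × _≋_ K (prodₚ K (factorsII r)) (mapₚ F K ι (compose F (cyclo2pow F (s + r)) (Xpow F d)))
    × All (MonicIrreducibleOver F K ι) (factorsII r)
  partII (suc r′) _ = lengthII , Polynomials.at productII , irreducibleII
    where open PartII r′
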